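{- Let $n\geq 6$ be an integer such that $p=(2n-1)(2n+1)$, $q=(2n-1)(2n+3)$ and $r=(2n+1)(2n+3)$ are square-free integers, and let $K=\mathbb{Q}(\sqrt{p},\sqrt{q})$. If $\alpha\in\mathcal{O}_K^{+}$ is indecomposable in $\mathcal{O}_K$, then $\min_{\delta\in\mathcal{O}_K^{\vee,+}}\mathrm{Tr}(\alpha\delta)\leq 2$.
   Context: $\mathcal{O}_K$ is the ring of integers of $K$; $\mathcal{O}_K^{+}$ is the set of totally positive elements of $\mathcal{O}_K$. An element $\alpha\in\mathcal{O}_K^{+}$ is indecomposable if it cannot be written as $\beta+\gamma$ with $\beta,\gamma\in\mathcal{O}_K^{+}$. The codifferent is $\mathcal{O}_K^{\vee}=\{\delta\in K:\mathrm{Tr}(\alpha\delta)\in\mathbb{Z}\text{ for all }\alpha\in\mathcal{O}_K\}$, and $\mathcal{O}_K^{\vee,+}$ is the set of its totally positive elements; $\mathrm{Tr}$ is the trace $K\to\mathbb{Q}$. -}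

module Defs where

open import Data.Nat as ℕ using (ℕ)
open import Data.Nat.Divisibility using (_∣_)
open import Data.Integer as ℤ using (ℤ; +_)
open import Data.Rational as ℚ using (ℚ; 0ℚ; 1ℚ; _/_)
open import Data.Bool using (Bool; true; false)
open import Data.List using (List; []; _∷_)
open import Data.Product using (Σ; ∃; ∃-syntax; _×_; _,_)
open import Data.Sum using (_⊎_)
open import Relation.Nullary using (¬_)
open import Relation.Binary.PropositionalEquality using (_≡_)

SquareFree : ℕ → Set
SquareFree m = ∀ (d : ℕ) → 2 ℕ.≤ d → ¬ ((d ℕ.* d) ∣ m)

m₁ m₂ m₃ : ℕ → ℕ
m₁ n = 2 ℕ.* n ℕ.∸ 1
m₂ n = 2 ℕ.* n ℕ.+ 1
m₃ n = 2 ℕ.* n ℕ.+ 3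

pN qN rN : ℕ → ℕ
pN n = m₁ n ℕ.* m₂ n
qN n = m₁ n ℕ.* m₃ n
rN n = m₂ n ℕ.* m₃ n

ℕ→ℚ : ℕ → ℚ
ℕ→ℚ k = (+ k) / 1

ℤ→ℚ : ℤ → ℚ
ℤ→ℚ z = z / 1

-- K = ℚ(√p, √q), p = m₁m₂, q = m₁m₃, r = m₂m₃.
-- An element  a + b√p + c√q + d√r  (a,b,c,d ∈ ℚ) is stored as a record.
-- Here √p, √q, √r denote the positive real square roots, so that
-- √p√q = m₁√r, √p√r = m₂√q, √q√r = m₃√p.

record K : Set where
  constructor ⟨_,_,_,_⟩
  field
    a b c d : ℚ
open K public

module _ (n : ℕ) where

  private
    M₁ = ℕ→ℚ (m₁ n)
    M₂ = ℕ→ℚ (m₂ n)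
    M₃ = ℕ→ℚ (m₃ n)
    P  = ℕ→ℚ (pN n)
    Q  = ℕ→ℚ (qN n)
    R  = ℕ→ℚ (rN n)

  infixl 6 _⊕_
  infixl 7 _⊛_

  _⊕_ : K → K → K
  x ⊕ y = ⟨ a x ℚ.+ a y , b x ℚ.+ b y , c x ℚ.+ c y , d x ℚ.+ d y ⟩

  _⊛_ : K → K → K
  x ⊛ y = ⟨ a x ℚ.* a y ℚ.+ P ℚ.* (b x ℚ.* b y) ℚ.+ Q ℚ.* (c x ℚ.* c y) ℚ.+ R ℚ.* (d x ℚ.* d y)
          , a x ℚ.* b y ℚ.+ b x ℚ.* a y ℚ.+ M₃ ℚ.* (c x ℚ.* d y ℚ.+ d x ℚ.* c y)
          , a x ℚ.* c y ℚ.+ c x ℚ.* a y ℚ.+ M₂ ℚ.* (b x ℚ.* d y ℚ.+ d x ℚ.* b y)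
          , a x ℚ.* d y ℚ.+ d x ℚ.* a y ℚ.+ M₁ ℚ.* (b x ℚ.* c y ℚ.+ c x ℚ.* b y) ⟩

  embℤ : ℤ → K
  embℤ z = ⟨ ℤ→ℚ z , 0ℚ , 0ℚ , 0ℚ ⟩

  oneK zeroK : K
  oneK = ⟨ 1ℚ , 0ℚ , 0ℚ , 0ℚ ⟩
  zeroK = ⟨ 0ℚ , 0ℚ , 0ℚ , 0ℚ ⟩

  -- Value at x of the monic integer polynomial
  --   X^k + c_{k-1} X^{k-1} + ... + c_0,  coefficients given as [c_0, ..., c_{k-1}].
  evalMonic : List ℤ → K → K
  evalMonic []       x = oneK
  evalMonic (z ∷ zs) x = embℤ z ⊕ (x ⊛ evalMonic zs x)

  InOK : K → Set
  InOK x = ∃[ cs ] (evalMonic cs x ≡ zeroK)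

  -- u = u₀ + u₁√p  ∈ ℚ(√p)
  Pos₁ : ℚ × ℚ → Set
  Pos₁ (u₀ , u₁) =
      (0ℚ ℚ.< u₀ × 0ℚ ℚ.≤ u₁)
    ⊎ (0ℚ ℚ.≤ u₀ × 0ℚ ℚ.< u₁)
    ⊎ (0ℚ ℚ.< u₀ × u₁ ℚ.< 0ℚ × P ℚ.* (u₁ ℚ.* u₁) ℚ.< u₀ ℚ.* u₀)
    ⊎ (u₀ ℚ.< 0ℚ × 0ℚ ℚ.< u₁ × u₀ ℚ.* u₀ ℚ.< P ℚ.* (u₁ ℚ.* u₁))

  Zero₁ : ℚ × ℚ → Set
  Zero₁ (u₀ , u₁) = (u₀ ≡ 0ℚ) × (u₁ ≡ 0ℚ)

  NonNeg₁ : ℚ × ℚ → Set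
  NonNeg₁ u = Pos₁ u ⊎ Zero₁ u

  neg₁ : ℚ × ℚ → ℚ × ℚ
  neg₁ (u₀ , u₁) = (ℚ.- u₀ , ℚ.- u₁)

  Neg₁ : ℚ × ℚ → Set
  Neg₁ u = Pos₁ (neg₁ u)

  mul₁ : ℚ × ℚ → ℚ × ℚ → ℚ × ℚ
  mul₁ (u₀ , u₁) (v₀ , v₁) = (u₀ ℚ.* v₀ ℚ.+ P ℚ.* (u₁ ℚ.* v₁) , u₀ ℚ.* v₁ ℚ.+ u₁ ℚ.* v₀)

  sub₁ : ℚ × ℚ → ℚ × ℚ → ℚ × ℚ
  sub₁ (u₀ , u₁) (v₀ , v₁) = (u₀ ℚ.- v₀ , u₁ ℚ.- v₁)

  scale₁ : ℚ → ℚ × ℚ → ℚ × ℚ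
  scale₁ s (u₀ , u₁) = (s ℚ.* u₀ , s ℚ.* u₁)

  -- u + v√q > 0  with u, v ∈ ℚ(√p)
  Pos₂ : ℚ × ℚ → ℚ × ℚ → Set
  Pos₂ u v =
      (Pos₁ u × NonNeg₁ v)
    ⊎ (NonNeg₁ u × Pos₁ v)
    ⊎ (Pos₁ u × Neg₁ v × Pos₁ (sub₁ (mul₁ u u) (scale₁ Q (mul₁ v v))))
    ⊎ (Neg₁ u × Pos₁ v × Pos₁ (sub₁ (scale₁ Q (mul₁ v v)) (mul₁ u u)))

  -- x = a + b√p + c√q + d√r is a positive real number.  Since √r = √p√q/m₁,
  -- m₁·x = (m₁a + m₁b√p) + (m₁c + d√p)√q, and m₁ > 0 for n ≥ 1.
  PosReal : K → Set
  PosReal x = Pos₂ (M₁ ℚ.* a x , M₁ ℚ.* b x) (M₁ ℚ.* c x , d x)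

  -- The four embeddings K → ℝ:  √p ↦ ±√p, √q ↦ ±√q (hence √r ↦ ±√r).
  sgn : Bool → ℚ → ℚ
  sgn true  u = u
  sgn false u = ℚ.- u

  σ : Bool → Bool → K → K
  σ s t x = ⟨ a x , sgn s (b x) , sgn t (c x) , sgn s (sgn t (d x)) ⟩

  TotPos : K → Set
  TotPos x = ∀ (s t : Bool) → PosReal (σ s t x)

  InOK⁺ : K → Set
  InOK⁺ x = InOK x × TotPos x

  Indecomposable : K → Set
  Indecomposable α = InOK⁺ α × ¬ (∃[ β ] ∃[ γ ] (InOK⁺ β × InOK⁺ γ × α ≡ β ⊕ γ))

  -- Trace K → ℚ: the sum of the four conjugates, which is 4a.
  Tr : K → ℚ
  Tr x = ℕ→ℚ 4 ℚ.* a x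

  IsInteger : ℚ → Set
  IsInteger u = ∃[ z ] (u ≡ ℤ→ℚ z)

  InCodiff : K → Set
  InCodiff δ = ∀ (β : K) → InOK β → IsInteger (Tr (β ⊛ δ))

  InCodiff⁺ : K → Set
  InCodiff⁺ δ = InCodiff δ × TotPos δ

{-# OPTIONS --safe #-}

-- Write m₁, m₂, m₃ for 2n − 1, 2n + 1, 2n + 3. The boundary of the convex hull of O_K⁺ (the Klein polyhedron)
-- has, up to units and Galois conjugation, two facets: the simplex with vertices 1, ε_p, ε_q, ε_p ε_q, and a
-- polytope joining two hexagons. Their supporting functionals are α ↦ Tr(αδ) for the totally positive codifferent elements
--   ¼(1 − √(m₁/m₂))(1 − √(m₁/m₃))  and  ¼(1 − √(m₁/m₂))(1 − √(m₂/m₃)).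
-- Given α, descend on the integer Tr(αδ): if α violates an inequality of the cone over the current facet, then a symmetry
-- x ↦ u σ(x), with u a totally positive unit, carries the neighbouring facet to one of the two, and the trace decreases.
-- Once α lies in the cone over the facet, either Tr(αδ) ≤ 2, or a lattice point of the facet can be subtracted from α
-- without leaving the cone, so that α is decomposable.
module Submission where

open import Defs
open import Data.Nat using (ℕ; _≤_)
open import Data.Rational as ℚ using (ℚ)
open import Data.Product using (∃-syntax; _×_)
open import Algebra.Bundles using (CommutativeRing)
open import Algebra.Consequences.Propositional using (comm∧idˡ⇒id; comm∧invˡ⇒inv; comm∧distrˡ⇒distrʳ)
open import Algebra.Definitions using (Associative; Commutative; LeftIdentity; LeftInverse; _DistributesOverˡ_)
import Algebra.Properties.Ring as RingProperties
import Algebra.Properties.Semiring.Mult as Mult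
import Algebra.Solver.Ring as RingSolver
import Algebra.Solver.Ring.AlmostCommutativeRing as ACR
open import Algebra.Structures using (IsCommutativeRing)
open import Data.Bool using (Bool; true; false)
open import Data.Empty using (⊥-elim)
open import Data.Fin using (zero; suc) renaming (#_ to fin)
open import Data.Integer as ℤ using (ℤ; +_; -[1+_]; _⊖_)
open import Data.Integer.DivMod using (a≡a%ℕn+[a/ℕn]*n; n%ℕd<d) renaming (_/ℕ_ to _divℕ_; _%ℕ_ to _modℕ_)
import Data.Integer.Properties as ℤ
open import Data.List using (List; []; _∷_; length)
open import Data.Maybe using (Maybe; just; nothing)
open import Data.Nat as ℕ using (zero; suc; z≤n; s≤s)
open import Data.Nat.Coprimality as Coprime using (Coprime; coprime-divisor)
open import Data.Nat.Divisibility using (_∣_; _∣?_; divides; *-cancelˡ-∣; ∣-trans; m∣m*n; *-pres-∣)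
open import Data.Nat.Induction using (<-wellFounded)
import Data.Nat.Properties as ℕ
open import Data.Product using (_,_; proj₁; proj₂)
open import Data.Rational using (mkℚ; 0ℚ; 1ℚ; ½; ↥_; ↧_; ↧ₙ_; toℚᵘ)
import Data.Rational.Properties as ℚ
open import Data.Rational.Unnormalised as ℚᵘ using (ℚᵘ; mkℚᵘ; *≡*)
import Data.Rational.Unnormalised.Properties as ℚᵘ
open import Data.Sign as Sign using (Sign)
import Data.Sign.Properties as Sign
open import Data.Sum as Sum using (_⊎_; inj₁; inj₂; [_,_]′)
open import Data.Vec as Vec using (Vec; []; _∷_; lookup; tabulate)
open import Data.Vec.N-ary using (N-ary; _$ⁿ_)
import Data.Vec.Properties as Vec
open import Induction.WellFounded using (Acc; acc)
open import Level using (0ℓ)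
open import Relation.Binary.Definitions using (tri<; tri≈; tri>)
open import Relation.Binary.PropositionalEquality as ≡ using (_≡_; refl; sym; trans; cong; cong₂; subst)
import Relation.Binary.Reasoning.Setoid as SetoidReasoning
open import Relation.Nullary using (¬_; Dec; yes; no)
open import Relation.Nullary.Decidable using (False; toWitnessFalse)

-- The shape of the Klein polyhedron is never proved. What is used of it is that the vertices of the
-- two facets are totally positive and that the two functionals are integral on O_K and positive on
-- O_K⁺; the latter makes the descent stop. The bound 2 has the same origin at both facets. The
-- trace of an element of the cone is a sum of two non-negative integers: the heights over the two
-- hexagons, or the sums of opposite coordinates in the simplex. As soon as one summand reaches 2,
-- some vertex can be subtracted. The obstacle is uniformity in n. Coordinates are chosen in which
-- walls, vertices and symmetries are polynomial in n, so that each inequality is a combination of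
-- known ones with non-negative coefficients, checked as a polynomial identity. No real numbers
-- occur: positivity is read off from norms in the tower ℚ, ℚ(√p), K. Integrality, given by a monic
-- polynomial, is replaced by boundedness of the denominators of all powers, which passes to sums
-- and products without resultants.

-- A ring solver with integer coefficients for any commutative ring.

module RingSolving where

  -- Coefficients live in ℤ, where equality is decidable, and are mapped into R; thus identities can
  -- be normalised in rings whose own equality is not decided.
  module IntegerCoefficients (R : CommutativeRing 0ℓ 0ℓ) where
    open CommutativeRing R renaming (refl to ≈-refl; sym to ≈-sym; trans to ≈-trans)
    open RingProperties ring
    open Mult semiring renaming (_×_ to _×′_)
    open SetoidReasoning setoid

    fromℤ : ℤ → Carrier
    fromℤ (+ k)    = k ×′ 1#
    fromℤ -[1+ k ] = - (suc k ×′ 1#)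

    fromℤ-⊖ : ∀ k l → fromℤ (k ⊖ l) ≈ k ×′ 1# - l ×′ 1#
    fromℤ-⊖ k zero = begin
      k ×′ 1#              ≈⟨ +-identityʳ _ ⟨
      k ×′ 1# + 0#         ≈⟨ +-congˡ -0#≈0# ⟨
      k ×′ 1# - 0#         ∎
    fromℤ-⊖ zero (suc l) = ≈-sym (+-identityˡ _)
    fromℤ-⊖ (suc k) (suc l) = begin
      fromℤ (suc k ⊖ suc l)                    ≡⟨ ≡.cong fromℤ (ℤ.[1+m]⊖[1+n]≡m⊖n k l) ⟩
      fromℤ (k ⊖ l)                            ≈⟨ fromℤ-⊖ k l ⟩
      k ×′ 1# - l ×′ 1#                          ≈⟨ +-congˡ (+-identityˡ _) ⟨
      k ×′ 1# + (0# - l ×′ 1#)                   ≈⟨ +-congˡ (+-congʳ (-‿inverseʳ 1#)) ⟨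
      k ×′ 1# + ((1# - 1#) - l ×′ 1#)            ≈⟨ +-congˡ (+-assoc _ _ _) ⟩
      k ×′ 1# + (1# + (- 1# - l ×′ 1#))          ≈⟨ +-assoc _ _ _ ⟨
      (k ×′ 1# + 1#) + (- 1# - l ×′ 1#)          ≈⟨ +-cong (+-comm _ _) (-‿+-comm _ _) ⟩
      (1# + k ×′ 1#) - (1# + l ×′ 1#)            ∎

    fromℤ-+ : ∀ k l → fromℤ (k ℤ.+ l) ≈ fromℤ k + fromℤ l
    fromℤ-+ (+ k)    (+ l)    = ×-homo-+ 1# k l
    fromℤ-+ (+ k)    -[1+ l ] = fromℤ-⊖ k (suc l)
    fromℤ-+ -[1+ k ] (+ l)    = ≈-trans (fromℤ-⊖ l (suc k)) (+-comm _ _)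
    fromℤ-+ -[1+ k ] -[1+ l ] = begin
      - (suc (suc (k ℕ.+ l)) ×′ 1#)             ≡⟨ ≡.cong (λ t → - (suc t ×′ 1#)) (ℕ.+-suc k l) ⟨
      - ((suc k ℕ.+ suc l) ×′ 1#)               ≈⟨ -‿cong (×-homo-+ 1# (suc k) (suc l)) ⟩
      - (suc k ×′ 1# + suc l ×′ 1#)              ≈⟨ -‿+-comm _ _ ⟨
      - (suc k ×′ 1#) - suc l ×′ 1#              ∎

    fromℤ-neg : ∀ k → fromℤ (ℤ.- k) ≈ - fromℤ k
    fromℤ-neg (+ zero)  = ≈-sym -0#≈0#
    fromℤ-neg (+ suc k) = ≈-refl
    fromℤ-neg -[1+ k ]  = ≈-sym (-‿involutive _)

    fromℤ-* : ∀ k l → fromℤ (k ℤ.* l) ≈ fromℤ k * fromℤ l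
    fromℤ-*⁺ : ∀ k l → fromℤ (+ k ℤ.* l) ≈ fromℤ (+ k) * fromℤ l
    fromℤ-*⁺ k (+ l) = begin
      fromℤ (+ k ℤ.* + l)     ≡⟨ ≡.cong fromℤ (≡.sym (ℤ.pos-* k l)) ⟩
      (k ℕ.* l) ×′ 1#          ≈⟨ ×1-homo-* k l ⟩
      (k ×′ 1#) * (l ×′ 1#)     ∎
    fromℤ-*⁺ k -[1+ l ] = begin
      fromℤ (+ k ℤ.* ℤ.- (+ suc l))      ≡⟨ ≡.cong fromℤ (ℤ.neg-distribʳ-* (+ k) (+ suc l)) ⟨
      fromℤ (ℤ.- (+ k ℤ.* + suc l))      ≈⟨ fromℤ-neg (+ k ℤ.* + suc l) ⟩
      - fromℤ (+ k ℤ.* + suc l)          ≈⟨ -‿cong (fromℤ-*⁺ k (+ suc l)) ⟩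
      - (fromℤ (+ k) * fromℤ (+ suc l))  ≈⟨ -‿distribʳ-* _ _ ⟩
      fromℤ (+ k) * - fromℤ (+ suc l)    ∎
    fromℤ-* (+ k) l = fromℤ-*⁺ k l
    fromℤ-* -[1+ k ] l = begin
      fromℤ (ℤ.- (+ suc k) ℤ.* l)        ≡⟨ ≡.cong fromℤ (ℤ.neg-distribˡ-* (+ suc k) l) ⟨
      fromℤ (ℤ.- (+ suc k ℤ.* l))        ≈⟨ fromℤ-neg (+ suc k ℤ.* l) ⟩
      - fromℤ (+ suc k ℤ.* l)            ≈⟨ -‿cong (fromℤ-*⁺ (suc k) l) ⟩
      - (fromℤ (+ suc k) * fromℤ l)      ≈⟨ -‿distribˡ-* _ _ ⟩
      - fromℤ (+ suc k) * fromℤ l        ∎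

    private
      target = ACR.fromCommutativeRing R
      morphism : ℤ.+-*-rawRing ACR.-Raw-AlmostCommutative⟶ target
      morphism = record
        { ⟦_⟧ = fromℤ ; +-homo = fromℤ-+ ; *-homo = fromℤ-* ; -‿homo = fromℤ-neg
        ; 0-homo = ≈-refl ; 1-homo = +-identityʳ 1# }
      _≟′_ : ∀ k l → Maybe (fromℤ k ≈ fromℤ l)
      k ≟′ l with k ℤ.≟ l
      ... | yes eq = just (reflexive (≡.cong fromℤ eq))
      ... | no _   = nothing

    open RingSolver ℤ.+-*-rawRing target morphism _≟′_ public
      using (Polynomial; solve; prove; ⟦_⟧; ⟦_⟧↓; op; var; con; _:+_; _:*_; _:-_; :-_; _:^_; _:=_)
      renaming ([+] to plus; [*] to times)

-- Ordered rings and the order on a quadratic extension.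

module OrderedRings where
  open RingSolving

  mkIsCommutativeRing : ∀ {A : Set} {_+_ _*_ : A → A → A} {neg : A → A} {0# 1# : A}
    → Associative _≡_ _+_ → Commutative _≡_ _+_ → LeftIdentity _≡_ 0# _+_ → LeftInverse _≡_ 0# neg _+_
    → Associative _≡_ _*_ → Commutative _≡_ _*_ → LeftIdentity _≡_ 1# _*_ → _DistributesOverˡ_ _≡_ _*_ _+_
    → IsCommutativeRing _≡_ _+_ _*_ neg 0# 1#
  mkIsCommutativeRing {_+_ = _+_} {_*_} {neg} +-assoc +-comm +-idˡ +-invˡ *-assoc *-comm *-idˡ distribˡ = record
    { isRing = record
      { +-isAbelianGroup = record
        { isGroup = record
          { isMonoid = record
            { isSemigroup = record
              { isMagma = record { isEquivalence = ≡.isEquivalence ; ∙-cong = cong₂ _+_ }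
              ; assoc = +-assoc }
            ; identity = comm∧idˡ⇒id +-comm +-idˡ }
          ; inverse = comm∧invˡ⇒inv +-comm +-invˡ
          ; ⁻¹-cong = cong neg }
        ; comm = +-comm }
      ; *-cong = cong₂ _*_
      ; *-assoc = *-assoc
      ; *-identity = comm∧idˡ⇒id *-comm *-idˡ
      ; distrib = distribˡ , comm∧distrˡ⇒distrʳ *-comm distribˡ }
    ; *-comm = *-comm }

  record OrderedRing : Set₁ where
    infixl 6 _+_
    infixl 7 _*_
    infix  8 -_
    field
      Carrier : Set
      _+_ _*_ : Carrier → Carrier → Carrier
      -_      : Carrier → Carrier
      0# 1#   : Carrier
      isCommutativeRing : IsCommutativeRing _≡_ _+_ _*_ -_ 0# 1#
      Pos     : Carrier → Set
      pos-+   : ∀ {x y} → Pos x → Pos y → Pos (x + y)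
      pos-*   : ∀ {x y} → Pos x → Pos y → Pos (x * y)
      compare : ∀ x → Pos x ⊎ x ≡ 0# ⊎ Pos (- x)
      ¬pos-0  : ¬ Pos 0#

    commutativeRing : CommutativeRing 0ℓ 0ℓ
    commutativeRing = record { isCommutativeRing = isCommutativeRing }

    open CommutativeRing commutativeRing public using (_-_; ring; *-comm; +-comm; +-identityˡ; +-identityʳ)
    open IntegerCoefficients commutativeRing public using (solve; _:+_; _:*_; _:-_; :-_; _:=_; con)

    NonNeg : Carrier → Set
    NonNeg x = Pos x ⊎ x ≡ 0#

    ¬pos-neg : ∀ {x} → Pos x → ¬ Pos (- x)
    ¬pos-neg {x} p p′ = ¬pos-0 (subst Pos (solve 1 (λ x → x :+ :- x := con (+ 0)) refl x) (pos-+ p p′))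

    pos-+ʳ : ∀ {x y} → Pos x → NonNeg y → Pos (x + y)
    pos-+ʳ p (inj₁ p′) = pos-+ p p′
    pos-+ʳ {x} p (inj₂ refl) = subst Pos (sym (+-identityʳ x)) p

    nonneg-* : ∀ {x y} → NonNeg x → Pos y → NonNeg (x * y)
    nonneg-* (inj₁ p) p′ = inj₁ (pos-* p p′)
    nonneg-* {y = y} (inj₂ refl) _ = inj₂ (solve 1 (λ y → con (+ 0) :* y := con (+ 0)) refl y)

    square-nonneg : ∀ x → NonNeg (x * x)
    square-nonneg x with compare x
    ... | inj₁ p = inj₁ (pos-* p p)
    ... | inj₂ (inj₁ refl) = inj₂ (solve 0 (con (+ 0) :* con (+ 0) := con (+ 0)) refl)
    ... | inj₂ (inj₂ p) = inj₁ (subst Pos (solve 1 (λ x → (:- x) :* (:- x) := x :* x) refl x) (pos-* p p))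

    pos-cancelˡ : ∀ {x y} → Pos x → Pos (x * y) → Pos y
    pos-cancelˡ {x} {y} p p′ with compare y
    ... | inj₁ p″ = p″
    ... | inj₂ (inj₁ refl) = ⊥-elim (¬pos-0 (subst Pos (solve 1 (λ x → x :* con (+ 0) := con (+ 0)) refl x) p′))
    ... | inj₂ (inj₂ p″) = ⊥-elim (¬pos-neg p′ (subst Pos (solve 2 (λ x y → x :* (:- y) := :- (x :* y)) refl x y) (pos-* p p″)))

    -- If x + y were negative, x - y = 2x - (x + y) would be positive and x² - y² negative. This
    -- takes the place of absolute values in all sign computations below.
    dominate : ∀ {x y} → Pos x → Pos (x * x - y * y) → Pos (x + y)
    dominate {x} {y} p p′ with compare (x + y)
    ... | inj₁ p″ = p″
    ... | inj₂ (inj₁ eq) = ⊥-elim (¬pos-0 (subst Pos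
        (trans (solve 2 (λ x y → x :* x :- y :* y := (x :+ y) :* (x :- y)) refl x y)
          (trans (cong (_* (x - y)) eq) (solve 1 (λ z → con (+ 0) :* z := con (+ 0)) refl (x - y)))) p′))
    ... | inj₂ (inj₂ p″) = ⊥-elim (¬pos-neg p′ (subst Pos
        (solve 2 (λ x y → (:- (x :+ y)) :* (x :+ x :+ :- (x :+ y)) := :- (x :* x :- y :* y)) refl x y)
        (pos-* p″ (pos-+ (pos-+ p p) p″))))

  -- Anisotropy of the norm form u² - qv²: it says that q is not a square without dividing in F.
  NonSquare : (F : OrderedRing) → OrderedRing.Carrier F → Set
  NonSquare F q = ∀ u v → u * u ≡ q * (v * v) → u ≡ 0# × v ≡ 0#
    where open OrderedRing F

  module QuadraticExtension (F : OrderedRing) (q : OrderedRing.Carrier F) (q-pos : OrderedRing.Pos F q)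
    (nonsquare : NonSquare F q) where
    open OrderedRing F

    norm : Carrier → Carrier → Carrier
    norm u v = u * u - q * (v * v)

    conorm : Carrier → Carrier → Carrier
    conorm u v = q * (v * v) - u * u

    -- Since u² ≠ qv², the larger of u² and qv² decides the sign of u + v√q.
    Pos′ : Carrier → Carrier → Set
    Pos′ u v = (Pos u × Pos (norm u v)) ⊎ (Pos v × Pos (conorm u v))

    private
      -norm : ∀ u v → - norm u v ≡ conorm u v
      -norm = solve 3 (λ q u v → :- (u :* u :- q :* (v :* v)) := q :* (v :* v) :- u :* u) refl q

      q*-nonneg : ∀ v → NonNeg (q * (v * v))
      q*-nonneg v with square-nonneg v
      ... | inj₁ p = inj₁ (pos-* q-pos p)
      ... | inj₂ eq = inj₂ (trans (cong (q *_) eq) (solve 1 (λ q → q :* con (+ 0) := con (+ 0)) refl q))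

    data NormSign (u v : Carrier) : Set where
      npos  : Pos (norm u v) → NormSign u v
      nzero : u ≡ 0# → v ≡ 0# → NormSign u v
      nneg  : Pos (conorm u v) → NormSign u v

    normSign : ∀ u v → NormSign u v
    normSign u v with compare (norm u v)
    ... | inj₁ p = npos p
    ... | inj₂ (inj₁ eq) = let u≡0 , v≡0 = nonsquare u v u²≡qv² in nzero u≡0 v≡0
      where
      u²≡qv² : u * u ≡ q * (v * v)
      u²≡qv² = trans (solve 2 (λ s t → s := (s :- t) :+ t) refl (u * u) (q * (v * v)))
                 (trans (cong (_+ q * (v * v)) eq) (+-identityˡ _))
    ... | inj₂ (inj₂ p) = nneg (subst Pos (-norm u v) p)

    ¬npos∧nneg : ∀ {u v} → Pos (norm u v) → ¬ Pos (conorm u v)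
    ¬npos∧nneg {u} {v} p p′ = ¬pos-neg p (subst Pos (sym (-norm u v)) p′)

    npos⇒u≢0 : ∀ {v} → ¬ Pos (norm 0# v)
    npos⇒u≢0 {v} p = ¬pos-0 (subst Pos (solve 2 (λ q v → (con (+ 0) :* con (+ 0) :- q :* (v :* v)) :+ q :* (v :* v) := con (+ 0)) refl q v)
      (pos-+ʳ p (q*-nonneg v)))

    nneg⇒v≢0 : ∀ {u} → ¬ Pos (conorm u 0#)
    nneg⇒v≢0 {u} p = ¬pos-0 (subst Pos (solve 2 (λ q u → (q :* (con (+ 0) :* con (+ 0)) :- u :* u) :+ u :* u := con (+ 0)) refl q u)
      (pos-+ʳ p (square-nonneg u)))

    compare′ : ∀ u v → Pos′ u v ⊎ (u ≡ 0# × v ≡ 0#) ⊎ Pos′ (- u) (- v)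
    compare′ u v with normSign u v
    ... | nzero e e′ = inj₂ (inj₁ (e , e′))
    compare′ u v | npos p with compare u
    ... | inj₁ pu = inj₁ (inj₁ (pu , p))
    ... | inj₂ (inj₁ refl) = ⊥-elim (npos⇒u≢0 p)
    ... | inj₂ (inj₂ pu) = inj₂ (inj₂ (inj₁ (pu , subst Pos
        (solve 3 (λ q u v → u :* u :- q :* (v :* v) := (:- u) :* (:- u) :- q :* ((:- v) :* (:- v))) refl q u v) p)))
    compare′ u v | nneg p with compare v
    ... | inj₁ pv = inj₁ (inj₂ (pv , p))
    ... | inj₂ (inj₁ refl) = ⊥-elim (nneg⇒v≢0 p)
    ... | inj₂ (inj₂ pv) = inj₂ (inj₂ (inj₂ (pv , subst Pos
        (solve 3 (λ q u v → q :* (v :* v) :- u :* u := q :* ((:- v) :* (:- v)) :- (:- u) :* (:- u)) refl q u v) p)))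

    ¬pos′-0 : ¬ Pos′ 0# 0#
    ¬pos′-0 (inj₁ (p , _)) = ¬pos-0 p
    ¬pos′-0 (inj₂ (p , _)) = ¬pos-0 p

    -- The norm is multiplicative, so its sign tells which part of the product is the larger one.
    -- That part is a sum of two terms whose squares are compared by the two norms, and `dominate`
    -- gives its sign.
    pos′-* : ∀ {u v s t} → Pos′ u v → Pos′ s t → Pos′ (u * s + q * (v * t)) (u * t + v * s)
    pos′-* {u} {v} {s} {t} (inj₁ (pu , N)) (inj₁ (ps , N′)) = inj₁
      ( dominate (pos-* pu ps) (subst Pos
          (solve 5 (λ q u v s t → (u :* u :- q :* (v :* v)) :* (s :* s) :+ (q :* (v :* v)) :* (s :* s :- q :* (t :* t))
             := (u :* s) :* (u :* s) :- (q :* (v :* t)) :* (q :* (v :* t))) refl q u v s t)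
          (pos-+ʳ (pos-* N (pos-* ps ps)) (nonneg-* (q*-nonneg v) N′)))
      , subst Pos
          (solve 5 (λ q u v s t → (u :* u :- q :* (v :* v)) :* (s :* s :- q :* (t :* t))
             := (u :* s :+ q :* (v :* t)) :* (u :* s :+ q :* (v :* t)) :- q :* ((u :* t :+ v :* s) :* (u :* t :+ v :* s))) refl q u v s t)
          (pos-* N N′) )
    pos′-* {u} {v} {s} {t} (inj₁ (pu , N)) (inj₂ (pt , N′)) = inj₂
      ( dominate (pos-* pu pt) (pos-cancelˡ q-pos (subst Pos
          (solve 5 (λ q u v s t → (u :* u :- q :* (v :* v)) :* (q :* (t :* t)) :+ (q :* (v :* v)) :* (q :* (t :* t) :- s :* s)
             := q :* ((u :* t) :* (u :* t) :- (v :* s) :* (v :* s))) refl q u v s t)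
          (pos-+ʳ (pos-* N (pos-* q-pos (pos-* pt pt))) (nonneg-* (q*-nonneg v) N′))))
      , subst Pos
          (solve 5 (λ q u v s t → (u :* u :- q :* (v :* v)) :* (q :* (t :* t) :- s :* s)
             := q :* ((u :* t :+ v :* s) :* (u :* t :+ v :* s)) :- (u :* s :+ q :* (v :* t)) :* (u :* s :+ q :* (v :* t))) refl q u v s t)
          (pos-* N N′) )
    pos′-* {u} {v} {s} {t} x@(inj₂ _) y@(inj₁ _) = ≡.subst₂ Pos′
      (solve 5 (λ q u v s t → s :* u :+ q :* (t :* v) := u :* s :+ q :* (v :* t)) refl q u v s t)
      (solve 4 (λ u v s t → s :* v :+ t :* u := u :* t :+ v :* s) refl u v s t)
      (pos′-* y x)
    pos′-* {u} {v} {s} {t} (inj₂ (pv , N)) (inj₂ (pt , N′)) = inj₁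
      ( subst Pos (+-comm _ _) (dominate (pos-* q-pos (pos-* pv pt)) (subst Pos
          (solve 5 (λ q u v s t → (q :* (v :* v) :- u :* u) :* (q :* (t :* t)) :+ (u :* u) :* (q :* (t :* t) :- s :* s)
             := (q :* (v :* t)) :* (q :* (v :* t)) :- (u :* s) :* (u :* s)) refl q u v s t)
          (pos-+ʳ (pos-* N (pos-* q-pos (pos-* pt pt))) (nonneg-* (square-nonneg u) N′))))
      , subst Pos
          (solve 5 (λ q u v s t → (q :* (v :* v) :- u :* u) :* (q :* (t :* t) :- s :* s)
             := (u :* s :+ q :* (v :* t)) :* (u :* s :+ q :* (v :* t)) :- q :* ((u :* t :+ v :* s) :* (u :* t :+ v :* s))) refl q u v s t)
          (pos-* N N′) )

    pos′-scale : ∀ {k u v} → Pos k → Pos′ u v → Pos′ (k * u) (k * v)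
    pos′-scale {k} {u} {v} pk (inj₁ (pu , N)) = inj₁ (pos-* pk pu , subst Pos
      (solve 4 (λ k q u v → (k :* k) :* (u :* u :- q :* (v :* v)) := (k :* u) :* (k :* u) :- q :* ((k :* v) :* (k :* v))) refl k q u v)
      (pos-* (pos-* pk pk) N))
    pos′-scale {k} {u} {v} pk (inj₂ (pv , N)) = inj₂ (pos-* pk pv , subst Pos
      (solve 4 (λ k q u v → (k :* k) :* (q :* (v :* v) :- u :* u) := q :* ((k :* v) :* (k :* v)) :- (k :* u) :* (k :* u)) refl k q u v)
      (pos-* (pos-* pk pk) N))

    pos′-unscale : ∀ {k u v} → Pos k → Pos′ (k * u) (k * v) → Pos′ u v
    pos′-unscale {k} {u} {v} pk (inj₁ (pu , N)) = inj₁ (pos-cancelˡ pk pu , pos-cancelˡ (pos-* pk pk) (subst Pos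
      (solve 4 (λ k q u v → (k :* u) :* (k :* u) :- q :* ((k :* v) :* (k :* v)) := (k :* k) :* (u :* u :- q :* (v :* v))) refl k q u v) N))
    pos′-unscale {k} {u} {v} pk (inj₂ (pv , N)) = inj₂ (pos-cancelˡ pk pv , pos-cancelˡ (pos-* pk pk) (subst Pos
      (solve 4 (λ k q u v → q :* ((k :* v) :* (k :* v)) :- (k :* u) :* (k :* u) := (k :* k) :* (q :* (v :* v) :- u :* u)) refl k q u v) N))

    private
      add-constant : ∀ {k u v} → Pos k → Pos v → Pos (conorm u v) → Pos′ (k + u) v
      add-constant {k} {u} {v} pk pv N with normSign (k + u) v
      ... | nneg p = inj₂ (pv , p)
      ... | nzero _ refl = ⊥-elim (¬pos-0 pv)
      ... | npos p with compare (k + u)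
      ...   | inj₁ p′ = inj₁ (p′ , p)
      ...   | inj₂ (inj₁ eq) = ⊥-elim (npos⇒u≢0 (subst (λ z → Pos (norm z v)) eq p))
      -- k + u < 0 < k implies (k + u)² < u² < qv², against the positive norm.
      ...   | inj₂ (inj₂ p′) = ⊥-elim (¬pos-0 (subst Pos
        (solve 4 (λ k q u v → ((k :+ u) :* (k :+ u) :- q :* (v :* v)) :+ (q :* (v :* v) :- u :* u)
            :+ (k :* (:- (k :+ u)) :+ k :* (:- (k :+ u)) :+ k :* k) := con (+ 0)) refl k q u v)
        (pos-+ (pos-+ p N) (pos-+ (pos-+ (pos-* pk p′) (pos-* pk p′)) (pos-* pk pk)))))

      -- With x = u + v√q positive of positive norm k, both x̄y and k lie on the
      -- positive side, and x + y = x (k + x̄y) / k.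
      pos′-+-mixed : ∀ {u v s t} → Pos u → Pos (norm u v) → Pos t → Pos (conorm s t) → Pos′ (u + s) (v + t)
      pos′-+-mixed {u} {v} {s} {t} pu N pt N′ = pos′-unscale N (≡.subst₂ Pos′
          (solve 5 (λ q u v s t → u :* ((u :* u :- q :* (v :* v)) :+ (u :* s :+ q :* ((:- v) :* t))) :+ q :* (v :* (u :* t :+ (:- v) :* s))
            := (u :* u :- q :* (v :* v)) :* (u :+ s)) refl q u v s t)
          (solve 5 (λ q u v s t → u :* (u :* t :+ (:- v) :* s) :+ v :* ((u :* u :- q :* (v :* v)) :+ (u :* s :+ q :* ((:- v) :* t)))
            := (u :* u :- q :* (v :* v)) :* (v :+ t)) refl q u v s t)
          (pos′-* (inj₁ (pu , N)) (choose x̄y)))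
        where
        x̄y : Pos′ (u * s + q * ((- v) * t)) (u * t + (- v) * s)
        x̄y = pos′-* (inj₁ (pu , subst Pos (solve 3 (λ q u v → u :* u :- q :* (v :* v) := u :* u :- q :* ((:- v) :* (:- v))) refl q u v) N))
                    (inj₂ (pt , N′))
        choose : Pos′ (u * s + q * ((- v) * t)) (u * t + (- v) * s)
               → Pos′ (norm u v + (u * s + q * ((- v) * t))) (u * t + (- v) * s)
        choose (inj₂ (p , M)) = add-constant N p M
        choose (inj₁ (_ , M)) = ⊥-elim (¬npos∧nneg M (subst Pos
          (solve 5 (λ q u v s t → (u :* u :- q :* (v :* v)) :* (q :* (t :* t) :- s :* s)
             := q :* ((u :* t :+ (:- v) :* s) :* (u :* t :+ (:- v) :* s)) :- (u :* s :+ q :* ((:- v) :* t)) :* (u :* s :+ q :* ((:- v) :* t))) refl q u v s t)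
          (pos-* N N′)))

    pos′-+ : ∀ {u v s t} → Pos′ u v → Pos′ s t → Pos′ (u + s) (v + t)
    pos′-+ {u} {v} {s} {t} (inj₁ (pu , N)) (inj₁ (ps , N′)) = inj₁ (pos-+ pu ps , subst Pos
        (solve 5 (λ q u v s t → (u :* u :- q :* (v :* v)) :+ (s :* s :- q :* (t :* t))
             :+ ((u :* s :+ :- (q :* (v :* t))) :+ (u :* s :+ :- (q :* (v :* t))))
           := (u :+ s) :* (u :+ s) :- q :* ((v :+ t) :* (v :+ t))) refl q u v s t)
        (pos-+ (pos-+ N N′) (pos-+ D D)))
      where
      -- Half the cross term in the norm of the sum: u² > qv² and s² > qt² give us > |qvt|.
      D : Pos (u * s + - (q * (v * t)))
      D = dominate (pos-* pu ps) (subst Pos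
          (solve 5 (λ q u v s t → (u :* u :- q :* (v :* v)) :* (s :* s) :+ (q :* (v :* v)) :* (s :* s :- q :* (t :* t))
             := (u :* s) :* (u :* s) :- (:- (q :* (v :* t))) :* (:- (q :* (v :* t)))) refl q u v s t)
          (pos-+ʳ (pos-* N (pos-* ps ps)) (nonneg-* (q*-nonneg v) N′)))
    pos′-+ (inj₁ (pu , N)) (inj₂ (pt , N′)) = pos′-+-mixed pu N pt N′
    pos′-+ (inj₂ (pv , N)) (inj₁ (ps , N′)) = ≡.subst₂ Pos′ (+-comm _ _) (+-comm _ _) (pos′-+-mixed ps N′ pv N)
    pos′-+ {u} {v} {s} {t} (inj₂ (pv , N)) (inj₂ (pt , N′)) = inj₂ (pos-+ pv pt , subst Pos
        (solve 5 (λ q u v s t → (q :* (v :* v) :- u :* u) :+ (q :* (t :* t) :- s :* s)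
             :+ ((q :* (v :* t) :+ :- (u :* s)) :+ (q :* (v :* t) :+ :- (u :* s)))
           := q :* ((v :+ t) :* (v :+ t)) :- (u :+ s) :* (u :+ s)) refl q u v s t)
        (pos-+ (pos-+ N N′) (pos-+ D D)))
      where
      D : Pos (q * (v * t) + - (u * s))
      D = dominate (pos-* q-pos (pos-* pv pt)) (subst Pos
          (solve 5 (λ q u v s t → (q :* (v :* v) :- u :* u) :* (q :* (t :* t)) :+ (u :* u) :* (q :* (t :* t) :- s :* s)
             := (q :* (v :* t)) :* (q :* (v :* t)) :- (:- (u :* s)) :* (:- (u :* s))) refl q u v s t)
          (pos-+ʳ (pos-* N (pos-* q-pos (pos-* pt pt))) (nonneg-* (square-nonneg u) N′)))

    SignPos : Carrier → Carrier → Set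
    SignPos u v = (Pos u × NonNeg v) ⊎ (NonNeg u × Pos v)
      ⊎ (Pos u × Pos (- v) × Pos (norm u v)) ⊎ (Pos (- u) × Pos v × Pos (conorm u v))

    signPos⇒pos′ : ∀ {u v} → SignPos u v → Pos′ u v
    signPos⇒pos′ {u} {v} (inj₁ (pu , nv)) with normSign u v
    ... | npos p = inj₁ (pu , p)
    ... | nzero refl _ = ⊥-elim (¬pos-0 pu)
    ... | nneg p with nv
    ...   | inj₁ pv = inj₂ (pv , p)
    ...   | inj₂ refl = ⊥-elim (nneg⇒v≢0 p)
    signPos⇒pos′ {u} {v} (inj₂ (inj₁ (nu , pv))) with normSign u v
    ... | nneg p = inj₂ (pv , p)
    ... | nzero _ refl = ⊥-elim (¬pos-0 pv)
    ... | npos p with nu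
    ...   | inj₁ pu = inj₁ (pu , p)
    ...   | inj₂ refl = ⊥-elim (npos⇒u≢0 p)
    signPos⇒pos′ (inj₂ (inj₂ (inj₁ (pu , _ , N)))) = inj₁ (pu , N)
    signPos⇒pos′ (inj₂ (inj₂ (inj₂ (_ , pv , N)))) = inj₂ (pv , N)

    pos′⇒signPos : ∀ {u v} → Pos′ u v → SignPos u v
    pos′⇒signPos {u} {v} (inj₁ (pu , N)) with compare v
    ... | inj₁ pv = inj₁ (pu , inj₁ pv)
    ... | inj₂ (inj₁ eq) = inj₁ (pu , inj₂ eq)
    ... | inj₂ (inj₂ pv) = inj₂ (inj₂ (inj₁ (pu , pv , N)))
    pos′⇒signPos {u} {v} (inj₂ (pv , N)) with compare u
    ... | inj₁ pu = inj₂ (inj₁ (inj₁ pu , pv))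
    ... | inj₂ (inj₁ eq) = inj₂ (inj₁ (inj₂ eq , pv))
    ... | inj₂ (inj₂ pu) = inj₂ (inj₂ (inj₂ (pu , pv , N)))

    -- The predicate is a parameter equivalent to `Pos′`, so that the extension can be ordered by
    -- the very case distinction used in the definitions of the statement.
    extension : (Pos″ : Carrier × Carrier → Set)
      → (∀ {u v} → Pos″ (u , v) → Pos′ u v) → (∀ {u v} → Pos′ u v → Pos″ (u , v)) → OrderedRing
    extension Pos″ to from = record
      { Carrier = Carrier × Carrier
      ; _+_ = λ { (u , v) (s , t) → u + s , v + t }
      ; _*_ = λ { (u , v) (s , t) → u * s + q * (v * t) , u * t + v * s }
      ; -_ = λ { (u , v) → - u , - v }
      ; 0# = 0# , 0#
      ; 1# = 1# , 0#
      ; isCommutativeRing = mkIsCommutativeRing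
          (λ { (u , v) (s , t) (x , y) → cong₂ _,_ (R.+-assoc u s x) (R.+-assoc v t y) })
          (λ { (u , v) (s , t) → cong₂ _,_ (+-comm u s) (+-comm v t) })
          (λ { (u , v) → cong₂ _,_ (+-identityˡ u) (+-identityˡ v) })
          (λ { (u , v) → cong₂ _,_ (R.-‿inverseˡ u) (R.-‿inverseˡ v) })
          (λ { (u , v) (s , t) (x , y) → cong₂ _,_
            (solve 7 (λ q u v s t x y → (u :* s :+ q :* (v :* t)) :* x :+ q :* ((u :* t :+ v :* s) :* y)
               := u :* (s :* x :+ q :* (t :* y)) :+ q :* (v :* (s :* y :+ t :* x))) refl q u v s t x y)
            (solve 7 (λ q u v s t x y → (u :* s :+ q :* (v :* t)) :* y :+ (u :* t :+ v :* s) :* x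
               := u :* (s :* y :+ t :* x) :+ v :* (s :* x :+ q :* (t :* y))) refl q u v s t x y) })
          (λ { (u , v) (s , t) → cong₂ _,_
            (solve 5 (λ q u v s t → u :* s :+ q :* (v :* t) := s :* u :+ q :* (t :* v)) refl q u v s t)
            (solve 4 (λ u v s t → u :* t :+ v :* s := s :* v :+ t :* u) refl u v s t) })
          (λ { (u , v) → cong₂ _,_
            (trans (cong₂ (λ a b → a + q * b) (R.*-identityˡ u) (R.zeroˡ v)) (trans (cong (λ b → u + b) (R.zeroʳ q)) (+-identityʳ u)))
            (trans (cong₂ _+_ (R.*-identityˡ v) (R.zeroˡ u)) (+-identityʳ v)) })
          (λ { (u , v) (s , t) (x , y) → cong₂ _,_
            (solve 7 (λ q u v s t x y → u :* (s :+ x) :+ q :* (v :* (t :+ y))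
               := (u :* s :+ q :* (v :* t)) :+ (u :* x :+ q :* (v :* y))) refl q u v s t x y)
            (solve 6 (λ u v s t x y → u :* (t :+ y) :+ v :* (s :+ x)
               := (u :* t :+ v :* s) :+ (u :* y :+ v :* x)) refl u v s t x y) })
      ; Pos = Pos″
      ; pos-+ = λ p p′ → from (pos′-+ (to p) (to p′))
      ; pos-* = λ p p′ → from (pos′-* (to p) (to p′))
      ; compare = λ { (u , v) → Sum.map from (Sum.map (λ { (e , e′) → cong₂ _,_ e e′ }) from) (compare′ u v) }
      ; ¬pos-0 = λ p → ¬pos′-0 (to p)
      }
      where module R = CommutativeRing commutativeRing

-- Integral rationals and square-free radicands.

module Rationals where
  open RingSolving
  open OrderedRings

  open IntegerCoefficients ℚ.+-*-commutativeRing public using (_:+_; _:*_; _:-_; :-_; _:=_) renaming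
    (solve to solveℚ; con to conℚ; Polynomial to Polyℚ; prove to proveℚ; ⟦_⟧ to evalℚ; ⟦_⟧↓ to evalℚ↓; var to varℚ)

  κ : ∀ {k} → ℕ → Polyℚ k
  κ c = conℚ (+ c)

  private
    toℚᵘ-ℤ : ∀ z → toℚᵘ (ℤ→ℚ z) ℚᵘ.≃ mkℚᵘ z 0
    toℚᵘ-ℤ z = ℚ.toℚᵘ-fromℚᵘ (mkℚᵘ z 0)

  ℤ→ℚ-+ : ∀ x y → ℤ→ℚ (x ℤ.+ y) ≡ ℤ→ℚ x ℚ.+ ℤ→ℚ y
  ℤ→ℚ-+ x y = ℚ.toℚᵘ-injective (begin
    toℚᵘ (ℤ→ℚ (x ℤ.+ y))               ≈⟨ toℚᵘ-ℤ (x ℤ.+ y) ⟩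
    mkℚᵘ (x ℤ.+ y) 0                   ≈⟨ *≡* (cong (ℤ._* + 1) (sym (cong₂ ℤ._+_ (ℤ.*-identityʳ x) (ℤ.*-identityʳ y)))) ⟩
    mkℚᵘ x 0 ℚᵘ.+ mkℚᵘ y 0             ≈⟨ ℚᵘ.+-cong (toℚᵘ-ℤ x) (toℚᵘ-ℤ y) ⟨
    toℚᵘ (ℤ→ℚ x) ℚᵘ.+ toℚᵘ (ℤ→ℚ y)     ≈⟨ ℚ.toℚᵘ-homo-+ (ℤ→ℚ x) (ℤ→ℚ y) ⟨
    toℚᵘ (ℤ→ℚ x ℚ.+ ℤ→ℚ y)             ∎)
    where open ℚᵘ.≃-Reasoning

  ℤ→ℚ-* : ∀ x y → ℤ→ℚ (x ℤ.* y) ≡ ℤ→ℚ x ℚ.* ℤ→ℚ y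
  ℤ→ℚ-* x y = ℚ.toℚᵘ-injective (begin
    toℚᵘ (ℤ→ℚ (x ℤ.* y))               ≈⟨ toℚᵘ-ℤ (x ℤ.* y) ⟩
    mkℚᵘ x 0 ℚᵘ.* mkℚᵘ y 0             ≈⟨ ℚᵘ.*-cong (toℚᵘ-ℤ x) (toℚᵘ-ℤ y) ⟨
    toℚᵘ (ℤ→ℚ x) ℚᵘ.* toℚᵘ (ℤ→ℚ y)     ≈⟨ ℚ.toℚᵘ-homo-* (ℤ→ℚ x) (ℤ→ℚ y) ⟨
    toℚᵘ (ℤ→ℚ x ℚ.* ℤ→ℚ y)             ∎)
    where open ℚᵘ.≃-Reasoning

  ℤ→ℚ-neg : ∀ x → ℤ→ℚ (ℤ.- x) ≡ ℚ.- ℤ→ℚ x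
  ℤ→ℚ-neg x = ℚ.toℚᵘ-injective (begin
    toℚᵘ (ℤ→ℚ (ℤ.- x))                 ≈⟨ toℚᵘ-ℤ (ℤ.- x) ⟩
    ℚᵘ.- mkℚᵘ x 0                      ≈⟨ ℚᵘ.-‿cong (toℚᵘ-ℤ x) ⟨
    ℚᵘ.- toℚᵘ (ℤ→ℚ x)                  ≈⟨ ℚ.toℚᵘ-homo‿- (ℤ→ℚ x) ⟨
    toℚᵘ (ℚ.- ℤ→ℚ x)                   ∎)
    where open ℚᵘ.≃-Reasoning

  ℤ→ℚ-- : ∀ x y → ℤ→ℚ (x ℤ.- y) ≡ ℤ→ℚ x ℚ.- ℤ→ℚ y
  ℤ→ℚ-- x y = trans (ℤ→ℚ-+ x (ℤ.- y)) (cong (ℤ→ℚ x ℚ.+_) (ℤ→ℚ-neg y))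

  ℤ→ℚ-injective : ∀ {x y} → ℤ→ℚ x ≡ ℤ→ℚ y → x ≡ y
  ℤ→ℚ-injective {x} {y} eq with ℚ.fromℚᵘ-injective {mkℚᵘ x 0} {mkℚᵘ y 0} eq
  ... | *≡* eq′ = trans (sym (ℤ.*-identityʳ x)) (trans eq′ (ℤ.*-identityʳ y))

  ℤ→ℚ-mono-≤ : ∀ {x y} → x ℤ.≤ y → ℤ→ℚ x ℚ.≤ ℤ→ℚ y
  ℤ→ℚ-mono-≤ {x} {y} le = ℚ.toℚᵘ-cancel-≤
    (ℚᵘ.≤-respˡ-≃ (ℚᵘ.≃-sym (toℚᵘ-ℤ x)) (ℚᵘ.≤-respʳ-≃ (ℚᵘ.≃-sym (toℚᵘ-ℤ y))
      (ℚᵘ.*≤* (ℤ.*-monoʳ-≤-nonNeg (+ 1) le))))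

  ℤ→ℚ-cancel-< : ∀ {x y} → ℤ→ℚ x ℚ.< ℤ→ℚ y → x ℤ.< y
  ℤ→ℚ-cancel-< {x} {y} lt with x ℤ.<? y
  ... | yes p = p
  ... | no ¬p = ⊥-elim (ℚ.<-irrefl refl (ℚ.<-≤-trans lt (ℤ→ℚ-mono-≤ (ℤ.≮⇒≥ ¬p))))

  ℤ→ℚ-mono-< : ∀ {x y} → x ℤ.< y → ℤ→ℚ x ℚ.< ℤ→ℚ y
  ℤ→ℚ-mono-< {x} {y} lt with ℚ.<-cmp (ℤ→ℚ x) (ℤ→ℚ y)
  ... | tri< p _ _ = p
  ... | tri≈ _ p _ = ⊥-elim (ℤ.<-irrefl (ℤ→ℚ-injective p) lt)
  ... | tri> _ _ p = ⊥-elim (ℤ.<-asym lt (ℤ→ℚ-cancel-< p))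

  Integral : ℚ → Set
  Integral x = ∃[ z ] (x ≡ ℤ→ℚ z)

  integral-+ : ∀ {x y} → Integral x → Integral y → Integral (x ℚ.+ y)
  integral-+ (s , refl) (t , refl) = s ℤ.+ t , sym (ℤ→ℚ-+ s t)

  integral-* : ∀ {x y} → Integral x → Integral y → Integral (x ℚ.* y)
  integral-* (s , refl) (t , refl) = s ℤ.* t , sym (ℤ→ℚ-* s t)

  integral-neg : ∀ {x} → Integral x → Integral (ℚ.- x)
  integral-neg (s , refl) = ℤ.- s , sym (ℤ→ℚ-neg s)

  integral-- : ∀ {x y} → Integral x → Integral y → Integral (x ℚ.- y)
  integral-- i j = integral-+ i (integral-neg j)

  coprime-num-den : ∀ x → Coprime (↧ₙ x) ℤ.∣ ↥ x ∣
  coprime-num-den (mkℚ _ _ c) = Coprime.sym (Coprime.recompute c)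

  private
    toℚᵘ-* : ∀ (x y : ℚ) {p q : ℚᵘ} → toℚᵘ x ℚᵘ.≃ p → toℚᵘ y ℚᵘ.≃ q → toℚᵘ (x ℚ.* y) ℚᵘ.≃ p ℚᵘ.* q
    toℚᵘ-* x y e e′ = ℚᵘ.≃-trans (ℚ.toℚᵘ-homo-* x y) (ℚᵘ.*-cong e e′)

    ≃⇒cross : ∀ {p q : ℚᵘ} → p ℚᵘ.≃ q → ℚᵘ.↥ p ℤ.* ℚᵘ.↧ q ≡ ℚᵘ.↥ q ℤ.* ℚᵘ.↧ p
    ≃⇒cross (*≡* eq) = eq

  denominator≡1⇒integral : ∀ x → ↧ₙ x ≡ 1 → Integral x
  denominator≡1⇒integral x@(mkℚ a zero _) refl = a , sym (ℚ.↥p/↧p≡p x)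

  denominator-∣ : ∀ c x → Integral (ℤ→ℚ c ℚ.* x) → ↧ₙ x ∣ ℤ.∣ c ∣
  denominator-∣ c x@(mkℚ a d-1 _) (k , eq) = coprime-divisor (coprime-num-den x)
      (divides ℤ.∣ k ∣ (begin
        ℤ.∣ a ∣ ℕ.* ℤ.∣ c ∣                 ≡⟨ ℕ.*-comm ℤ.∣ a ∣ ℤ.∣ c ∣ ⟩
        ℤ.∣ c ∣ ℕ.* ℤ.∣ a ∣                 ≡⟨ ℤ.abs-* c a ⟨
        ℤ.∣ c ℤ.* a ∣                       ≡⟨ cong ℤ.∣_∣ cross ⟩
        ℤ.∣ k ℤ.* + suc d-1 ∣               ≡⟨ ℤ.abs-* k (+ suc d-1) ⟩
        ℤ.∣ k ∣ ℕ.* suc d-1                 ∎))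
    where
    open ≡.≡-Reasoning
    cross : c ℤ.* a ≡ k ℤ.* + suc d-1
    cross = trans (sym (ℤ.*-identityʳ (c ℤ.* a))) (trans
      (≃⇒cross (ℚᵘ.≃-trans (ℚᵘ.≃-sym (toℚᵘ-* (ℤ→ℚ c) x (toℚᵘ-ℤ c) ℚᵘ.≃-refl))
        (ℚᵘ.≃-trans (ℚ.toℚᵘ-cong eq) (toℚᵘ-ℤ k))))
      (cong (λ t → k ℤ.* + suc t) (ℕ.+-identityʳ d-1)))

  -- For x = a/d in lowest terms, d² divides ma². Coprimality of d and a moves the factors into m
  -- one at a time, first d ∣ m and then d ∣ m/d, so d² ∣ m and d = 1.
  squareFree⇒integral : ∀ {m} → SquareFree m → ∀ x → Integral (ℕ→ℚ m ℚ.* (x ℚ.* x)) → Integral x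
  squareFree⇒integral {m} sf x int with ↧ₙ x ℕ.≟ 1
  ... | yes eq = denominator≡1⇒integral x eq
  ... | no neq = ⊥-elim (sf (↧ₙ x) (2≤den x neq) d²∣m)
    where
    2≤den : ∀ x → ¬ ↧ₙ x ≡ 1 → 2 ℕ.≤ ↧ₙ x
    2≤den (mkℚ _ zero _) neq = ⊥-elim (neq refl)
    2≤den (mkℚ _ (suc _) _) _ = s≤s (s≤s z≤n)
    d²∣maa : ∀ x → Integral (ℕ→ℚ m ℚ.* (x ℚ.* x)) → ↧ₙ x ℕ.* ↧ₙ x ∣ m ℕ.* (ℤ.∣ ↥ x ∣ ℕ.* ℤ.∣ ↥ x ∣)
    d²∣maa x@(mkℚ a d-1 _) (k , eq) = divides ℤ.∣ k ∣ (begin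
        m ℕ.* (ℤ.∣ a ∣ ℕ.* ℤ.∣ a ∣)              ≡⟨ cong (m ℕ.*_) (ℤ.abs-* a a) ⟨
        m ℕ.* ℤ.∣ a ℤ.* a ∣                      ≡⟨ ℤ.abs-* (+ m) (a ℤ.* a) ⟨
        ℤ.∣ + m ℤ.* (a ℤ.* a) ∣                  ≡⟨ cong ℤ.∣_∣ cross ⟩
        ℤ.∣ k ℤ.* + (suc d-1 ℕ.* suc d-1) ∣      ≡⟨ ℤ.abs-* k (+ (suc d-1 ℕ.* suc d-1)) ⟩
        ℤ.∣ k ∣ ℕ.* (suc d-1 ℕ.* suc d-1)        ∎)
      where
      open ≡.≡-Reasoning
      cross : + m ℤ.* (a ℤ.* a) ≡ k ℤ.* + (suc d-1 ℕ.* suc d-1)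
      cross = trans (sym (ℤ.*-identityʳ _)) (trans
        (≃⇒cross (ℚᵘ.≃-trans (ℚᵘ.≃-sym (toℚᵘ-* (ℕ→ℚ m) (x ℚ.* x) (toℚᵘ-ℤ (+ m)) (toℚᵘ-* x x ℚᵘ.≃-refl ℚᵘ.≃-refl)))
          (ℚᵘ.≃-trans (ℚ.toℚᵘ-cong eq) (toℚᵘ-ℤ k))))
        (cong (λ t → k ℤ.* + t) (ℕ.+-identityʳ _)))
    den = ↧ₙ x
    instance d≢0 : ℕ.NonZero den
    d≢0 = record { nonZero = _ }
    cancel-a² : ∀ c → den ∣ c ℕ.* (ℤ.∣ ↥ x ∣ ℕ.* ℤ.∣ ↥ x ∣) → den ∣ c
    cancel-a² c div = coprime-divisor (coprime-num-den x) (coprime-divisor (coprime-num-den x)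
      (subst (den ∣_) (trans (ℕ.*-comm c _) (ℕ.*-assoc ℤ.∣ ↥ x ∣ ℤ.∣ ↥ x ∣ c)) div))
    d∣m : den ∣ m
    d∣m = cancel-a² m (∣-trans (m∣m*n den) (d²∣maa x int))
    d²∣m : den ℕ.* den ∣ m
    d²∣m with d∣m
    ... | divides c refl = subst (den ℕ.* den ∣_) (ℕ.*-comm den c) (*-pres-∣ (divides 1 (sym (ℕ.+-identityʳ den)))
            (cancel-a² c (*-cancelˡ-∣ den (subst (den ℕ.* den ∣_)
              (trans (cong (ℕ._* (ℤ.∣ ↥ x ∣ ℕ.* ℤ.∣ ↥ x ∣)) (ℕ.*-comm c den)) (ℕ.*-assoc den c _)) (d²∣maa x int)))))

  -- q (v/u)² = 1 would make v/u an integer whose square times q is 1.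
  squareFree⇒nonsquare : ∀ {m} → SquareFree m → 2 ℕ.≤ m → ∀ u v → u ℚ.* u ≡ ℕ→ℚ m ℚ.* (v ℚ.* v) → u ≡ 0ℚ × v ≡ 0ℚ
  squareFree⇒nonsquare {m} sf 2≤m u v eq = u≡0 , v≡0 (v ℚ.≟ 0ℚ)
    where
    impossible : ∀ k → ¬ (ℕ→ℚ m ℚ.* (ℤ→ℚ k ℚ.* ℤ→ℚ k) ≡ 1ℚ)
    impossible k e = ℕ.<⇒≢ 2≤m (sym (ℕ.m*n≡1⇒m≡1 m ℤ.∣ k ℤ.* k ∣ (trans (sym (ℤ.abs-* (+ m) (k ℤ.* k)))
      (cong ℤ.∣_∣ (ℤ→ℚ-injective {+ m ℤ.* (k ℤ.* k)} {+ 1} (trans (ℤ→ℚ-* (+ m) (k ℤ.* k))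
        (trans (cong (ℕ→ℚ m ℚ.*_) (ℤ→ℚ-* k k)) e)))))))
    u≡0 : u ≡ 0ℚ
    u≡0 with u ℚ.≟ 0ℚ
    ... | yes e = e
    ... | no u≢0 = ⊥-elim (impossible k (trans (cong (λ t → ℕ→ℚ m ℚ.* (t ℚ.* t)) (sym e)) mw²≡1))
      where
      instance u≠0 : ℚ.NonZero u
      u≠0 = ℚ.≢-nonZero u≢0
      w = v ℚ.* ℚ.1/ u
      mw²≡1 : ℕ→ℚ m ℚ.* (w ℚ.* w) ≡ 1ℚ
      mw²≡1 = begin
        ℕ→ℚ m ℚ.* (w ℚ.* w)                             ≡⟨ solveℚ 3 (λ m v i → m :* ((v :* i) :* (v :* i)) := (m :* (v :* v)) :* (i :* i)) refl (ℕ→ℚ m) v (ℚ.1/ u) ⟩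
        ℕ→ℚ m ℚ.* (v ℚ.* v) ℚ.* (ℚ.1/ u ℚ.* ℚ.1/ u)     ≡⟨ cong (ℚ._* _) eq ⟨
        u ℚ.* u ℚ.* (ℚ.1/ u ℚ.* ℚ.1/ u)                 ≡⟨ solveℚ 2 (λ u i → u :* u :* (i :* i) := (u :* i) :* (u :* i)) refl u (ℚ.1/ u) ⟩
        (u ℚ.* ℚ.1/ u) ℚ.* (u ℚ.* ℚ.1/ u)               ≡⟨ cong (λ t → t ℚ.* t) (ℚ.*-inverseʳ u) ⟩
        1ℚ                                              ∎
        where open ≡.≡-Reasoning
      int = squareFree⇒integral sf w (+ 1 , mw²≡1)
      k = proj₁ int
      e = proj₂ int
    v≡0 : Dec (v ≡ 0ℚ) → v ≡ 0ℚ
    v≡0 (yes e) = e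
    v≡0 (no v≢0) = ⊥-elim (m≢0 (ℤ.+-injective (ℤ→ℚ-injective {+ m} {+ 0} m≡0)))
      where
      instance v≠0 : ℚ.NonZero v
      v≠0 = ℚ.≢-nonZero v≢0
      m≢0 : ¬ m ≡ 0
      m≢0 e = ℕ.<⇒≢ (ℕ.<-≤-trans (s≤s z≤n) 2≤m) (sym e)
      m≡0 : ℕ→ℚ m ≡ 0ℚ
      m≡0 = begin
        ℕ→ℚ m                                           ≡⟨ ℚ.*-identityʳ _ ⟨
        ℕ→ℚ m ℚ.* (1ℚ ℚ.* 1ℚ)                           ≡⟨ cong (λ t → ℕ→ℚ m ℚ.* (t ℚ.* t)) (ℚ.*-inverseʳ v) ⟨
        ℕ→ℚ m ℚ.* ((v ℚ.* ℚ.1/ v) ℚ.* (v ℚ.* ℚ.1/ v))   ≡⟨ solveℚ 3 (λ m v i → m :* ((v :* i) :* (v :* i)) := (m :* (v :* v)) :* (i :* i)) refl (ℕ→ℚ m) v (ℚ.1/ v) ⟩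
        ℕ→ℚ m ℚ.* (v ℚ.* v) ℚ.* (ℚ.1/ v ℚ.* ℚ.1/ v)     ≡⟨ cong (ℚ._* _) eq ⟨
        u ℚ.* u ℚ.* (ℚ.1/ v ℚ.* ℚ.1/ v)                 ≡⟨ cong (λ t → t ℚ.* t ℚ.* (ℚ.1/ v ℚ.* ℚ.1/ v)) u≡0 ⟩
        0ℚ ℚ.* 0ℚ ℚ.* (ℚ.1/ v ℚ.* ℚ.1/ v)               ≡⟨ ℚ.*-zeroˡ (ℚ.1/ v ℚ.* ℚ.1/ v) ⟩
        0ℚ                                              ∎
        where open ≡.≡-Reasoning

-- Multiplication in K, with a symbolic copy for the solver.

module Multiplication where
  open RingSolving
  open OrderedRings
  open Rationals
  open import Data.Rational using (_+_; _*_; -_; _-_; _<_)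

  0<-+ : ∀ {x y} → 0ℚ < x → 0ℚ < y → 0ℚ < x + y
  0<-+ = ℚ.+-mono-<

  0<-* : ∀ {x y} → 0ℚ < x → 0ℚ < y → 0ℚ < x * y
  0<-* {x} {y} p p′ = ℚ.positive⁻¹ (x * y) {{ℚ.pos*pos⇒pos x {{ℚ.positive p}} y {{ℚ.positive p′}}}}

  <0⇒0<- : ∀ {x} → x < 0ℚ → 0ℚ < - x
  <0⇒0<- = ℚ.neg-antimono-<

  0<-⇒<0 : ∀ {x} → 0ℚ < - x → x < 0ℚ
  0<-⇒<0 {x} p = subst (_< 0ℚ) (solveℚ 1 (λ x → :- (:- x) := x) refl x) (ℚ.neg-antimono-< p)

  <⇒0<- : ∀ {x y} → x < y → 0ℚ < y - x
  <⇒0<- {x} {y} lt = subst (_< y - x) (ℚ.+-inverseʳ x) (ℚ.+-monoˡ-< (- x) lt)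

  0<-⇒< : ∀ {x y} → 0ℚ < y - x → x < y
  0<-⇒< {x} {y} lt = ≡.subst₂ _<_ (ℚ.+-identityˡ x) (solveℚ 2 (λ x y → (y :- x) :+ x := y) refl x y) (ℚ.+-monoˡ-< x lt)

  ℚ-ordered : OrderedRing
  ℚ-ordered = record
    { isCommutativeRing = ℚ.+-*-isCommutativeRing
    ; Pos = 0ℚ <_
    ; pos-+ = 0<-+
    ; pos-* = 0<-*
    ; compare = compare
    ; ¬pos-0 = ℚ.<-irrefl refl
    }
    where
    compare : ∀ x → 0ℚ < x ⊎ x ≡ 0ℚ ⊎ 0ℚ < - x
    compare x with ℚ.<-cmp 0ℚ x
    ... | tri< p _ _ = inj₁ p
    ... | tri≈ _ p _ = inj₂ (inj₁ (sym p))
    ... | tri> _ _ p = inj₂ (inj₂ (<0⇒0<- p))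

  ≤⇒nonneg : ∀ {x} → 0ℚ ℚ.≤ x → 0ℚ < x ⊎ x ≡ 0ℚ
  ≤⇒nonneg {x} le with ℚ.<-cmp 0ℚ x
  ... | tri< p _ _ = inj₁ p
  ... | tri≈ _ p _ = inj₂ (sym p)
  ... | tri> _ _ p = ⊥-elim (ℚ.<-irrefl refl (ℚ.≤-<-trans le p))

  nonneg⇒≤ : ∀ {x} → 0ℚ < x ⊎ x ≡ 0ℚ → 0ℚ ℚ.≤ x
  nonneg⇒≤ (inj₁ p) = ℚ.<⇒≤ p
  nonneg⇒≤ (inj₂ refl) = ℚ.≤-refl

  ⟨⟩-cong : ∀ {x x′ y y′ z z′ w w′ : ℚ} → x ≡ x′ → y ≡ y′ → z ≡ z′ → w ≡ w′ → ⟨ x , y , z , w ⟩ ≡ ⟨ x′ , y′ , z′ , w′ ⟩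
  ⟨⟩-cong refl refl refl refl = refl

  -- The multiplication of Defs with p, q, r kept apart from m₁, m₂, m₃, so that
  -- matching on p ≡ m₁m₂ etc. turns ring laws into polynomial identities.
  mul : (M₁ M₂ M₃ P Q R : ℚ) → K → K → K
  mul M₁ M₂ M₃ P Q R x y =
    ⟨ a x * a y + P * (b x * b y) + Q * (c x * c y) + R * (d x * d y)
    , a x * b y + b x * a y + M₃ * (c x * d y + d x * c y)
    , a x * c y + c x * a y + M₂ * (b x * d y + d x * b y)
    , a x * d y + d x * a y + M₁ * (b x * c y + c x * b y) ⟩

  -- Symbolic elements of K: an identity between them is four polynomial identities, all settled by
  -- one `refl` in `solveᴷ`.
  record Quadᴾ (k : ℕ) : Set where
    constructor quad
    field π₀ π₁ π₂ π₃ : Polyℚ k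
  open Quadᴾ public

  infixl 6 _⊕ᴾ_ _⊖ᴾ_
  _⊕ᴾ_ _⊖ᴾ_ : ∀ {k} → Quadᴾ k → Quadᴾ k → Quadᴾ k
  quad x₀ x₁ x₂ x₃ ⊕ᴾ quad y₀ y₁ y₂ y₃ = quad (x₀ :+ y₀) (x₁ :+ y₁) (x₂ :+ y₂) (x₃ :+ y₃)
  quad x₀ x₁ x₂ x₃ ⊖ᴾ quad y₀ y₁ y₂ y₃ = quad (x₀ :- y₀) (x₁ :- y₁) (x₂ :- y₂) (x₃ :- y₃)

  mulᴾ : ∀ {k} → (M₁ M₂ M₃ P Q R : Polyℚ k) → Quadᴾ k → Quadᴾ k → Quadᴾ k
  mulᴾ M₁ M₂ M₃ P Q R (quad x₀ x₁ x₂ x₃) (quad y₀ y₁ y₂ y₃) = quad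
    (x₀ :* y₀ :+ P :* (x₁ :* y₁) :+ Q :* (x₂ :* y₂) :+ R :* (x₃ :* y₃))
    (x₀ :* y₁ :+ x₁ :* y₀ :+ M₃ :* (x₂ :* y₃ :+ x₃ :* y₂))
    (x₀ :* y₂ :+ x₂ :* y₀ :+ M₂ :* (x₁ :* y₃ :+ x₃ :* y₁))
    (x₀ :* y₃ :+ x₃ :* y₀ :+ M₁ :* (x₁ :* y₂ :+ x₂ :* y₁))

  mulᴹ : ∀ {k} → (M₁ M₂ M₃ : Polyℚ k) → Quadᴾ k → Quadᴾ k → Quadᴾ k
  mulᴹ M₁ M₂ M₃ = mulᴾ M₁ M₂ M₃ (M₁ :* M₂) (M₁ :* M₃) (M₂ :* M₃)

  scalarᴾ : ∀ {k} → Polyℚ k → Quadᴾ k → Quadᴾ k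
  scalarᴾ h (quad x₀ x₁ x₂ x₃) = quad (h :* x₀) (h :* x₁) (h :* x₂) (h :* x₃)

  negᴾ : ∀ {k} → Quadᴾ k → Quadᴾ k
  negᴾ (quad x₀ x₁ x₂ x₃) = quad (:- x₀) (:- x₁) (:- x₂) (:- x₃)

  sgnᴾ : ∀ {k} → Bool → Polyℚ k → Polyℚ k
  sgnᴾ true  x = x
  sgnᴾ false x = :- x

  σᴾ : ∀ {k} → Bool → Bool → Quadᴾ k → Quadᴾ k
  σᴾ s t (quad x₀ x₁ x₂ x₃) = quad x₀ (sgnᴾ s x₁) (sgnᴾ t x₂) (sgnᴾ s (sgnᴾ t x₃))

  ⟦_⟧ᴷ ⟦_⟧ᴷ↓ : ∀ {k} → Quadᴾ k → Vec ℚ k → K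
  ⟦ quad x y z w ⟧ᴷ ρ = ⟨ evalℚ x ρ , evalℚ y ρ , evalℚ z ρ , evalℚ w ρ ⟩
  ⟦ quad x y z w ⟧ᴷ↓ ρ = ⟨ evalℚ↓ x ρ , evalℚ↓ y ρ , evalℚ↓ z ρ , evalℚ↓ w ρ ⟩

  private
    close : ∀ {A : Set} k → N-ary k (Polyℚ k) A → A
    close k f = f $ⁿ tabulate varℚ

    proveᴷ : ∀ {k} (p q : Quadᴾ k) ρ → ⟦ p ⟧ᴷ↓ ρ ≡ ⟦ q ⟧ᴷ↓ ρ → ⟦ p ⟧ᴷ ρ ≡ ⟦ q ⟧ᴷ ρ
    proveᴷ (quad x y z w) (quad x′ y′ z′ w′) ρ eq =
      ⟨⟩-cong (proveℚ ρ x x′ (cong a eq)) (proveℚ ρ y y′ (cong b eq)) (proveℚ ρ z z′ (cong c eq)) (proveℚ ρ w w′ (cong d eq))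

  evaluateᴷ : ∀ k → N-ary k (Polyℚ k) (Quadᴾ k) → Vec ℚ k → K
  evaluateᴷ k f = ⟦ close k f ⟧ᴷ

  Identityᴷ : ∀ k → N-ary k (Polyℚ k) (Quadᴾ k × Quadᴾ k) → Vec ℚ k → Set
  Identityᴷ k f ρ = ⟦ proj₁ (close k f) ⟧ᴷ ρ ≡ ⟦ proj₂ (close k f) ⟧ᴷ ρ

  solveᴷ : ∀ k (f : N-ary k (Polyℚ k) (Quadᴾ k × Quadᴾ k)) → (∀ {ρ} → ⟦ proj₁ (close k f) ⟧ᴷ↓ ρ ≡ ⟦ proj₂ (close k f) ⟧ᴷ↓ ρ)
    → ∀ ρ → ⟦ proj₁ (close k f) ⟧ᴷ ρ ≡ ⟦ proj₂ (close k f) ⟧ᴷ ρ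
  solveᴷ k f eq ρ = proveᴷ (proj₁ (close k f)) (proj₂ (close k f)) ρ eq

  mul-comm : ∀ M₁ M₂ M₃ P Q R x y → mul M₁ M₂ M₃ P Q R x y ≡ mul M₁ M₂ M₃ P Q R y x
  mul-comm M₁ M₂ M₃ P Q R ⟨ x₀ , x₁ , x₂ , x₃ ⟩ ⟨ y₀ , y₁ , y₂ , y₃ ⟩ =
    solveᴷ 14 (λ M₁ M₂ M₃ P Q R x₀ x₁ x₂ x₃ y₀ y₁ y₂ y₃ → let x = quad x₀ x₁ x₂ x₃ ; y = quad y₀ y₁ y₂ y₃ ; _·_ = mulᴾ M₁ M₂ M₃ P Q R in
      x · y , y · x) refl (M₁ ∷ M₂ ∷ M₃ ∷ P ∷ Q ∷ R ∷ x₀ ∷ x₁ ∷ x₂ ∷ x₃ ∷ y₀ ∷ y₁ ∷ y₂ ∷ y₃ ∷ [])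

  mul-distribˡ : ∀ M₁ M₂ M₃ P Q R n x y z → mul M₁ M₂ M₃ P Q R x (_⊕_ n y z) ≡ _⊕_ n (mul M₁ M₂ M₃ P Q R x y) (mul M₁ M₂ M₃ P Q R x z)
  mul-distribˡ M₁ M₂ M₃ P Q R n ⟨ x₀ , x₁ , x₂ , x₃ ⟩ ⟨ y₀ , y₁ , y₂ , y₃ ⟩ ⟨ z₀ , z₁ , z₂ , z₃ ⟩ =
    solveᴷ 18 (λ M₁ M₂ M₃ P Q R x₀ x₁ x₂ x₃ y₀ y₁ y₂ y₃ z₀ z₁ z₂ z₃ →
      let x = quad x₀ x₁ x₂ x₃ ; y = quad y₀ y₁ y₂ y₃ ; z = quad z₀ z₁ z₂ z₃ ; _·_ = mulᴾ M₁ M₂ M₃ P Q R in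
      x · (y ⊕ᴾ z) , (x · y) ⊕ᴾ (x · z)) refl (M₁ ∷ M₂ ∷ M₃ ∷ P ∷ Q ∷ R ∷ x₀ ∷ x₁ ∷ x₂ ∷ x₃ ∷ y₀ ∷ y₁ ∷ y₂ ∷ y₃ ∷ z₀ ∷ z₁ ∷ z₂ ∷ z₃ ∷ [])

  mul-assoc : ∀ M₁ M₂ M₃ {P Q R} → P ≡ M₁ * M₂ → Q ≡ M₁ * M₃ → R ≡ M₂ * M₃ → ∀ x y z →
    mul M₁ M₂ M₃ P Q R (mul M₁ M₂ M₃ P Q R x y) z ≡ mul M₁ M₂ M₃ P Q R x (mul M₁ M₂ M₃ P Q R y z)
  mul-assoc M₁ M₂ M₃ refl refl refl ⟨ x₀ , x₁ , x₂ , x₃ ⟩ ⟨ y₀ , y₁ , y₂ , y₃ ⟩ ⟨ z₀ , z₁ , z₂ , z₃ ⟩ =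
    solveᴷ 15 (λ M₁ M₂ M₃ x₀ x₁ x₂ x₃ y₀ y₁ y₂ y₃ z₀ z₁ z₂ z₃ →
      let x = quad x₀ x₁ x₂ x₃ ; y = quad y₀ y₁ y₂ y₃ ; z = quad z₀ z₁ z₂ z₃ ; _·_ = mulᴹ M₁ M₂ M₃ in
      (x · y) · z , x · (y · z)) refl (M₁ ∷ M₂ ∷ M₃ ∷ x₀ ∷ x₁ ∷ x₂ ∷ x₃ ∷ y₀ ∷ y₁ ∷ y₂ ∷ y₃ ∷ z₀ ∷ z₁ ∷ z₂ ∷ z₃ ∷ [])

-- The order on ℚ(√p) and K, and total positivity.

module FieldOrder where
  open RingSolving
  open OrderedRings
  open Rationals
  open Multiplication
  open import Data.Rational using (_+_; _*_; -_; _-_; _<_)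

  zero-product : ∀ {x y} → ¬ x ≡ 0ℚ → x * y ≡ 0ℚ → y ≡ 0ℚ
  zero-product {x} {y} x≢0 eq = begin
    y                       ≡⟨ ℚ.*-identityˡ y ⟨
    1ℚ * y                  ≡⟨ cong (_* y) (ℚ.*-inverseˡ x) ⟨
    ℚ.1/ x * x * y          ≡⟨ ℚ.*-assoc (ℚ.1/ x) x y ⟩
    ℚ.1/ x * (x * y)        ≡⟨ cong (ℚ.1/ x *_) eq ⟩
    ℚ.1/ x * 0ℚ             ≡⟨ ℚ.*-zeroʳ (ℚ.1/ x) ⟩
    0ℚ                      ∎
    where
    open ≡.≡-Reasoning
    instance x≠0 : ℚ.NonZero x
    x≠0 = ℚ.≢-nonZero x≢0

  -≡0⇒≡ : ∀ {x y} → x - y ≡ 0ℚ → x ≡ y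
  -≡0⇒≡ {x} {y} eq = trans (solveℚ 2 (λ x y → x := (x :- y) :+ y) refl x y) (trans (cong (_+ y) eq) (ℚ.+-identityˡ y))

  ≡⇒-≡0 : ∀ {x y} → x ≡ y → x - y ≡ 0ℚ
  ≡⇒-≡0 {x} refl = ℚ.+-inverseʳ x

  0<⇒≢0 : ∀ {x} → 0ℚ < x → ¬ x ≡ 0ℚ
  0<⇒≢0 p refl = ℚ.<-irrefl refl p

  -- The numbers attached to n, kept abstract so that the rationals m₁, …, r never unfold.
  record Setting : Set where
    field
      n  : ℕ
      ν  : ℤ
      M₁ M₂ M₃ P Q R : ℚ
      M₁≡ : M₁ ≡ ℤ→ℚ (+ 2 ℤ.* ν ℤ.- + 1)
      M₂≡ : M₂ ≡ ℤ→ℚ (+ 2 ℤ.* ν ℤ.+ + 1)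
      M₃≡ : M₃ ≡ ℤ→ℚ (+ 2 ℤ.* ν ℤ.+ + 3)
      P≡  : P ≡ M₁ * M₂
      Q≡  : Q ≡ M₁ * M₃
      R≡  : R ≡ M₂ * M₃
      6≤ν : + 6 ℤ.≤ ν
      M₁>0 : 0ℚ < M₁
      M₂>0 : 0ℚ < M₂
      M₃>0 : 0ℚ < M₃
      P>0  : 0ℚ < P
      Q>0  : 0ℚ < Q
      nonsquare-p : ∀ u v → u * u ≡ P * (v * v) → u ≡ 0ℚ × v ≡ 0ℚ
      nonsquare-q : ∀ u v → u * u ≡ Q * (v * v) → u ≡ 0ℚ × v ≡ 0ℚ
      nonsquare-r : ∀ u v → u * u ≡ R * (v * v) → u ≡ 0ℚ × v ≡ 0ℚ
      integral-p : ∀ x → Integral (P * (x * x)) → Integral x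
      integral-q : ∀ x → Integral (Q * (x * x)) → Integral x
      integral-r : ∀ x → Integral (R * (x * x)) → Integral x

  module Biquadratic (S : Setting) where
    open Setting S

    private module E₁ = QuadraticExtension ℚ-ordered P P>0 nonsquare-p

    -- Repeats `Pos₁` over the abstract `P`, so that for the actual numbers it unfolds to the
    -- positivity of the statement. Proofs pass through the equivalent `E₁.Pos′`.
    Positive₁ : ℚ × ℚ → Set
    Positive₁ (u₀ , u₁) =
        (0ℚ < u₀ × 0ℚ ℚ.≤ u₁)
      ⊎ (0ℚ ℚ.≤ u₀ × 0ℚ < u₁)
      ⊎ (0ℚ < u₀ × u₁ < 0ℚ × P * (u₁ * u₁) < u₀ * u₀)
      ⊎ (u₀ < 0ℚ × 0ℚ < u₁ × u₀ * u₀ < P * (u₁ * u₁))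

    positive₁⇒pos′ : ∀ {u v} → Positive₁ (u , v) → E₁.Pos′ u v
    positive₁⇒pos′ (inj₁ (p , le)) = E₁.signPos⇒pos′ (inj₁ (p , ≤⇒nonneg le))
    positive₁⇒pos′ (inj₂ (inj₁ (le , p))) = E₁.signPos⇒pos′ (inj₂ (inj₁ (≤⇒nonneg le , p)))
    positive₁⇒pos′ (inj₂ (inj₂ (inj₁ (p , _ , N)))) = inj₁ (p , <⇒0<- N)
    positive₁⇒pos′ (inj₂ (inj₂ (inj₂ (_ , p , N)))) = inj₂ (p , <⇒0<- N)

    pos′⇒positive₁ : ∀ {u v} → E₁.Pos′ u v → Positive₁ (u , v)
    pos′⇒positive₁ p with E₁.pos′⇒signPos p
    ... | inj₁ (p , nn) = inj₁ (p , nonneg⇒≤ nn)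
    ... | inj₂ (inj₁ (nn , p)) = inj₂ (inj₁ (nonneg⇒≤ nn , p))
    ... | inj₂ (inj₂ (inj₁ (p , p′ , N))) = inj₂ (inj₂ (inj₁ (p , 0<-⇒<0 p′ , 0<-⇒< N)))
    ... | inj₂ (inj₂ (inj₂ (p , p′ , N))) = inj₂ (inj₂ (inj₂ (0<-⇒<0 p , p′ , 0<-⇒< N)))

    ℚ√p : OrderedRing
    ℚ√p = E₁.extension Positive₁ positive₁⇒pos′ pos′⇒positive₁

    private module F = OrderedRing ℚ√p

    positive₁-rational : ∀ {u} → 0ℚ < u → Positive₁ (u , 0ℚ)
    positive₁-rational p = inj₁ (p , ℚ.≤-refl)

    -- With s = u₀², t = pu₁², S = qv₀², T = pqv₁², the equation u² = qv² in ℚ(√p) says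
    -- s + t = S + T and st = ST, so s = S or s = T.
    nonsquare₂ : ∀ u v → u F.* u ≡ (Q , 0ℚ) F.* (v F.* v) → u ≡ (0ℚ , 0ℚ) × v ≡ (0ℚ , 0ℚ)
    nonsquare₂ (u₀ , u₁) (v₀ , v₁) eq = conclude ((u₀ * u₀ - Q * (v₀ * v₀)) ℚ.≟ 0ℚ)
      where
      open ≡.≡-Reasoning
      P≢0 = 0<⇒≢0 P>0
      M₁≢0 = 0<⇒≢0 M₁>0
      sum : u₀ * u₀ + P * (u₁ * u₁) ≡ Q * (v₀ * v₀) + Q * P * (v₁ * v₁)
      sum = trans (cong proj₁ eq) (solveℚ 4 (λ P Q v₀ v₁ →
        Q :* (v₀ :* v₀ :+ P :* (v₁ :* v₁)) :+ P :* (κ 0 :* (v₀ :* v₁ :+ v₁ :* v₀))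
        := Q :* (v₀ :* v₀) :+ Q :* P :* (v₁ :* v₁)) refl P Q v₀ v₁)
      twice : u₀ * u₁ + u₁ * u₀ ≡ Q * (v₀ * v₁ + v₁ * v₀)
      twice = trans (cong proj₂ eq) (solveℚ 4 (λ P Q v₀ v₁ →
        Q :* (v₀ :* v₁ :+ v₁ :* v₀) :+ κ 0 :* (v₀ :* v₀ :+ P :* (v₁ :* v₁))
        := Q :* (v₀ :* v₁ :+ v₁ :* v₀)) refl P Q v₀ v₁)
      -- The √p-coordinate only yields 2u₀u₁ = 2qv₀v₁; squaring it produces this factor.
      four = + 4
      4≢0 : ¬ ℤ→ℚ four ≡ 0ℚ
      4≢0 ()
      product : (u₀ * u₀ - Q * (v₀ * v₀)) * (u₀ * u₀ - Q * P * (v₁ * v₁)) ≡ 0ℚ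
      product = zero-product 4≢0 (begin
        ℤ→ℚ four * ((u₀ * u₀ - Q * (v₀ * v₀)) * (u₀ * u₀ - Q * P * (v₁ * v₁)))
          ≡⟨ solveℚ 7 (λ k P Q u₀ u₁ v₀ v₁ →
               k :* ((u₀ :* u₀ :- Q :* (v₀ :* v₀)) :* (u₀ :* u₀ :- Q :* P :* (v₁ :* v₁)))
               := k :* (u₀ :* u₀ :* ((u₀ :* u₀ :+ P :* (u₁ :* u₁)) :- (Q :* (v₀ :* v₀) :+ Q :* P :* (v₁ :* v₁))))
                 :+ k :* (P :* (Q :* (v₀ :* v₁) :* (Q :* (v₀ :* v₁)) :- u₀ :* u₁ :* (u₀ :* u₁)))) refl (ℤ→ℚ four) P Q u₀ u₁ v₀ v₁ ⟩
        ℤ→ℚ four * (u₀ * u₀ * ((u₀ * u₀ + P * (u₁ * u₁)) - (Q * (v₀ * v₀) + Q * P * (v₁ * v₁))))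
          + ℤ→ℚ four * (P * (Q * (v₀ * v₁) * (Q * (v₀ * v₁)) - u₀ * u₁ * (u₀ * u₁)))
          ≡⟨ cong₂ (λ s t → ℤ→ℚ four * (u₀ * u₀ * s) + t) (≡⇒-≡0 sum) squares ⟩
        ℤ→ℚ four * (u₀ * u₀ * 0ℚ) + 0ℚ
          ≡⟨ solveℚ 2 (λ k u → k :* (u :* κ 0) :+ κ 0 := κ 0) refl (ℤ→ℚ four) (u₀ * u₀) ⟩
        0ℚ ∎)
        where
        squares : ℤ→ℚ four * (P * (Q * (v₀ * v₁) * (Q * (v₀ * v₁)) - u₀ * u₁ * (u₀ * u₁))) ≡ 0ℚ
        squares = begin
          ℤ→ℚ four * (P * (Q * (v₀ * v₁) * (Q * (v₀ * v₁)) - u₀ * u₁ * (u₀ * u₁)))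
            ≡⟨⟩
          (1ℚ + 1ℚ) * (1ℚ + 1ℚ) * (P * (Q * (v₀ * v₁) * (Q * (v₀ * v₁)) - u₀ * u₁ * (u₀ * u₁)))
            ≡⟨ solveℚ 7 (λ o P Q u₀ u₁ v₀ v₁ →
                 (o :+ o) :* (o :+ o) :* (P :* (Q :* (v₀ :* v₁) :* (Q :* (v₀ :* v₁)) :- u₀ :* u₁ :* (u₀ :* u₁)))
                 := o :* o :* P :* ((Q :* (v₀ :* v₁ :+ v₁ :* v₀)) :* (Q :* (v₀ :* v₁ :+ v₁ :* v₀))
                     :- (u₀ :* u₁ :+ u₁ :* u₀) :* (u₀ :* u₁ :+ u₁ :* u₀))) refl 1ℚ P Q u₀ u₁ v₀ v₁ ⟩
          1ℚ * 1ℚ * P * ((Q * (v₀ * v₁ + v₁ * v₀)) * (Q * (v₀ * v₁ + v₁ * v₀)) - (u₀ * u₁ + u₁ * u₀) * (u₀ * u₁ + u₁ * u₀))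
            ≡⟨ cong (1ℚ * 1ℚ * P *_) (≡⇒-≡0 (cong₂ _*_ (sym twice) (sym twice))) ⟩
          1ℚ * 1ℚ * P * 0ℚ
            ≡⟨ ℚ.*-zeroʳ (1ℚ * 1ℚ * P) ⟩
          0ℚ ∎
      remainder : ∀ {s t S T : ℚ} → s + t ≡ S + T → s ≡ S → t ≡ T
      remainder {s} {t} {S} {T} e refl = trans (solveℚ 2 (λ s t → t := (s :+ t) :- s) refl s t)
        (trans (cong (_- s) e) (solveℚ 2 (λ s t → (s :+ t) :- s := t) refl s T))
      PQ≡ : Q * P ≡ R * (M₁ * M₁)
      PQ≡ = trans (cong₂ _*_ Q≡ P≡) (trans (solveℚ 3 (λ x y z → x :* z :* (x :* y) := y :* z :* (x :* x)) refl M₁ M₂ M₃)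
        (cong (_* (M₁ * M₁)) (sym R≡)))
      conclude : Dec (u₀ * u₀ - Q * (v₀ * v₀) ≡ 0ℚ) → (u₀ , u₁) ≡ (0ℚ , 0ℚ) × (v₀ , v₁) ≡ (0ℚ , 0ℚ)
      conclude (yes e) =
        let s≡S = -≡0⇒≡ e
            u₀≡0 , v₀≡0 = nonsquare-q u₀ v₀ s≡S
            t≡T = remainder sum s≡S
            Pu₁≡0 , Pv₁≡0 = nonsquare-q (P * u₁) (P * v₁) (begin
              P * u₁ * (P * u₁)         ≡⟨ solveℚ 2 (λ P u → P :* u :* (P :* u) := P :* (P :* (u :* u))) refl P u₁ ⟩
              P * (P * (u₁ * u₁))       ≡⟨ cong (P *_) t≡T ⟩
              P * (Q * P * (v₁ * v₁))   ≡⟨ solveℚ 3 (λ P Q v → P :* (Q :* P :* (v :* v)) := Q :* (P :* v :* (P :* v))) refl P Q v₁ ⟩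
              Q * (P * v₁ * (P * v₁))   ∎)
        in cong₂ _,_ u₀≡0 (zero-product P≢0 Pu₁≡0) , cong₂ _,_ v₀≡0 (zero-product P≢0 Pv₁≡0)
      -- Now s = T and t = S. Since qp = rm₁², both equations take the form u² = rv², and r is not a
      -- square.
      conclude (no ne) =
        let s≡T = -≡0⇒≡ (zero-product ne product)
            t≡S = remainder (trans sum (ℚ.+-comm (Q * (v₀ * v₀)) (Q * P * (v₁ * v₁)))) s≡T
            u₀≡0 , M₁v₁≡0 = nonsquare-r u₀ (M₁ * v₁) (begin
              u₀ * u₀                     ≡⟨ s≡T ⟩
              Q * P * (v₁ * v₁)           ≡⟨ cong (_* (v₁ * v₁)) PQ≡ ⟩
              R * (M₁ * M₁) * (v₁ * v₁)   ≡⟨ solveℚ 3 (λ R M v → R :* (M :* M) :* (v :* v) := R :* (M :* v :* (M :* v))) refl R M₁ v₁ ⟩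
              R * (M₁ * v₁ * (M₁ * v₁))   ∎)
            Pu₁≡0 , M₁v₀≡0 = nonsquare-r (P * u₁) (M₁ * v₀) (begin
              P * u₁ * (P * u₁)           ≡⟨ solveℚ 2 (λ P u → P :* u :* (P :* u) := P :* (P :* (u :* u))) refl P u₁ ⟩
              P * (P * (u₁ * u₁))         ≡⟨ cong (P *_) t≡S ⟩
              P * (Q * (v₀ * v₀))         ≡⟨ solveℚ 3 (λ P Q v → P :* (Q :* (v :* v)) := Q :* P :* (v :* v)) refl P Q v₀ ⟩
              Q * P * (v₀ * v₀)           ≡⟨ cong (_* (v₀ * v₀)) PQ≡ ⟩
              R * (M₁ * M₁) * (v₀ * v₀)   ≡⟨ solveℚ 3 (λ R M v → R :* (M :* M) :* (v :* v) := R :* (M :* v :* (M :* v))) refl R M₁ v₀ ⟩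
              R * (M₁ * v₀ * (M₁ * v₀))   ∎)
        in cong₂ _,_ u₀≡0 (zero-product P≢0 Pu₁≡0) , cong₂ _,_ (zero-product M₁≢0 M₁v₀≡0) (zero-product M₁≢0 M₁v₁≡0)

    private module E₂ = QuadraticExtension ℚ√p (Q , 0ℚ) (positive₁-rational Q>0) nonsquare₂

    scale : ℚ → ℚ × ℚ → ℚ × ℚ
    scale k (w₀ , w₁) = k * w₀ , k * w₁

    *-rational : ∀ k w → (k , 0ℚ) F.* w ≡ scale k w
    *-rational k (w₀ , w₁) = cong₂ _,_
      (solveℚ 4 (λ P k x y → k :* x :+ P :* (κ 0 :* y) := k :* x) refl P k w₀ w₁)
      (solveℚ 3 (λ k x y → k :* y :+ κ 0 :* x := k :* y) refl k w₀ w₁)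

    NonNegative₁ : ℚ × ℚ → Set
    NonNegative₁ u = Positive₁ u ⊎ (proj₁ u ≡ 0ℚ × proj₂ u ≡ 0ℚ)

    Positive₂ : ℚ × ℚ → ℚ × ℚ → Set
    Positive₂ u v =
        (Positive₁ u × NonNegative₁ v)
      ⊎ (NonNegative₁ u × Positive₁ v)
      ⊎ (Positive₁ u × Positive₁ (F.- v) × Positive₁ (u F.* u F.- scale Q (v F.* v)))
      ⊎ (Positive₁ (F.- u) × Positive₁ v × Positive₁ (scale Q (v F.* v) F.- u F.* u))

    private
      nonNegative₁⇒ : ∀ {u} → NonNegative₁ u → F.NonNeg u
      nonNegative₁⇒ = Sum.map₂ (λ { (e , e′) → cong₂ _,_ e e′ })

      nonNegative₁⇐ : ∀ {u} → F.NonNeg u → NonNegative₁ u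
      nonNegative₁⇐ = Sum.map₂ (λ { refl → refl , refl })

    positive₂⇒pos′ : ∀ {u v} → Positive₂ u v → E₂.Pos′ u v
    positive₂⇒pos′ (inj₁ (p , nn)) = E₂.signPos⇒pos′ (inj₁ (p , nonNegative₁⇒ nn))
    positive₂⇒pos′ (inj₂ (inj₁ (nn , p))) = E₂.signPos⇒pos′ (inj₂ (inj₁ (nonNegative₁⇒ nn , p)))
    positive₂⇒pos′ {u} {v} (inj₂ (inj₂ (inj₁ (p , _ , N)))) =
      inj₁ (p , subst (λ w → Positive₁ (u F.* u F.- w)) (sym (*-rational Q (v F.* v))) N)
    positive₂⇒pos′ {u} {v} (inj₂ (inj₂ (inj₂ (_ , p , N)))) =
      inj₂ (p , subst (λ w → Positive₁ (w F.- u F.* u)) (sym (*-rational Q (v F.* v))) N)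

    pos′⇒positive₂ : ∀ {u v} → E₂.Pos′ u v → Positive₂ u v
    pos′⇒positive₂ {u} {v} p = convert (E₂.pos′⇒signPos p)
      where
      convert : E₂.SignPos u v → Positive₂ u v
      convert (inj₁ (p , nn)) = inj₁ (p , nonNegative₁⇐ nn)
      convert (inj₂ (inj₁ (nn , p))) = inj₂ (inj₁ (nonNegative₁⇐ nn , p))
      convert (inj₂ (inj₂ (inj₁ (p , p′ , N)))) =
        inj₂ (inj₂ (inj₁ (p , p′ , subst (λ w → Positive₁ (u F.* u F.- w)) (*-rational Q (v F.* v)) N)))
      convert (inj₂ (inj₂ (inj₂ (p , p′ , N)))) =
        inj₂ (inj₂ (inj₂ (p , p′ , subst (λ w → Positive₁ (w F.- u F.* u)) (*-rational Q (v F.* v)) N)))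

    infixl 7 _·_
    _·_ : K → K → K
    _·_ = mul M₁ M₂ M₃ P Q R

    private
      infixl 6 _⊞_
      _⊞_ : K → K → K
      _⊞_ = _⊕_ n

    neg : K → K
    neg x = ⟨ - a x , - b x , - c x , - d x ⟩

    rational-· : ∀ k x → ⟨ k , 0ℚ , 0ℚ , 0ℚ ⟩ · x ≡ ⟨ k * a x , k * b x , k * c x , k * d x ⟩
    rational-· k ⟨ x₀ , x₁ , x₂ , x₃ ⟩ = solveᴷ 11 (λ M₁ M₂ M₃ P Q R k x₀ x₁ x₂ x₃ →
      mulᴾ M₁ M₂ M₃ P Q R (quad k (κ 0) (κ 0) (κ 0)) (quad x₀ x₁ x₂ x₃) , quad (k :* x₀) (k :* x₁) (k :* x₂) (k :* x₃))
      refl (M₁ ∷ M₂ ∷ M₃ ∷ P ∷ Q ∷ R ∷ k ∷ x₀ ∷ x₁ ∷ x₂ ∷ x₃ ∷ [])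

    K-commutativeRing : CommutativeRing 0ℓ 0ℓ
    K-commutativeRing = record
      { Carrier = K ; _≈_ = _≡_ ; _+_ = _⊞_ ; _*_ = _·_ ; -_ = neg ; 0# = zeroK n ; 1# = oneK n
      ; isCommutativeRing = mkIsCommutativeRing
          (λ x y z → ⟨⟩-cong (ℚ.+-assoc (a x) (a y) (a z)) (ℚ.+-assoc (b x) (b y) (b z)) (ℚ.+-assoc (c x) (c y) (c z)) (ℚ.+-assoc (d x) (d y) (d z)))
          (λ x y → ⟨⟩-cong (ℚ.+-comm (a x) (a y)) (ℚ.+-comm (b x) (b y)) (ℚ.+-comm (c x) (c y)) (ℚ.+-comm (d x) (d y)))
          (λ x → ⟨⟩-cong (ℚ.+-identityˡ (a x)) (ℚ.+-identityˡ (b x)) (ℚ.+-identityˡ (c x)) (ℚ.+-identityˡ (d x)))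
          (λ x → ⟨⟩-cong (ℚ.+-inverseˡ (a x)) (ℚ.+-inverseˡ (b x)) (ℚ.+-inverseˡ (c x)) (ℚ.+-inverseˡ (d x)))
          (mul-assoc M₁ M₂ M₃ P≡ Q≡ R≡)
          (mul-comm M₁ M₂ M₃ P Q R)
          (λ x → trans (rational-· 1ℚ x) (⟨⟩-cong (ℚ.*-identityˡ (a x)) (ℚ.*-identityˡ (b x)) (ℚ.*-identityˡ (c x)) (ℚ.*-identityˡ (d x))))
          (mul-distribˡ M₁ M₂ M₃ P Q R n)
      }

    PositiveK : K → Set
    PositiveK x = Positive₂ (M₁ * a x , M₁ * b x) (M₁ * c x , d x)

    positive-⊕ : ∀ {x y} → PositiveK x → PositiveK y → PositiveK (x ⊞ y)
    positive-⊕ {x} {y} p p′ = ≡.subst₂ Positive₂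
      (cong₂ _,_ (sym (ℚ.*-distribˡ-+ M₁ (a x) (a y))) (sym (ℚ.*-distribˡ-+ M₁ (b x) (b y))))
      (cong₂ _,_ (sym (ℚ.*-distribˡ-+ M₁ (c x) (c y))) refl)
      (pos′⇒positive₂ (E₂.pos′-+ (positive₂⇒pos′ p) (positive₂⇒pos′ p′)))

    private
      -- A quadruple of polynomials as an element of ℚ(√p)(√q); φᴾ is multiplication by m₁, in these coordinates.
      _×ᴾ_ : ∀ {k} → Polyℚ k × Polyℚ k → Polyℚ k × Polyℚ k → Polyℚ k → Polyℚ k × Polyℚ k
      ((x₀ , x₁) ×ᴾ (y₀ , y₁)) P = x₀ :* y₀ :+ P :* (x₁ :* y₁) , x₀ :* y₁ :+ x₁ :* y₀

      φᴾ : ∀ {k} → Polyℚ k → Quadᴾ k → Quadᴾ k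
      φᴾ M₁ (quad x₀ x₁ x₂ x₃) = quad (M₁ :* x₀) (M₁ :* x₁) (M₁ :* x₂) x₃

      join : ∀ {k} → Polyℚ k × Polyℚ k → Polyℚ k × Polyℚ k → Quadᴾ k
      join (u₀ , u₁) (v₀ , v₁) = quad u₀ u₁ v₀ v₁

      scaleᴾ : ∀ {k} → (P M₁ : Polyℚ k) → Quadᴾ k → Quadᴾ k
      scaleᴾ P M₁ (quad x₀ x₁ x₂ x₃) = join (((M₁ , κ 0) ×ᴾ (x₀ , x₁)) P) (((M₁ , κ 0) ×ᴾ (x₂ , x₃)) P)

      extᴾ : ∀ {k} → (P Q : Polyℚ k) → Quadᴾ k → Quadᴾ k → Quadᴾ k
      extᴾ P Q (quad x₀ x₁ x₂ x₃) (quad y₀ y₁ y₂ y₃) =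
        join (((x₀ , x₁) ×ᴾ (y₀ , y₁)) P) (((x₀ , x₁) ×ᴾ (y₂ , y₃)) P) ⊕ᴾ
        join (((Q , κ 0) ×ᴾ ((x₂ , x₃) ×ᴾ (y₂ , y₃)) P) P) (((x₂ , x₃) ×ᴾ (y₀ , y₁)) P)

      Pos″ : K → Set
      Pos″ ⟨ u₀ , u₁ , v₀ , v₁ ⟩ = E₂.Pos′ (u₀ , u₁) (v₀ , v₁)

      φ-·ᴾ : ∀ {k} → N-ary 14 (Polyℚ k) (Quadᴾ k × Quadᴾ k)
      φ-·ᴾ M₁ M₂ M₃ P Q R x₀ x₁ x₂ x₃ y₀ y₁ y₂ y₃ = let x = quad x₀ x₁ x₂ x₃ ; y = quad y₀ y₁ y₂ y₃ in
        extᴾ P Q (φᴾ M₁ x) (φᴾ M₁ y) , scaleᴾ P M₁ (φᴾ M₁ (mulᴾ M₁ M₂ M₃ P Q R x y))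

      φ-· : ∀ M₁ M₂ M₃ {P Q R} → P ≡ M₁ * M₂ → Q ≡ M₁ * M₃ → R ≡ M₂ * M₃ → ∀ x₀ x₁ x₂ x₃ y₀ y₁ y₂ y₃
        → Identityᴷ 14 φ-·ᴾ (M₁ ∷ M₂ ∷ M₃ ∷ P ∷ Q ∷ R ∷ x₀ ∷ x₁ ∷ x₂ ∷ x₃ ∷ y₀ ∷ y₁ ∷ y₂ ∷ y₃ ∷ [])
      φ-· M₁ M₂ M₃ refl refl refl x₀ x₁ x₂ x₃ y₀ y₁ y₂ y₃ =
        solveᴷ 11 (λ M₁ M₂ M₃ → φ-·ᴾ M₁ M₂ M₃ (M₁ :* M₂) (M₁ :* M₃) (M₂ :* M₃)) refl (M₁ ∷ M₂ ∷ M₃ ∷ x₀ ∷ x₁ ∷ x₂ ∷ x₃ ∷ y₀ ∷ y₁ ∷ y₂ ∷ y₃ ∷ [])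

    -- PositiveK x is the positivity of m₁x in ℚ(√p)(√q), and (m₁x)(m₁y) = m₁(m₁xy).
    positive-· : ∀ {x y} → PositiveK x → PositiveK y → PositiveK (x · y)
    positive-· {⟨ x₀ , x₁ , x₂ , x₃ ⟩} {⟨ y₀ , y₁ , y₂ , y₃ ⟩} p p′ =
      pos′⇒positive₂ (E₂.pos′-unscale (positive₁-rational M₁>0)
        (subst Pos″ (φ-· M₁ M₂ M₃ P≡ Q≡ R≡ x₀ x₁ x₂ x₃ y₀ y₁ y₂ y₃) (E₂.pos′-* (positive₂⇒pos′ p) (positive₂⇒pos′ p′))))

    σ-⊕ : ∀ s t x y → σ n s t (x ⊞ y) ≡ σ n s t x ⊞ σ n s t y
    σ-⊕ s t x y = ⟨⟩-cong refl (sgn-+ s (b x) (b y)) (sgn-+ t (c x) (c y))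
        (trans (cong (sgn n s) (sgn-+ t (d x) (d y))) (sgn-+ s (sgn n t (d x)) (sgn n t (d y))))
      where
      sgn-+ : ∀ s u v → sgn n s (u + v) ≡ sgn n s u + sgn n s v
      sgn-+ true  u v = refl
      sgn-+ false u v = ℚ.neg-distrib-+ u v

    private
      σ-·ᴾ : Bool → Bool → N-ary 14 (Polyℚ 14) (Quadᴾ 14 × Quadᴾ 14)
      σ-·ᴾ s t M₁ M₂ M₃ P Q R x₀ x₁ x₂ x₃ y₀ y₁ y₂ y₃ = let x = quad x₀ x₁ x₂ x₃ ; y = quad y₀ y₁ y₂ y₃ ; _·ᴾ_ = mulᴾ M₁ M₂ M₃ P Q R in
        σᴾ s t (x ·ᴾ y) , σᴾ s t x ·ᴾ σᴾ s t y

    σ-· : ∀ s t x y → σ n s t (x · y) ≡ σ n s t x · σ n s t y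
    σ-· true true x y = refl
    σ-· false true ⟨ x₀ , x₁ , x₂ , x₃ ⟩ ⟨ y₀ , y₁ , y₂ , y₃ ⟩ = solveᴷ 14 (σ-·ᴾ false true) refl (M₁ ∷ M₂ ∷ M₃ ∷ P ∷ Q ∷ R ∷ x₀ ∷ x₁ ∷ x₂ ∷ x₃ ∷ y₀ ∷ y₁ ∷ y₂ ∷ y₃ ∷ [])
    σ-· true false ⟨ x₀ , x₁ , x₂ , x₃ ⟩ ⟨ y₀ , y₁ , y₂ , y₃ ⟩ = solveᴷ 14 (σ-·ᴾ true false) refl (M₁ ∷ M₂ ∷ M₃ ∷ P ∷ Q ∷ R ∷ x₀ ∷ x₁ ∷ x₂ ∷ x₃ ∷ y₀ ∷ y₁ ∷ y₂ ∷ y₃ ∷ [])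
    σ-· false false ⟨ x₀ , x₁ , x₂ , x₃ ⟩ ⟨ y₀ , y₁ , y₂ , y₃ ⟩ = solveᴷ 14 (σ-·ᴾ false false) refl (M₁ ∷ M₂ ∷ M₃ ∷ P ∷ Q ∷ R ∷ x₀ ∷ x₁ ∷ x₂ ∷ x₃ ∷ y₀ ∷ y₁ ∷ y₂ ∷ y₃ ∷ [])

    σ-σ : ∀ s t s′ t′ x → ∃[ s″ ] ∃[ t″ ] (σ n s t (σ n s′ t′ x) ≡ σ n s″ t″ x)
    σ-σ s t s′ t′ x = s ⊙ s′ , t ⊙ t′ , ⟨⟩-cong refl (sgn-sgn s s′ (b x)) (sgn-sgn t t′ (c x))
        (trans (cong (sgn n s) (sgn-comm t s′ (sgn n t′ (d x))))
          (trans (sgn-sgn s s′ (sgn n t (sgn n t′ (d x)))) (cong (sgn n (s ⊙ s′)) (sgn-sgn t t′ (d x)))))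
      where
      _⊙_ : Bool → Bool → Bool
      true ⊙ t = t
      false ⊙ true = false
      false ⊙ false = true
      sgn-sgn : ∀ s t u → sgn n s (sgn n t u) ≡ sgn n (s ⊙ t) u
      sgn-sgn true  t     u = refl
      sgn-sgn false true  u = refl
      sgn-sgn false false u = solveℚ 1 (λ u → :- (:- u) := u) refl u
      sgn-comm : ∀ s t u → sgn n s (sgn n t u) ≡ sgn n t (sgn n s u)
      sgn-comm true  true  u = refl
      sgn-comm true  false u = refl
      sgn-comm false true  u = refl
      sgn-comm false false u = refl

    -- A record rather than a function type, so that TotallyPositive x is compared by x alone.
    record TotallyPositive (x : K) : Set where
      constructor totPos
      field conjugates : ∀ s t → PositiveK (σ n s t x)
    open TotallyPositive public

    totPos-⊕ : ∀ {x y} → TotallyPositive x → TotallyPositive y → TotallyPositive (x ⊞ y)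
    totPos-⊕ {x} {y} (totPos p) (totPos p′) = totPos λ s t → subst PositiveK (sym (σ-⊕ s t x y)) (positive-⊕ (p s t) (p′ s t))

    totPos-· : ∀ {x y} → TotallyPositive x → TotallyPositive y → TotallyPositive (x · y)
    totPos-· {x} {y} (totPos p) (totPos p′) = totPos λ s t → subst PositiveK (sym (σ-· s t x y)) (positive-· (p s t) (p′ s t))

    totPos-σ : ∀ s t {x} → TotallyPositive x → TotallyPositive (σ n s t x)
    totPos-σ s t {x} (totPos p) = totPos λ s′ t′ → let s″ , t″ , eq = σ-σ s′ t′ s t x in subst PositiveK (sym eq) (p s″ t″)

    private
      0<-scaled : ∀ {w} → 0ℚ < w → 0ℚ < (M₁ * M₁) * w
      0<-scaled = 0<-* (0<-* M₁>0 M₁>0)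

      even-norm : ∀ M u v → 0ℚ < u * u - M * (v * v) → 0ℚ < u * u - M * ((- v) * (- v))
      even-norm M u v = subst (0ℚ <_) (solveℚ 3 (λ P u v → u :* u :- P :* (v :* v) := u :* u :- P :* ((:- v) :* (:- v))) refl M u v)

    -- The hypotheses do not see the sign of v, so one computation serves all four embeddings.
    totPos-p : ∀ {u v} → 0ℚ < u → 0ℚ < u * u - P * (v * v) → TotallyPositive ⟨ u , v , 0ℚ , 0ℚ ⟩
    totPos-p {u} {v} pu N = totPos λ
      { true true → main v N ; true false → main v N ; false true → main (- v) (even-norm P u v N) ; false false → main (- v) (even-norm P u v N) }
      where
      main : ∀ v → 0ℚ < u * u - P * (v * v) → PositiveK ⟨ u , v , 0ℚ , 0ℚ ⟩
      main v N = inj₁ (pos′⇒positive₁ (inj₁ (0<-* M₁>0 pu , subst (0ℚ <_)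
        (solveℚ 4 (λ M P u v → (M :* M) :* (u :* u :- P :* (v :* v)) := (M :* u) :* (M :* u) :- P :* ((M :* v) :* (M :* v))) refl M₁ P u v)
        (0<-scaled N))) , inj₂ (ℚ.*-zeroʳ M₁ , refl))

    private
      normᴾ : ∀ {k} → (M₁ P Q : Polyℚ k) → Quadᴾ k → Quadᴾ k
      normᴾ M₁ P Q (quad x₀ x₁ x₂ x₃) = let u = M₁ :* x₀ , M₁ :* x₁ ; v = M₁ :* x₂ , x₃ ; w = κ 0 , κ 0 in
        join ((u ×ᴾ u) P) w ⊖ᴾ join (((Q , κ 0) ×ᴾ (v ×ᴾ v) P) P) w

      normK : K → K
      normK ⟨ x₀ , x₁ , x₂ , x₃ ⟩ = evaluateᴷ 7 (λ M₁ P Q x₀ x₁ x₂ x₃ → normᴾ M₁ P Q (quad x₀ x₁ x₂ x₃)) (M₁ ∷ P ∷ Q ∷ x₀ ∷ x₁ ∷ x₂ ∷ x₃ ∷ [])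

      norm-qᴾ norm-rᴾ : ∀ {k} → N-ary 8 (Polyℚ k) (Quadᴾ k × Quadᴾ k)
      norm-qᴾ M₁ M₂ M₃ P Q R u v = let o = κ 0 in quad (M₁ :* M₁ :* (u :* u :- Q :* (v :* v))) o (o :- o) (o :- o) , normᴾ M₁ P Q (quad u o v o)
      norm-rᴾ M₁ M₂ M₃ P Q R u v = let o = κ 0 in quad (M₁ :* M₁ :* (u :* u :- R :* (v :* v))) o (o :- o) (o :- o) , normᴾ M₁ P Q (quad u o o v)

      norm-r : ∀ M₁ M₂ M₃ {P Q R} → P ≡ M₁ * M₂ → Q ≡ M₁ * M₃ → R ≡ M₂ * M₃ → ∀ u v → Identityᴷ 8 norm-rᴾ (M₁ ∷ M₂ ∷ M₃ ∷ P ∷ Q ∷ R ∷ u ∷ v ∷ [])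
      norm-r M₁ M₂ M₃ refl refl refl u v =
        solveᴷ 5 (λ M₁ M₂ M₃ → norm-rᴾ M₁ M₂ M₃ (M₁ :* M₂) (M₁ :* M₃) (M₂ :* M₃)) refl (M₁ ∷ M₂ ∷ M₃ ∷ u ∷ v ∷ [])

      -- With u > 0 and a positive norm of m₁x over ℚ(√p), the part in ℚ(√p) outweighs the other,
      -- whatever its sign. The entries `0ℚ - 0ℚ` are the last two slots of `normK`, which subtracts
      -- two elements of ℚ(√p) padded with zeros.
      positive-norm : ∀ {u v w N} → 0ℚ < u → 0ℚ < N
        → ⟨ M₁ * M₁ * N , 0ℚ , 0ℚ - 0ℚ , 0ℚ - 0ℚ ⟩ ≡ normK ⟨ u , 0ℚ , v , w ⟩ → PositiveK ⟨ u , 0ℚ , v , w ⟩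
      positive-norm pu N eq = pos′⇒positive₂ (inj₁ (inj₁ (0<-* M₁>0 pu , ℚ.≤-reflexive (sym (ℚ.*-zeroʳ M₁))) ,
        subst (λ x → Positive₁ (a x , b x)) eq (positive₁-rational (0<-scaled N))))

    totPos-q : ∀ {u v} → 0ℚ < u → 0ℚ < u * u - Q * (v * v) → TotallyPositive ⟨ u , 0ℚ , v , 0ℚ ⟩
    totPos-q {u} {v} pu N = totPos λ
      { true true → main v N ; true false → main (- v) (even-norm Q u v N) ; false true → main v N ; false false → main (- v) (even-norm Q u v N) }
      where
      main : ∀ v → 0ℚ < u * u - Q * (v * v) → PositiveK ⟨ u , 0ℚ , v , 0ℚ ⟩
      main v N = positive-norm pu N (solveᴷ 8 norm-qᴾ refl (M₁ ∷ M₂ ∷ M₃ ∷ P ∷ Q ∷ R ∷ u ∷ v ∷ []))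

    totPos-r : ∀ {u v} → 0ℚ < u → 0ℚ < u * u - R * (v * v) → TotallyPositive ⟨ u , 0ℚ , 0ℚ , v ⟩
    totPos-r {u} {v} pu N = totPos λ
      { true true → main v N ; true false → main (- v) (even-norm R u v N) ; false true → main (- v) (even-norm R u v N)
      ; false false → main (- (- v)) (even-norm R u (- v) (even-norm R u v N)) }
      where
      main : ∀ v → 0ℚ < u * u - R * (v * v) → PositiveK ⟨ u , 0ℚ , 0ℚ , v ⟩
      main v N = positive-norm pu N (norm-r M₁ M₂ M₃ P≡ Q≡ R≡ u v)

    positive-rational⇒0< : ∀ {u} → PositiveK ⟨ u , 0ℚ , 0ℚ , 0ℚ ⟩ → 0ℚ < u
    positive-rational⇒0< {u} p = OrderedRing.pos-cancelˡ ℚ-ordered M₁>0 (first (positive₂⇒pos′ p))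
      where
      zero₁ : ¬ Positive₁ (M₁ * 0ℚ , 0ℚ)
      zero₁ p = F.¬pos-0 (subst (λ z → Positive₁ (z , 0ℚ)) (ℚ.*-zeroʳ M₁) p)
      first′ : E₁.Pos′ (M₁ * u) (M₁ * 0ℚ) → 0ℚ < M₁ * u
      first′ (inj₁ (p , _)) = p
      first′ (inj₂ (p , _)) = ⊥-elim (ℚ.<-irrefl refl (subst (0ℚ <_) (ℚ.*-zeroʳ M₁) p))
      first : E₂.Pos′ (M₁ * u , M₁ * 0ℚ) (M₁ * 0ℚ , 0ℚ) → 0ℚ < M₁ * u
      first (inj₁ (p , _)) = first′ (positive₁⇒pos′ p)
      first (inj₂ (p , _)) = ⊥-elim (zero₁ p)

    -- The sum of the four conjugates is 4a.
    totPos⇒0<a : ∀ {x} → TotallyPositive x → 0ℚ < a x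
    totPos⇒0<a {x} (totPos p) = OrderedRing.pos-cancelˡ ℚ-ordered {1ℚ + 1ℚ + 1ℚ + 1ℚ} (ℤ→ℚ-mono-< {+ 0} {+ 4} (ℤ.+<+ (s≤s z≤n)))
      (positive-rational⇒0< (subst PositiveK eq
        (positive-⊕ (positive-⊕ (positive-⊕ (p true true) (p true false)) (p false true)) (p false false))))
      where
      eq : σ n true true x ⊞ σ n true false x ⊞ σ n false true x ⊞ σ n false false x ≡ ⟨ (1ℚ + 1ℚ + 1ℚ + 1ℚ) * a x , 0ℚ , 0ℚ , 0ℚ ⟩
      eq = ⟨⟩-cong
        (trans (sym (cong (λ t → t + t + t + t) (ℚ.*-identityˡ (a x))))
          (solveℚ 2 (λ o x → o :* x :+ o :* x :+ o :* x :+ o :* x := (o :+ o :+ o :+ o) :* x) refl 1ℚ (a x)))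
        (solveℚ 1 (λ x → x :+ x :+ (:- x) :+ (:- x) := κ 0) refl (b x))
        (solveℚ 1 (λ x → x :+ (:- x) :+ x :+ (:- x) := κ 0) refl (c x))
        (solveℚ 1 (λ x → x :+ (:- x) :+ (:- x) :+ (:- (:- x)) := κ 0) refl (d x))

-- Transfer between ℤ and ℚ, bounded denominators, parity.

module Integrality where
  open RingSolving
  open OrderedRings
  open Rationals
  open Multiplication
  open FieldOrder
  open import Data.Rational using (_+_; _*_; -_; _-_; _<_)

  open IntegerCoefficients ℤ.+-*-commutativeRing public using (⟦_⟧; ⟦_⟧↓; plus; times; op; var) renaming
    (solve to solveℤ; prove to proveℤ; Polynomial to Poly; _:+_ to _[+]_; _:*_ to _[*]_; _:-_ to _[-]_; :-_ to [-]_; _:=_ to _[=]_; _:^_ to _[^]_; con to conℤ)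

  #_ : ∀ {k} → ℕ → Poly k
  # c = conℤ (+ c)

  _^ℚ_ : ℚ → ℕ → ℚ
  x ^ℚ zero = 1ℚ
  x ^ℚ suc k = x * x ^ℚ k

  ⟦_⟧ℚ : ∀ {k} → Poly k → Vec ℤ k → ℚ
  ⟦ op plus e e′ ⟧ℚ ρ = ⟦ e ⟧ℚ ρ + ⟦ e′ ⟧ℚ ρ
  ⟦ op times e e′ ⟧ℚ ρ = ⟦ e ⟧ℚ ρ * ⟦ e′ ⟧ℚ ρ
  ⟦ conℤ c ⟧ℚ ρ = ℤ→ℚ (⟦ conℤ c ⟧ ρ)
  ⟦ var i ⟧ℚ ρ = ℤ→ℚ (lookup ρ i)
  ⟦ e [^] k ⟧ℚ ρ = ⟦ e ⟧ℚ ρ ^ℚ k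
  ⟦ [-] e ⟧ℚ ρ = - ⟦ e ⟧ℚ ρ

  -- Carries the cast through a whole polynomial down to its variables in one step.
  ℤ→ℚ-poly : ∀ {k} (e : Poly k) ρ → ℤ→ℚ (⟦ e ⟧ ρ) ≡ ⟦ e ⟧ℚ ρ
  ℤ→ℚ-poly (op plus e e′) ρ = trans (ℤ→ℚ-+ (⟦ e ⟧ ρ) (⟦ e′ ⟧ ρ)) (cong₂ _+_ (ℤ→ℚ-poly e ρ) (ℤ→ℚ-poly e′ ρ))
  ℤ→ℚ-poly (op times e e′) ρ = trans (ℤ→ℚ-* (⟦ e ⟧ ρ) (⟦ e′ ⟧ ρ)) (cong₂ _*_ (ℤ→ℚ-poly e ρ) (ℤ→ℚ-poly e′ ρ))
  ℤ→ℚ-poly (conℤ c) ρ = refl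
  ℤ→ℚ-poly (var i) ρ = refl
  ℤ→ℚ-poly (e [^] zero) ρ = refl
  ℤ→ℚ-poly (e [^] suc k) ρ = trans (ℤ→ℚ-* (⟦ e ⟧ ρ) (⟦ e [^] k ⟧ ρ)) (cong₂ _*_ (ℤ→ℚ-poly e ρ) (ℤ→ℚ-poly (e [^] k) ρ))
  ℤ→ℚ-poly ([-] e) ρ = trans (ℤ→ℚ-neg (⟦ e ⟧ ρ)) (cong -_ (ℤ→ℚ-poly e ρ))

  v₀ : ∀ {k} → Poly (1 ℕ.+ k)
  v₀ = var zero
  v₁ : ∀ {k} → Poly (2 ℕ.+ k)
  v₁ = var (suc zero)
  v₂ : ∀ {k} → Poly (3 ℕ.+ k)
  v₂ = var (suc (suc zero))
  v₃ : ∀ {k} → Poly (4 ℕ.+ k)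
  v₃ = var (suc (suc (suc zero)))
  v₄ : ∀ {k} → Poly (5 ℕ.+ k)
  v₄ = var (suc (suc (suc (suc zero))))

  denominator-clears : ∀ x → ℤ→ℚ (↧ x) * x ≡ ℤ→ℚ (↥ x)
  denominator-clears x@(mkℚ k d-1 _) = ℚ.toℚᵘ-injective (begin
    toℚᵘ (ℤ→ℚ (+ suc d-1) * x)                 ≈⟨ ℚ.toℚᵘ-homo-* (ℤ→ℚ (+ suc d-1)) x ⟩
    toℚᵘ (ℤ→ℚ (+ suc d-1)) ℚᵘ.* mkℚᵘ k d-1     ≈⟨ ℚᵘ.*-cong (ℚ.toℚᵘ-fromℚᵘ (mkℚᵘ (+ suc d-1) 0)) ℚᵘ.≃-refl ⟩
    mkℚᵘ (+ suc d-1) 0 ℚᵘ.* mkℚᵘ k d-1         ≈⟨ *≡* (trans (solveℤ 2 (λ e k → e [*] k [*] # 1 [=] k [*] e) refl (+ suc d-1) k)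
                                                    (cong (λ t → k ℤ.* + suc t) (sym (ℕ.+-identityʳ d-1)))) ⟩
    mkℚᵘ k 0                                   ≈⟨ ℚ.toℚᵘ-fromℚᵘ (mkℚᵘ k 0) ⟨
    toℚᵘ (ℤ→ℚ k)                               ∎)
    where open ℚᵘ.≃-Reasoning

  private
    ∣∣≡0⇒ : ∀ {z} → ¬ z ≡ + 0 → ¬ ℤ.∣ z ∣ ≡ 0
    ∣∣≡0⇒ ne e = ne (ℤ.∣i∣≡0⇒i≡0 e)

  -- With u = s/t in lowest terms, t divides N, and N/t is again a common denominator
  -- of all powers of u: both s and t times (N/t)uᵏ are integers.
  bounded-denominators⇒integral : ∀ u N → ¬ N ≡ + 0 → (∀ k → Integral (ℤ→ℚ N * u ^ℚ k)) → Integral u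
  bounded-denominators⇒integral u N N≢0 int = go N N≢0 int (<-wellFounded ℤ.∣ N ∣)
    where
    go : ∀ N → ¬ N ≡ + 0 → (∀ k → Integral (ℤ→ℚ N * u ^ℚ k)) → Acc ℕ._<_ ℤ.∣ N ∣ → Integral u
    go N N≢0 int (acc rec) = step (↧ₙ u ℕ.≟ 1)
        (denominator-∣ N u (subst Integral (cong (ℤ→ℚ N *_) (ℚ.*-identityʳ u)) (int 1)))
      where
      step : Dec (↧ₙ u ≡ 1) → ↧ₙ u ∣ ℤ.∣ N ∣ → Integral u
      step (yes e) _ = denominator≡1⇒integral u e
      step (no ne) (divides q eq) = go N′ N′≢0 int′ (rec decreases)
        where
        t = ↧ₙ u
        N′ : ℤ
        N′ = (ℤ.sign N ℤ.◃ q)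
        N≡ : N ≡ N′ ℤ.* + t
        N≡ = begin
          N                                     ≡⟨ ℤ.◃-inverse N ⟨
          ℤ.sign N ℤ.◃ ℤ.∣ N ∣                  ≡⟨ cong (ℤ.sign N ℤ.◃_) eq ⟩
          ℤ.sign N ℤ.◃ (q ℕ.* t)                ≡⟨ cong (ℤ._◃ (q ℕ.* t)) (Sign.*-identityʳ (ℤ.sign N)) ⟨
          (ℤ.sign N Sign.* Sign.+) ℤ.◃ (q ℕ.* t) ≡⟨ ℤ.◃-distrib-* (ℤ.sign N) Sign.+ q t ⟩
          N′ ℤ.* (Sign.+ ℤ.◃ t)                 ≡⟨ cong (N′ ℤ.*_) (ℤ.+◃n≡+n t) ⟩
          N′ ℤ.* + t                            ∎
          where
          open ≡.≡-Reasoning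
        N′≢0 : ¬ N′ ≡ + 0
        N′≢0 e = N≢0 (trans N≡ (cong (ℤ._* + t) e))
        2≤t : 2 ℕ.≤ t
        2≤t = ℕ.≤∧≢⇒< (den≥1 u) (λ e → ne (sym e))
          where
          den≥1 : ∀ u → 1 ℕ.≤ ↧ₙ u
          den≥1 (mkℚ _ _ _) = s≤s z≤n
        decreases : ℤ.∣ N′ ∣ ℕ.< ℤ.∣ N ∣
        decreases = subst (ℤ.∣ N′ ∣ ℕ.<_) (sym (trans (cong ℤ.∣_∣ N≡) (ℤ.abs-* N′ (+ t))))
          (ℕ.m<m*n ℤ.∣ N′ ∣ t {{ℕ.≢-nonZero (∣∣≡0⇒ N′≢0)}} 2≤t)
        int′ : ∀ k → Integral (ℤ→ℚ N′ * u ^ℚ k)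
        int′ k = denominator≡1⇒integral y (coprime-num-den u
            (denominator-∣ (+ t) y (subst Integral t*y (int k)) , denominator-∣ (↥ u) y (subst Integral s*y (int (suc k)))))
          where
          y = ℤ→ℚ N′ * u ^ℚ k
          t*y : ℤ→ℚ N * u ^ℚ k ≡ ℤ→ℚ (+ t) * y
          t*y = trans (cong (_* u ^ℚ k) (trans (cong ℤ→ℚ N≡) (ℤ→ℚ-* N′ (+ t))))
            (solveℚ 3 (λ N t w → N :* t :* w := t :* (N :* w)) refl (ℤ→ℚ N′) (ℤ→ℚ (+ t)) (u ^ℚ k))
          s*y : ℤ→ℚ N * u ^ℚ suc k ≡ ℤ→ℚ (↥ u) * y
          s*y = trans (cong (_* u ^ℚ suc k) (trans (cong ℤ→ℚ N≡) (ℤ→ℚ-* N′ (+ t))))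
            (trans (solveℚ 4 (λ N t u w → N :* t :* (u :* w) := t :* u :* (N :* w)) refl (ℤ→ℚ N′) (ℤ→ℚ (+ t)) u (u ^ℚ k))
              (cong (_* y) (denominator-clears u)))

  bit : Bool → ℤ
  bit false = + 0
  bit true  = + 1

  parity : ∀ z → ∃[ k ] ∃[ e ] (z ≡ + 2 ℤ.* k ℤ.+ bit e)
  parity z = z divℕ 2 , classify (z modℕ 2) (n%ℕd<d z 2) (a≡a%ℕn+[a/ℕn]*n z 2)
    where
    classify : ∀ r → r ℕ.< 2 → z ≡ + r ℤ.+ (z divℕ 2) ℤ.* + 2 → ∃[ e ] (z ≡ + 2 ℤ.* (z divℕ 2) ℤ.+ bit e)
    classify 0 _ e = false , trans e (solveℤ 1 (λ k → # 0 [+] k [*] # 2 [=] # 2 [*] k [+] # 0) refl (z divℕ 2))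
    classify 1 _ e = true , trans e (solveℤ 1 (λ k → # 1 [+] k [*] # 2 [=] # 2 [*] k [+] # 1) refl (z divℕ 2))
    classify (suc (suc _)) (s≤s (s≤s ())) _

  multiple≢ : ∀ c k v → {False (c ∣? ℤ.∣ v ∣)} → ¬ (+ c ℤ.* k ≡ v)
  multiple≢ c k v {w} e = toWitnessFalse w (divides ℤ.∣ k ∣
    (trans (cong ℤ.∣_∣ (sym e)) (trans (ℤ.abs-* (+ c) k) (ℕ.*-comm c ℤ.∣ k ∣))))

-- Integrality expressed by bounded denominators.

module BoundedDenominators where
  open RingSolving

  -- A subring `Λ` containing the image of ℤ, into which a nonzero integer multiple of every element
  -- falls. The instance below is ℤ[√p,√q,√r], which need not be the full ring of integers.
  record Order (R : CommutativeRing 0ℓ 0ℓ) : Set₁ where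
    open CommutativeRing R
    field
      Λ      : Carrier → Set
      Λ-resp : ∀ {x y} → x ≈ y → Λ x → Λ y
      Λ-+    : ∀ {x y} → Λ x → Λ y → Λ (x + y)
      Λ-*    : ∀ {x y} → Λ x → Λ y → Λ (x * y)
      Λ-neg  : ∀ {x} → Λ x → Λ (- x)
      Λ-0    : Λ 0#
      emb    : ℤ → Carrier
      emb-*  : ∀ y z → emb (y ℤ.* z) ≈ emb y * emb z
      Λ-emb  : ∀ z → Λ (emb z)
      clear  : ∀ x → ∃[ N ] (¬ N ≡ + 0 × Λ (emb N * x))

  module AlmostIntegrality (R : CommutativeRing 0ℓ 0ℓ) (O : Order R) where
    open CommutativeRing R renaming (refl to ≈-refl; sym to ≈-sym; trans to ≈-trans)
    open Order O
    open IntegerCoefficients R using (solve; _:+_; _:*_; _:-_; :-_; _:=_; con)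

    eval : List ℤ → Carrier → Carrier
    eval []       x = 1#
    eval (z ∷ zs) x = emb z + x * eval zs x

    pow : Carrier → ℕ → Carrier
    pow x zero    = 1#
    pow x (suc k) = x * pow x k

    -- All powers have a common denominator; this is integrality, in a form which is
    -- evidently stable under sums and products.
    AlmostIntegral : Carrier → Set
    AlmostIntegral x = ∃[ N ] (¬ N ≡ + 0 × (∀ k → Λ (emb N * pow x k)))

    private
      *≢0 : ∀ {y z} → ¬ y ≡ + 0 → ¬ z ≡ + 0 → ¬ y ℤ.* z ≡ + 0
      *≢0 {y} ny nz e = [ ny , nz ]′ (ℤ.i*j≡0⇒i≡0∨j≡0 y e)

      common : ∀ x l → ∃[ N ] (¬ N ≡ + 0 × (∀ i → i ℕ.< l → Λ (emb N * pow x i)))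
      common x zero = + 1 , (λ ()) , λ _ ()
      common x (suc l) = let N , N≢0 , int = common x l
                             M , M≢0 , int′ = clear (pow x l)
                         in N ℤ.* M , *≢0 N≢0 M≢0 , λ i i<1+l → extend N int M int′ i (ℕ.m≤n⇒m<n∨m≡n (ℕ.≤-pred i<1+l))
        where
        extend : ∀ N → (∀ i → i ℕ.< l → Λ (emb N * pow x i)) → ∀ M → Λ (emb M * pow x l)
          → ∀ i → i ℕ.< l ⊎ i ≡ l → Λ (emb (N ℤ.* M) * pow x i)
        extend N int M int′ i (inj₁ lt) = Λ-resp (≈-trans (solve 3 (λ N M y → M :* (N :* y) := N :* M :* y) ≈-refl (emb N) (emb M) (pow x i)) (*-congʳ (≈-sym (emb-* N M))))
          (Λ-* (Λ-emb M) (int i lt))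
        extend N int M int′ i (inj₂ refl) = Λ-resp (≈-trans (solve 3 (λ N M y → N :* (M :* y) := N :* M :* y) ≈-refl (emb N) (emb M) (pow x i)) (*-congʳ (≈-sym (emb-* N M))))
          (Λ-* (Λ-emb N) int′)

    root⇒almostIntegral : ∀ {x} cs → eval cs x ≈ 0# → AlmostIntegral x
    root⇒almostIntegral {x} cs root = N , proj₁ (proj₂ (common x (length cs))) , all (length cs) refl
      where
      N = proj₁ (common x (length cs))
      start = proj₂ (proj₂ (common x (length cs)))
      Scaled : ℕ → Set
      Scaled k = Λ (emb N * pow x k)
      -- Multiplying the equation by xᵏ expresses x^(k+l) by lower powers.
      top : ∀ cs k → (∀ i → i ℕ.< length cs → Scaled (k ℕ.+ i)) → Λ (emb N * (eval cs x * pow x k)) → Scaled (k ℕ.+ length cs)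
      top [] k _ s = subst Scaled (sym (ℕ.+-identityʳ k)) (Λ-resp (*-congˡ (*-identityˡ (pow x k))) s)
      top (z ∷ zs) k window s = subst Scaled (sym (ℕ.+-suc k (length zs)))
        (top zs (suc k) (λ i lt → subst Scaled (ℕ.+-suc k i) (window (suc i) (s≤s lt)))
          (Λ-resp
            (solve 5 (λ N z x e w → N :* ((z :+ x :* e) :* w) :+ (:- (z :* (N :* w))) := N :* (e :* (x :* w))) ≈-refl (emb N) (emb z) x (eval zs x) (pow x k))
            (Λ-+ s (Λ-neg (Λ-* (Λ-emb z) (subst Scaled (ℕ.+-identityʳ k) (window 0 (s≤s z≤n))))))))
      root·pow : ∀ k → Λ (emb N * (eval cs x * pow x k))
      root·pow k = Λ-resp (≈-sym (≈-trans (*-congˡ (*-congʳ root)) (solve 2 (λ N y → N :* (con (+ 0) :* y) := con (+ 0)) ≈-refl (emb N) (pow x k)))) Λ-0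
      window : ∀ k i → i ℕ.< length cs → Scaled (k ℕ.+ i)
      window zero i lt = start i lt
      window (suc k) i lt = next (ℕ.m≤n⇒m<n∨m≡n lt)
        where
        next : suc i ℕ.< length cs ⊎ suc i ≡ length cs → Scaled (suc k ℕ.+ i)
        next (inj₁ lt′) = subst Scaled (ℕ.+-suc k i) (window k (suc i) lt′)
        next (inj₂ eq) = subst Scaled (trans (cong (k ℕ.+_) (sym eq)) (ℕ.+-suc k i)) (top cs k (window k) (root·pow k))
      all : ∀ l → l ≡ length cs → ∀ k → Scaled k
      -- The constant polynomial 1 has an empty window; its root equation 1 = 0 makes `top`
      -- sufficient.
      all zero eq k = subst Scaled (trans (cong (k ℕ.+_) (sym eq)) (ℕ.+-identityʳ k)) (top cs k (window k) (root·pow k))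
      all (suc l) eq k = subst Scaled (ℕ.+-identityʳ k) (window k 0 (subst (0 ℕ.<_) eq (s≤s z≤n)))

    private
      mixed : ∀ {x y} (ix : AlmostIntegral x) (iy : AlmostIntegral y) → ∀ i j → Λ (emb (proj₁ ix ℤ.* proj₁ iy) * (pow x i * pow y j))
      mixed {x} {y} (N , _ , int) (M , _ , int′) i j = Λ-resp
        (≈-trans (solve 4 (λ N M u v → (N :* u) :* (M :* v) := N :* M :* (u :* v)) ≈-refl (emb N) (emb M) (pow x i) (pow y j)) (*-congʳ (≈-sym (emb-* N M))))
        (Λ-* (int i) (int′ j))

    almostIntegral-+ : ∀ {x y} → AlmostIntegral x → AlmostIntegral y → AlmostIntegral (x + y)
    almostIntegral-+ {x} {y} ix@(N , N≢0 , _) iy@(M , M≢0 , _) = N ℤ.* M , *≢0 N≢0 M≢0 ,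
      λ k → Λ-resp (*-congˡ (≈-trans (*-congˡ (*-identityˡ 1#)) (*-identityʳ (pow (x + y) k)))) (go k 0 0)
      where
      -- The extra monomial xⁱyʲ lets (x + y)ᵏ be expanded by recursion on k, with no binomial
      -- coefficients.
      go : ∀ k i j → Λ (emb (N ℤ.* M) * (pow (x + y) k * (pow x i * pow y j)))
      go zero i j = Λ-resp (*-congˡ (≈-sym (*-identityˡ _))) (mixed ix iy i j)
      go (suc k) i j = Λ-resp
        (solve 6 (λ E x y w u v → E :* (w :* ((x :* u) :* v)) :+ E :* (w :* (u :* (y :* v))) := E :* ((x :+ y) :* w :* (u :* v))) ≈-refl (emb (N ℤ.* M)) x y (pow (x + y) k) (pow x i) (pow y j))
        (Λ-+ (go k (suc i) j) (go k i (suc j)))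

    almostIntegral-* : ∀ {x y} → AlmostIntegral x → AlmostIntegral y → AlmostIntegral (x * y)
    almostIntegral-* {x} {y} ix@(N , N≢0 , _) iy@(M , M≢0 , _) = N ℤ.* M , *≢0 N≢0 M≢0 ,
      λ k → Λ-resp (*-congˡ (pow-* k)) (mixed ix iy k k)
      where
      pow-* : ∀ k → pow x k * pow y k ≈ pow (x * y) k
      pow-* zero = *-identityˡ _
      pow-* (suc k) = ≈-trans (solve 4 (λ x y u v → (x :* u) :* (y :* v) := x :* y :* (u :* v)) ≈-refl x y (pow x k) (pow y k)) (*-congˡ (pow-* k))

    almostIntegral-map : (f : Carrier → Carrier) → (∀ {x} → Λ x → Λ (f x)) → (∀ x y → f (x * y) ≈ f x * f y)
      → (∀ z → f (emb z) ≈ emb z) → f 1# ≈ 1# → ∀ {x} → AlmostIntegral x → AlmostIntegral (f x)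
    almostIntegral-map f f-Λ f-* f-emb f-1 {x} (N , N≢0 , int) = N , N≢0 , λ k → Λ-resp (≈-trans (f-* (emb N) (pow x k)) (*-cong (f-emb N) (f-pow k))) (f-Λ (int k))
      where
      f-pow : ∀ k → f (pow x k) ≈ pow (f x) k
      f-pow zero = f-1
      f-pow (suc k) = ≈-trans (f-* x (pow x k)) (*-congˡ (f-pow k))

    -- (X² − tX + N)(X² − t′X + N′) vanishes at y when its first factor does.
    quartic-root : ∀ {y t t′ N N′ : Carrier} c₀ c₁ c₂ c₃ → y * y + N ≈ t * y
      → emb c₃ ≈ - (t + t′) → emb c₂ ≈ t * t′ + N + N′ → emb c₁ ≈ - (t * N′ + t′ * N) → emb c₀ ≈ N * N′
      → eval (c₀ ∷ c₁ ∷ c₂ ∷ c₃ ∷ []) y ≈ 0#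
    quartic-root {y} {t} {t′} {N} {N′} c₀ c₁ c₂ c₃ eq e₃ e₂ e₁ e₀ = ≈-trans
      (+-cong e₀ (*-congˡ (+-cong e₁ (*-congˡ (+-cong e₂ (*-congˡ (+-cong e₃ (*-identityʳ y))))))))
      (≈-trans (solve 5 (λ y t t′ N N′ → N :* N′ :+ y :* ((:- (t :* N′ :+ t′ :* N)) :+ y :* ((t :* t′ :+ N :+ N′) :+ y :* ((:- (t :+ t′)) :+ y)))
           := ((y :* y :+ N) :- t :* y) :* (y :* y :- t′ :* y :+ N′)) ≈-refl y t t′ N N′)
        (≈-trans (*-congʳ (≈-trans (+-congʳ eq) (-‿inverseʳ (t * y)))) (zeroˡ _)))

-- The ring of integers of K as an explicit lattice.

module AlgebraicIntegers where
  open RingSolving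
  open OrderedRings
  open Rationals
  open Multiplication
  open FieldOrder
  open Integrality
  open BoundedDenominators
  open import Data.Rational using (_+_; _*_; -_; _-_; _<_)

  module Integers (S : Setting) where
    open Setting S
    open Biquadratic S
    private
      infixl 6 _⊞_
      _⊞_ : K → K → K
      _⊞_ = _⊕_ n
      emb : ℤ → K
      emb = embℤ n

    -- The order ℤ[√p,√q,√r].
    Coordinatewise : K → Set
    Coordinatewise x = Integral (a x) × Integral (b x) × Integral (c x) × Integral (d x)

    private
      int0 : Integral 0ℚ
      int0 = + 0 , refl
      intM₁ : Integral M₁
      intM₁ = + 2 ℤ.* ν ℤ.- + 1 , M₁≡
      intM₂ : Integral M₂
      intM₂ = + 2 ℤ.* ν ℤ.+ + 1 , M₂≡
      intM₃ : Integral M₃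
      intM₃ = + 2 ℤ.* ν ℤ.+ + 3 , M₃≡
      intP : Integral P
      intP = subst Integral (sym P≡) (integral-* intM₁ intM₂)
      intQ : Integral Q
      intQ = subst Integral (sym Q≡) (integral-* intM₁ intM₃)
      intR : Integral R
      intR = subst Integral (sym R≡) (integral-* intM₂ intM₃)

    coordinatewise-⊕ : ∀ {x y} → Coordinatewise x → Coordinatewise y → Coordinatewise (x ⊞ y)
    coordinatewise-⊕ (i₀ , i₁ , i₂ , i₃) (j₀ , j₁ , j₂ , j₃) = integral-+ i₀ j₀ , integral-+ i₁ j₁ , integral-+ i₂ j₂ , integral-+ i₃ j₃

    coordinatewise-neg : ∀ {x} → Coordinatewise x → Coordinatewise (neg x)
    coordinatewise-neg (i₀ , i₁ , i₂ , i₃) = integral-neg i₀ , integral-neg i₁ , integral-neg i₂ , integral-neg i₃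

    coordinatewise-· : ∀ {x y} → Coordinatewise x → Coordinatewise y → Coordinatewise (x · y)
    coordinatewise-· (i₀ , i₁ , i₂ , i₃) (j₀ , j₁ , j₂ , j₃) =
        integral-+ (integral-+ (integral-+ (integral-* i₀ j₀) (integral-* intP (integral-* i₁ j₁))) (integral-* intQ (integral-* i₂ j₂))) (integral-* intR (integral-* i₃ j₃))
      , integral-+ (integral-+ (integral-* i₀ j₁) (integral-* i₁ j₀)) (integral-* intM₃ (integral-+ (integral-* i₂ j₃) (integral-* i₃ j₂)))
      , integral-+ (integral-+ (integral-* i₀ j₂) (integral-* i₂ j₀)) (integral-* intM₂ (integral-+ (integral-* i₁ j₃) (integral-* i₃ j₁)))
      , integral-+ (integral-+ (integral-* i₀ j₃) (integral-* i₃ j₀)) (integral-* intM₁ (integral-+ (integral-* i₁ j₂) (integral-* i₂ j₁)))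

    coordinatewise-emb : ∀ z → Coordinatewise (emb z)
    coordinatewise-emb z = (z , refl) , int0 , int0 , int0

    coordinatewise-0 : Coordinatewise (zeroK n)
    coordinatewise-0 = int0 , int0 , int0 , int0

    integral-sgn : ∀ s {u} → Integral u → Integral (sgn n s u)
    integral-sgn true  i = i
    integral-sgn false i = integral-neg i

    coordinatewise-σ : ∀ s t {x} → Coordinatewise x → Coordinatewise (σ n s t x)
    coordinatewise-σ s t (i₀ , i₁ , i₂ , i₃) = i₀ , integral-sgn s i₁ , integral-sgn t i₂ , integral-sgn s (integral-sgn t i₃)

    emb-* : ∀ y z → emb (y ℤ.* z) ≡ emb y · emb z
    emb-* y z = ⟨⟩-cong
      (trans (ℤ→ℚ-* y z) (solveℚ 5 (λ P Q R y z → y :* z := y :* z :+ P :* (κ 0 :* κ 0) :+ Q :* (κ 0 :* κ 0) :+ R :* (κ 0 :* κ 0)) refl P Q R (ℤ→ℚ y) (ℤ→ℚ z)))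
      (part M₃) (part M₂) (part M₁)
      where
      part : ∀ M → 0ℚ ≡ ℤ→ℚ y * 0ℚ + 0ℚ * ℤ→ℚ z + M * (0ℚ * 0ℚ + 0ℚ * 0ℚ)
      part M = solveℚ 3 (λ M y z → κ 0 := y :* κ 0 :+ κ 0 :* z :+ M :* (κ 0 :* κ 0 :+ κ 0 :* κ 0)) refl M (ℤ→ℚ y) (ℤ→ℚ z)

    emb-· : ∀ z x → emb z · x ≡ ⟨ ℤ→ℚ z * a x , ℤ→ℚ z * b x , ℤ→ℚ z * c x , ℤ→ℚ z * d x ⟩
    emb-· z x = rational-· (ℤ→ℚ z) x

    clear-denominators : ∀ x → ∃[ N ] (¬ N ≡ + 0 × Coordinatewise (emb N · x))
    clear-denominators x@(⟨ x₀ , x₁ , x₂ , x₃ ⟩) = N , N≢0 , subst Coordinatewise (sym (emb-· N x))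
        ( subst Integral (trans (solveℚ 5 (λ p q r s x → q :* r :* s :* (p :* x) := p :* q :* r :* s :* x) refl p q r s x₀) (cong (_* x₀) (sym N≡))) (integral-* intqrs (clear x₀))
        , subst Integral (trans (solveℚ 5 (λ p q r s x → p :* r :* s :* (q :* x) := p :* q :* r :* s :* x) refl p q r s x₁) (cong (_* x₁) (sym N≡))) (integral-* intprs (clear x₁))
        , subst Integral (trans (solveℚ 5 (λ p q r s x → p :* q :* s :* (r :* x) := p :* q :* r :* s :* x) refl p q r s x₂) (cong (_* x₂) (sym N≡))) (integral-* intpqs (clear x₂))
        , subst Integral (trans (solveℚ 5 (λ p q r s x → p :* q :* r :* (s :* x) := p :* q :* r :* s :* x) refl p q r s x₃) (cong (_* x₃) (sym N≡))) (integral-* intpqr (clear x₃)))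
      where
      N = ↧ x₀ ℤ.* ↧ x₁ ℤ.* ↧ x₂ ℤ.* ↧ x₃
      p = ℤ→ℚ (↧ x₀)
      q = ℤ→ℚ (↧ x₁)
      r = ℤ→ℚ (↧ x₂)
      s = ℤ→ℚ (↧ x₃)
      N≡ : ℤ→ℚ N ≡ p * q * r * s
      N≡ = trans (ℤ→ℚ-* (↧ x₀ ℤ.* ↧ x₁ ℤ.* ↧ x₂) (↧ x₃)) (cong (_* s) (trans (ℤ→ℚ-* (↧ x₀ ℤ.* ↧ x₁) (↧ x₂)) (cong (_* r) (ℤ→ℚ-* (↧ x₀) (↧ x₁)))))
      clear : ∀ x → Integral (ℤ→ℚ (↧ x) * x)
      clear x = ↥ x , denominator-clears x
      intpqr = integral-* (integral-* (↧ x₀ , refl) (↧ x₁ , refl)) (↧ x₂ , refl)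
      intpqs = integral-* (integral-* (↧ x₀ , refl) (↧ x₁ , refl)) (↧ x₃ , refl)
      intprs = integral-* (integral-* (↧ x₀ , refl) (↧ x₂ , refl)) (↧ x₃ , refl)
      intqrs = integral-* (integral-* (↧ x₁ , refl) (↧ x₂ , refl)) (↧ x₃ , refl)
      den≢0 : ∀ x → ¬ ↧ x ≡ + 0
      den≢0 (mkℚ _ _ _) ()
      *≢0 : ∀ {y z} → ¬ y ≡ + 0 → ¬ z ≡ + 0 → ¬ y ℤ.* z ≡ + 0
      *≢0 {y} ny nz e = [ ny , nz ]′ (ℤ.i*j≡0⇒i≡0∨j≡0 y e)
      N≢0 : ¬ N ≡ + 0
      N≢0 = *≢0 (*≢0 (*≢0 (den≢0 x₀) (den≢0 x₁)) (den≢0 x₂)) (den≢0 x₃)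

    coordinatewise-order : Order K-commutativeRing
    coordinatewise-order = record
      { Λ = Coordinatewise ; Λ-resp = subst Coordinatewise
      ; Λ-+ = coordinatewise-⊕ ; Λ-* = coordinatewise-· ; Λ-neg = coordinatewise-neg ; Λ-0 = coordinatewise-0
      ; emb = emb ; emb-* = emb-* ; Λ-emb = coordinatewise-emb ; clear = clear-denominators }

    open AlmostIntegrality K-commutativeRing coordinatewise-order public

    σ-rational : ∀ s t u → σ n s t ⟨ u , 0ℚ , 0ℚ , 0ℚ ⟩ ≡ ⟨ u , 0ℚ , 0ℚ , 0ℚ ⟩
    σ-rational s t u = ⟨⟩-cong refl (sgn-0 s) (sgn-0 t) (trans (cong (sgn n s) (sgn-0 t)) (sgn-0 s))
      where
      sgn-0 : ∀ s → sgn n s 0ℚ ≡ 0ℚ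
      sgn-0 true = refl
      sgn-0 false = refl

    almostIntegral-σ : ∀ s t {x} → AlmostIntegral x → AlmostIntegral (σ n s t x)
    almostIntegral-σ s t = almostIntegral-map (σ n s t) (coordinatewise-σ s t) (σ-· s t) (λ z → σ-rational s t (ℤ→ℚ z)) (σ-rational s t 1ℚ)

    almostIntegral-rational : ∀ {u} → AlmostIntegral ⟨ u , 0ℚ , 0ℚ , 0ℚ ⟩ → Integral u
    almostIntegral-rational {u} (N , N≢0 , int) = bounded-denominators⇒integral u N N≢0
      (λ k → subst Integral (trans (cong a (emb-· N (pow u′ k))) (cong (ℤ→ℚ N *_) (cong a (pow-rational k)))) (proj₁ (int k)))
      where
      u′ = ⟨ u , 0ℚ , 0ℚ , 0ℚ ⟩
      pow-rational : ∀ k → pow u′ k ≡ ⟨ u ^ℚ k , 0ℚ , 0ℚ , 0ℚ ⟩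
      pow-rational zero = refl
      pow-rational (suc k) = trans (cong (u′ ·_) (pow-rational k)) (trans (rational-· u ⟨ u ^ℚ k , 0ℚ , 0ℚ , 0ℚ ⟩)
        (⟨⟩-cong refl (ℚ.*-zeroʳ u) (ℚ.*-zeroʳ u) (ℚ.*-zeroʳ u)))

    half : ℤ → ℤ → ℤ → ℤ → K
    half x y z w = ⟨ ½ * ℤ→ℚ x , ½ * ℤ→ℚ y , ½ * ℤ→ℚ z , ½ * ℤ→ℚ w ⟩

    -- ℤ + ℤ√p + ℤ(1+√q)/2 + ℤ(√p+√r)/2
    lattice : ℤ → ℤ → ℤ → ℤ → K
    lattice A B C D = half (+ 2 ℤ.* A ℤ.+ C) (+ 2 ℤ.* B ℤ.+ D) C D

    p q r : ℤ
    p = (+ 2 ℤ.* ν ℤ.- + 1) ℤ.* (+ 2 ℤ.* ν ℤ.+ + 1)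
    q = (+ 2 ℤ.* ν ℤ.- + 1) ℤ.* (+ 2 ℤ.* ν ℤ.+ + 3)
    r = (+ 2 ℤ.* ν ℤ.+ + 1) ℤ.* (+ 2 ℤ.* ν ℤ.+ + 3)

    P≡ℤ : P ≡ ℤ→ℚ p
    P≡ℤ = trans P≡ (trans (cong₂ _*_ M₁≡ M₂≡) (sym (ℤ→ℚ-* (+ 2 ℤ.* ν ℤ.- + 1) (+ 2 ℤ.* ν ℤ.+ + 1))))
    Q≡ℤ : Q ≡ ℤ→ℚ q
    Q≡ℤ = trans Q≡ (trans (cong₂ _*_ M₁≡ M₃≡) (sym (ℤ→ℚ-* (+ 2 ℤ.* ν ℤ.- + 1) (+ 2 ℤ.* ν ℤ.+ + 3))))
    R≡ℤ : R ≡ ℤ→ℚ r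
    R≡ℤ = trans R≡ (trans (cong₂ _*_ M₂≡ M₃≡) (sym (ℤ→ℚ-* (+ 2 ℤ.* ν ℤ.+ + 1) (+ 2 ℤ.* ν ℤ.+ + 3))))

    ½-double : ∀ u → u ≡ ½ * (u + u)
    ½-double u = trans (sym (ℚ.*-identityˡ u)) (solveℚ 2 (λ h u → (h :+ h) :* u := h :* (u :+ u)) refl ½ u)

    private
      halve : ∀ u k {e} → u + u ≡ ℤ→ℚ (+ 2 ℤ.* k ℤ.+ bit e) → e ≡ false → Integral u
      halve u k eq refl = k , trans (½-double u) (trans (cong (½ *_) (trans eq
          (trans (cong ℤ→ℚ (solveℤ 1 (λ k → # 2 [*] k [+] # 0 [=] k [+] k) refl k)) (ℤ→ℚ-+ k k))))
        (sym (½-double (ℤ→ℚ k))))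

      quadruple : ∀ k → ℤ→ℚ (+ 4 ℤ.* k) ≡ (ℤ→ℚ k + ℤ→ℚ k) + (ℤ→ℚ k + ℤ→ℚ k)
      quadruple k = trans (cong ℤ→ℚ (solveℤ 1 (λ k → # 4 [*] k [=] k [+] k [+] (k [+] k)) refl k))
        (trans (ℤ→ℚ-+ (k ℤ.+ k) (k ℤ.+ k)) (cong₂ _+_ (ℤ→ℚ-+ k k) (ℤ→ℚ-+ k k)))

      -- x² − m y² ∈ ℤ and 2x ∈ ℤ force m (2y)² ∈ ℤ.
      from-norm : ∀ m u v → Integral (u + u) → Integral (u * u - m * (v * v)) → Integral (m * ((v + v) * (v + v)))
      from-norm m u v i N = subst Integral
        (solveℚ 3 (λ m u v → let N = u :* u :- m :* (v :* v) in
           (u :+ u) :* (u :+ u) :- ((N :+ N) :+ (N :+ N)) := m :* ((v :+ v) :* (v :+ v))) refl m u v)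
        (integral-- (integral-* i i) (integral-+ (integral-+ N N) (integral-+ N N)))

    private
      -- p ≡ 3 (mod 4), so E² − pF² ≡ 0 (mod 4) only for even E and F.
      even-p : ∀ E F k g h s t → E ℤ.* E ℤ.- p ℤ.* (F ℤ.* F) ≡ + 4 ℤ.* k → E ≡ + 2 ℤ.* g ℤ.+ bit s → F ≡ + 2 ℤ.* h ℤ.+ bit t
        → s ≡ false × t ≡ false
      even-p .(+ 2 ℤ.* g ℤ.+ bit s) .(+ 2 ℤ.* h ℤ.+ bit t) k g h s t equation refl refl = decide s t mod4
        where
        F = + 2 ℤ.* h ℤ.+ bit t
        V W : ℤ
        V = g ℤ.* g ℤ.+ g ℤ.* bit s ℤ.- ν ℤ.* ν ℤ.* (F ℤ.* F) ℤ.+ (h ℤ.* h ℤ.+ h ℤ.* bit t)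
        W = k ℤ.- V
        mod4 : + 4 ℤ.* W ≡ bit s ℤ.* bit s ℤ.+ bit t ℤ.* bit t
        mod4 = trans (solveℤ 2 (λ k V → # 4 [*] (k [-] V) [=] # 4 [*] k [-] # 4 [*] V) refl k V)
          (trans (cong (ℤ._- + 4 ℤ.* V) (sym equation))
              (solveℤ 5 (λ g h s t ν → let E = # 2 [*] g [+] s ; F = # 2 [*] h [+] t in
                E [*] E [-] ((# 2 [*] ν [-] # 1) [*] (# 2 [*] ν [+] # 1)) [*] (F [*] F)
                  [-] # 4 [*] (g [*] g [+] g [*] s [-] ν [*] ν [*] (F [*] F) [+] (h [*] h [+] h [*] t))
                [=] s [*] s [+] t [*] t) refl g h (bit s) (bit t) ν))
        decide : ∀ s t → + 4 ℤ.* W ≡ bit s ℤ.* bit s ℤ.+ bit t ℤ.* bit t → s ≡ false × t ≡ false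
        decide false false _ = refl , refl
        decide false true m = ⊥-elim (multiple≢ 4 W (+ 1) m)
        decide true false m = ⊥-elim (multiple≢ 4 W (+ 1) m)
        decide true true m = ⊥-elim (multiple≢ 4 W (+ 2) m)

      norm-equation : ∀ e f E F k → e + e ≡ ℤ→ℚ E → f + f ≡ ℤ→ℚ F → e * e - P * (f * f) ≡ ℤ→ℚ k
        → E ℤ.* E ℤ.- p ℤ.* (F ℤ.* F) ≡ + 4 ℤ.* k
      norm-equation e f E F k E≡ F≡ k≡ = ℤ→ℚ-injective (begin
        ℤ→ℚ (E ℤ.* E ℤ.- p ℤ.* (F ℤ.* F))                   ≡⟨ ℤ→ℚ-- (E ℤ.* E) (p ℤ.* (F ℤ.* F)) ⟩
        ℤ→ℚ (E ℤ.* E) - ℤ→ℚ (p ℤ.* (F ℤ.* F))               ≡⟨ cong₂ _-_ (ℤ→ℚ-* E E) (trans (ℤ→ℚ-* p (F ℤ.* F)) (cong₂ _*_ (sym P≡ℤ) (ℤ→ℚ-* F F))) ⟩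
        ℤ→ℚ E * ℤ→ℚ E - P * (ℤ→ℚ F * ℤ→ℚ F)                 ≡⟨ cong₂ (λ s t → s * s - P * (t * t)) (sym E≡) (sym F≡) ⟩
        (e + e) * (e + e) - P * ((f + f) * (f + f))         ≡⟨ solveℚ 3 (λ P e f → let N = e :* e :- P :* (f :* f) in (e :+ e) :* (e :+ e) :- P :* ((f :+ f) :* (f :+ f)) := (N :+ N) :+ (N :+ N)) refl P e f ⟩
        (N + N) + (N + N)                                   ≡⟨ cong (λ t → (t + t) + (t + t)) k≡ ⟩
        (ℤ→ℚ k + ℤ→ℚ k) + (ℤ→ℚ k + ℤ→ℚ k)                   ≡⟨ quadruple k ⟨
        ℤ→ℚ (+ 4 ℤ.* k)                                     ∎)
        where
        open ≡.≡-Reasoning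
        N = e * e - P * (f * f)

      halve-both : ∀ e f → Integral (e + e) → Integral (f + f) → Integral (e * e - P * (f * f)) → Integral e × Integral f
      halve-both e f (E , E≡) (F , F≡) (k , k≡) = go (parity E) (parity F)
        where
        go : ∃[ g ] ∃[ s ] (E ≡ + 2 ℤ.* g ℤ.+ bit s) → ∃[ h ] ∃[ t ] (F ≡ + 2 ℤ.* h ℤ.+ bit t) → Integral e × Integral f
        go (g , s , e₁) (h , t , e₂) =
          let s≡ , t≡ = even-p E F k g h s t (norm-equation e f E F k E≡ F≡ k≡) e₁ e₂
          in halve e g (trans E≡ (cong ℤ→ℚ e₁)) s≡ , halve f h (trans F≡ (cong ℤ→ℚ e₂)) t≡

    -- The trace 2e and the norm e² - pf² are rational integers. As p is square-free, 2f is an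
    -- integer as well, and p ≡ 3 (mod 4) makes 2e and 2f even.
    almostIntegral-p : ∀ {e f} → AlmostIntegral ⟨ e , f , 0ℚ , 0ℚ ⟩ → Integral e × Integral f
    almostIntegral-p {e} {f} ai = halve-both e f trace (integral-p (f + f) (from-norm P e f trace norm)) norm
      where
      trace : Integral (e + e)
      trace = almostIntegral-rational (subst AlmostIntegral (⟨⟩-cong refl (ℚ.+-inverseʳ f) refl refl)
        (almostIntegral-+ ai (almostIntegral-σ false true ai)))
      norm : Integral (e * e - P * (f * f))
      norm = almostIntegral-rational (subst AlmostIntegral
          (solveᴷ 8 (λ M₁ M₂ M₃ P Q R e f → let o = κ 0 ; x = quad e f o o in
            mulᴾ M₁ M₂ M₃ P Q R x (σᴾ false true x) , quad (e :* e :- P :* (f :* f)) o o o) refl (M₁ ∷ M₂ ∷ M₃ ∷ P ∷ Q ∷ R ∷ e ∷ f ∷ []))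
        (almostIntegral-* ai (almostIntegral-σ false true ai)))

    private
      -- The traces to the three quadratic subfields show that the coordinates are at worst
      -- half-integers. The norm to ℚ(√p), again an integer of that field, then relates their
      -- parities.
      module Coordinates (x₀ x₁ x₂ x₃ : ℚ) (ai : AlmostIntegral ⟨ x₀ , x₁ , x₂ , x₃ ⟩) where
        2x₀,2x₁ : Integral (x₀ + x₀) × Integral (x₁ + x₁)
        2x₀,2x₁ = almostIntegral-p (subst AlmostIntegral (⟨⟩-cong refl refl (ℚ.+-inverseʳ x₂) (ℚ.+-inverseʳ x₃))
          (almostIntegral-+ ai (almostIntegral-σ true false ai)))

        2x₂ : Integral (x₂ + x₂)
        2x₂ = integral-q (x₂ + x₂) (subst Integral
            (solveℚ 3 (λ Q u v → (u :+ u) :* (u :+ u) :- ((u :+ u) :* (u :+ u) :- Q :* ((v :+ v) :* (v :+ v))) := Q :* ((v :+ v) :* (v :+ v))) refl Q x₀ x₂)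
            (integral-- (integral-* (proj₁ 2x₀,2x₁) (proj₁ 2x₀,2x₁)) norm))
          where
          y : AlmostIntegral ⟨ x₀ + x₀ , 0ℚ , x₂ + x₂ , 0ℚ ⟩
          y = subst AlmostIntegral (⟨⟩-cong refl (ℚ.+-inverseʳ x₁) refl (ℚ.+-inverseʳ x₃)) (almostIntegral-+ ai (almostIntegral-σ false true ai))
          norm : Integral ((x₀ + x₀) * (x₀ + x₀) - Q * ((x₂ + x₂) * (x₂ + x₂)))
          norm = almostIntegral-rational (subst AlmostIntegral
              (solveᴷ 8 (λ M₁ M₂ M₃ P Q R e f → let o = κ 0 ; x = quad e o f o in
                mulᴾ M₁ M₂ M₃ P Q R x (σᴾ true false x) , quad (e :* e :- Q :* (f :* f)) o o o) refl (M₁ ∷ M₂ ∷ M₃ ∷ P ∷ Q ∷ R ∷ x₀ + x₀ ∷ x₂ + x₂ ∷ []))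
            (almostIntegral-* y (almostIntegral-σ true false y)))

        2x₃ : Integral (x₃ + x₃)
        2x₃ = integral-r (x₃ + x₃) (subst Integral
            (solveℚ 3 (λ Q u v → (u :+ u) :* (u :+ u) :- ((u :+ u) :* (u :+ u) :- Q :* ((v :+ v) :* (v :+ v))) := Q :* ((v :+ v) :* (v :+ v))) refl R x₀ x₃)
            (integral-- (integral-* (proj₁ 2x₀,2x₁) (proj₁ 2x₀,2x₁)) norm))
          where
          y : AlmostIntegral ⟨ x₀ + x₀ , 0ℚ , 0ℚ , x₃ + x₃ ⟩
          y = subst AlmostIntegral (⟨⟩-cong refl (ℚ.+-inverseʳ x₁) (ℚ.+-inverseʳ x₂)
              (solveℚ 1 (λ v → v :+ (:- (:- v)) := v :+ v) refl x₃)) (almostIntegral-+ ai (almostIntegral-σ false false ai))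
          norm : Integral ((x₀ + x₀) * (x₀ + x₀) - R * ((x₃ + x₃) * (x₃ + x₃)))
          norm = almostIntegral-rational (subst AlmostIntegral
              (solveᴷ 8 (λ M₁ M₂ M₃ P Q R e f → let o = κ 0 ; x = quad e o o f in
                mulᴾ M₁ M₂ M₃ P Q R x (σᴾ true false x) , quad (e :* e :- R :* (f :* f)) o o o) refl (M₁ ∷ M₂ ∷ M₃ ∷ P ∷ Q ∷ R ∷ x₀ + x₀ ∷ x₃ + x₃ ∷ []))
            (almostIntegral-* y (almostIntegral-σ true false y)))

        norm : Integral (x₀ * x₀ + P * (x₁ * x₁) - Q * (x₂ * x₂) - R * (x₃ * x₃)) × Integral ((x₀ * x₁ + x₀ * x₁) - M₃ * (x₂ * x₃ + x₂ * x₃))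
        norm = almostIntegral-p (subst AlmostIntegral
            (solveᴷ 10 (λ M₁ M₂ M₃ P Q R x₀ x₁ x₂ x₃ → let x = quad x₀ x₁ x₂ x₃ in mulᴾ M₁ M₂ M₃ P Q R x (σᴾ true false x) ,
              quad (x₀ :* x₀ :+ P :* (x₁ :* x₁) :- Q :* (x₂ :* x₂) :- R :* (x₃ :* x₃))
                ((x₀ :* x₁ :+ x₀ :* x₁) :- M₃ :* (x₂ :* x₃ :+ x₂ :* x₃)) (κ 0) (κ 0))
              refl (M₁ ∷ M₂ ∷ M₃ ∷ P ∷ Q ∷ R ∷ x₀ ∷ x₁ ∷ x₂ ∷ x₃ ∷ []))
          (almostIntegral-* ai (almostIntegral-σ true false ai)))

      -- p, r ≡ 3 and q ≡ 1 (mod 4).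
      parities : ∀ e f α β γ δ s t u v → let x₀ = + 2 ℤ.* α ℤ.+ bit s ; x₁ = + 2 ℤ.* β ℤ.+ bit t ; x₂ = + 2 ℤ.* γ ℤ.+ bit u ; x₃ = + 2 ℤ.* δ ℤ.+ bit v in
        x₀ ℤ.* x₀ ℤ.+ p ℤ.* (x₁ ℤ.* x₁) ℤ.- q ℤ.* (x₂ ℤ.* x₂) ℤ.- r ℤ.* (x₃ ℤ.* x₃) ≡ + 4 ℤ.* e
        → x₀ ℤ.* x₁ ℤ.- (+ 2 ℤ.* ν ℤ.+ + 3) ℤ.* (x₂ ℤ.* x₃) ≡ + 2 ℤ.* f
        → s ≡ u × t ≡ v
      parities e f α β γ δ s t u v eq₁ eq₂ = decide s t u v mod4 mod2
        where
        V W V′ W′ : ℤ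
        V = α ℤ.* α ℤ.+ α ℤ.* bit s ℤ.+ ν ℤ.* ν ℤ.* ((+ 2 ℤ.* β ℤ.+ bit t) ℤ.* (+ 2 ℤ.* β ℤ.+ bit t)) ℤ.- (β ℤ.* β ℤ.+ β ℤ.* bit t)
          ℤ.- (ν ℤ.* ν ℤ.+ ν) ℤ.* ((+ 2 ℤ.* γ ℤ.+ bit u) ℤ.* (+ 2 ℤ.* γ ℤ.+ bit u)) ℤ.+ + 3 ℤ.* (γ ℤ.* γ ℤ.+ γ ℤ.* bit u)
          ℤ.- (ν ℤ.* ν ℤ.+ + 2 ℤ.* ν) ℤ.* ((+ 2 ℤ.* δ ℤ.+ bit v) ℤ.* (+ 2 ℤ.* δ ℤ.+ bit v)) ℤ.- + 3 ℤ.* (δ ℤ.* δ ℤ.+ δ ℤ.* bit v)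
        W = e ℤ.- V
        V′ = + 2 ℤ.* (α ℤ.* β) ℤ.+ α ℤ.* bit t ℤ.+ β ℤ.* bit s ℤ.- ν ℤ.* ((+ 2 ℤ.* γ ℤ.+ bit u) ℤ.* (+ 2 ℤ.* δ ℤ.+ bit v))
          ℤ.- + 3 ℤ.* (+ 2 ℤ.* (γ ℤ.* δ) ℤ.+ γ ℤ.* bit v ℤ.+ δ ℤ.* bit u)
        W′ = f ℤ.- V′
        mod4 : + 4 ℤ.* W ≡ bit s ℤ.* bit s ℤ.- bit t ℤ.* bit t ℤ.+ + 3 ℤ.* (bit u ℤ.* bit u) ℤ.- + 3 ℤ.* (bit v ℤ.* bit v)
        mod4 = trans (solveℤ 2 (λ k V → # 4 [*] (k [-] V) [=] # 4 [*] k [-] # 4 [*] V) refl e V)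
          (trans (cong (ℤ._- + 4 ℤ.* V) (sym eq₁))
            (solveℤ 9 (λ ν α β γ δ s t u v → let x₀ = # 2 [*] α [+] s ; x₁ = # 2 [*] β [+] t ; x₂ = # 2 [*] γ [+] u ; x₃ = # 2 [*] δ [+] v
                                                 m₁ = # 2 [*] ν [-] # 1 ; m₂ = # 2 [*] ν [+] # 1 ; m₃ = # 2 [*] ν [+] # 3 in
              x₀ [*] x₀ [+] (m₁ [*] m₂) [*] (x₁ [*] x₁) [-] (m₁ [*] m₃) [*] (x₂ [*] x₂) [-] (m₂ [*] m₃) [*] (x₃ [*] x₃)
              [-] # 4 [*] (α [*] α [+] α [*] s [+] ν [*] ν [*] (x₁ [*] x₁) [-] (β [*] β [+] β [*] t)
                 [-] (ν [*] ν [+] ν) [*] (x₂ [*] x₂) [+] # 3 [*] (γ [*] γ [+] γ [*] u)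
                 [-] (ν [*] ν [+] # 2 [*] ν) [*] (x₃ [*] x₃) [-] # 3 [*] (δ [*] δ [+] δ [*] v))
              [=] s [*] s [-] t [*] t [+] # 3 [*] (u [*] u) [-] # 3 [*] (v [*] v)) refl ν α β γ δ (bit s) (bit t) (bit u) (bit v)))
        mod2 : + 2 ℤ.* W′ ≡ bit s ℤ.* bit t ℤ.- + 3 ℤ.* (bit u ℤ.* bit v)
        mod2 = trans (solveℤ 2 (λ k V → # 2 [*] (k [-] V) [=] # 2 [*] k [-] # 2 [*] V) refl f V′)
          (trans (cong (ℤ._- + 2 ℤ.* V′) (sym eq₂))
            (solveℤ 9 (λ ν α β γ δ s t u v → let x₀ = # 2 [*] α [+] s ; x₁ = # 2 [*] β [+] t ; x₂ = # 2 [*] γ [+] u ; x₃ = # 2 [*] δ [+] v in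
              x₀ [*] x₁ [-] (# 2 [*] ν [+] # 3) [*] (x₂ [*] x₃)
              [-] # 2 [*] (# 2 [*] (α [*] β) [+] α [*] t [+] β [*] s [-] ν [*] (x₂ [*] x₃) [-] # 3 [*] (# 2 [*] (γ [*] δ) [+] γ [*] v [+] δ [*] u))
              [=] s [*] t [-] # 3 [*] (u [*] v)) refl ν α β γ δ (bit s) (bit t) (bit u) (bit v)))
        decide : ∀ s t u v → + 4 ℤ.* W ≡ bit s ℤ.* bit s ℤ.- bit t ℤ.* bit t ℤ.+ + 3 ℤ.* (bit u ℤ.* bit u) ℤ.- + 3 ℤ.* (bit v ℤ.* bit v)
          → + 2 ℤ.* W′ ≡ bit s ℤ.* bit t ℤ.- + 3 ℤ.* (bit u ℤ.* bit v) → s ≡ u × t ≡ v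
        -- The congruence mod 4 excludes all bad patterns but 0011 and 1100; these two fall to the
        -- √p-coordinate of the norm, taken mod 2.
        decide false false false false _ _ = refl , refl
        decide false true  false true  _ _ = refl , refl
        decide true  false true  false _ _ = refl , refl
        decide true  true  true  true  _ _ = refl , refl
        decide false false false true  m _ = ⊥-elim (multiple≢ 4 W (ℤ.- + 3) m)
        decide false false true  false m _ = ⊥-elim (multiple≢ 4 W (+ 3) m)
        decide false false true  true  _ m = ⊥-elim (multiple≢ 2 W′ (ℤ.- + 3) m)
        decide false true  false false m _ = ⊥-elim (multiple≢ 4 W (ℤ.- + 1) m)
        decide false true  true  false m _ = ⊥-elim (multiple≢ 4 W (+ 2) m)
        decide false true  true  true  m _ = ⊥-elim (multiple≢ 4 W (ℤ.- + 1) m)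
        decide true  false false false m _ = ⊥-elim (multiple≢ 4 W (+ 1) m)
        decide true  false false true  m _ = ⊥-elim (multiple≢ 4 W (ℤ.- + 2) m)
        decide true  false true  true  m _ = ⊥-elim (multiple≢ 4 W (+ 1) m)
        decide true  true  false false _ m = ⊥-elim (multiple≢ 2 W′ (+ 1) m)
        decide true  true  false true  m _ = ⊥-elim (multiple≢ 4 W (ℤ.- + 3) m)
        decide true  true  true  false m _ = ⊥-elim (multiple≢ 4 W (+ 3) m)

    private
      ℤ→ℚ-square : ∀ k z → ℤ→ℚ (k ℤ.* (z ℤ.* z)) ≡ ℤ→ℚ k * (ℤ→ℚ z * ℤ→ℚ z)
      ℤ→ℚ-square k z = trans (ℤ→ℚ-* k (z ℤ.* z)) (cong (ℤ→ℚ k *_) (ℤ→ℚ-* z z))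

      to-lattice : ∀ x₀ x₁ x₂ x₃ → Integral (x₀ + x₀) → Integral (x₁ + x₁) → Integral (x₂ + x₂) → Integral (x₃ + x₃)
        → Integral (x₀ * x₀ + P * (x₁ * x₁) - Q * (x₂ * x₂) - R * (x₃ * x₃)) → Integral ((x₀ * x₁ + x₀ * x₁) - M₃ * (x₂ * x₃ + x₂ * x₃))
        → ∃[ A ] ∃[ B ] ∃[ C ] ∃[ D ] (⟨ x₀ , x₁ , x₂ , x₃ ⟩ ≡ lattice A B C D)
      to-lattice x₀ x₁ x₂ x₃ (X₀ , e₀) (X₁ , e₁) (X₂ , e₂) (X₃ , e₃) (e , e≡) (f , f≡) = go (parity X₀) (parity X₁) (parity X₂) (parity X₃)
        where
        open ≡.≡-Reasoning
        eq₁ : X₀ ℤ.* X₀ ℤ.+ p ℤ.* (X₁ ℤ.* X₁) ℤ.- q ℤ.* (X₂ ℤ.* X₂) ℤ.- r ℤ.* (X₃ ℤ.* X₃) ≡ + 4 ℤ.* e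
        eq₁ = ℤ→ℚ-injective (begin
          ℤ→ℚ (X₀ ℤ.* X₀ ℤ.+ p ℤ.* (X₁ ℤ.* X₁) ℤ.- q ℤ.* (X₂ ℤ.* X₂) ℤ.- r ℤ.* (X₃ ℤ.* X₃))
            ≡⟨ trans (ℤ→ℚ-- (X₀ ℤ.* X₀ ℤ.+ p ℤ.* (X₁ ℤ.* X₁) ℤ.- q ℤ.* (X₂ ℤ.* X₂)) (r ℤ.* (X₃ ℤ.* X₃)))
                (cong₂ _-_ (trans (ℤ→ℚ-- (X₀ ℤ.* X₀ ℤ.+ p ℤ.* (X₁ ℤ.* X₁)) (q ℤ.* (X₂ ℤ.* X₂)))
                  (cong₂ _-_ (trans (ℤ→ℚ-+ (X₀ ℤ.* X₀) (p ℤ.* (X₁ ℤ.* X₁))) (cong₂ _+_ (ℤ→ℚ-* X₀ X₀) (ℤ→ℚ-square p X₁)))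
                    (ℤ→ℚ-square q X₂))) (ℤ→ℚ-square r X₃)) ⟩
          ℤ→ℚ X₀ * ℤ→ℚ X₀ + ℤ→ℚ p * (ℤ→ℚ X₁ * ℤ→ℚ X₁) - ℤ→ℚ q * (ℤ→ℚ X₂ * ℤ→ℚ X₂) - ℤ→ℚ r * (ℤ→ℚ X₃ * ℤ→ℚ X₃)
            ≡⟨ cong₂ _-_ (cong₂ _-_ (cong₂ _+_ (cong (λ z → z * z) (sym e₀)) (cong₂ (λ k z → k * (z * z)) (sym P≡ℤ) (sym e₁)))
                 (cong₂ (λ k z → k * (z * z)) (sym Q≡ℤ) (sym e₂))) (cong₂ (λ k z → k * (z * z)) (sym R≡ℤ) (sym e₃)) ⟩
          (x₀ + x₀) * (x₀ + x₀) + P * ((x₁ + x₁) * (x₁ + x₁)) - Q * ((x₂ + x₂) * (x₂ + x₂)) - R * ((x₃ + x₃) * (x₃ + x₃))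
            ≡⟨ solveℚ 7 (λ P Q R x₀ x₁ x₂ x₃ → let N = x₀ :* x₀ :+ P :* (x₁ :* x₁) :- Q :* (x₂ :* x₂) :- R :* (x₃ :* x₃) in
                 (x₀ :+ x₀) :* (x₀ :+ x₀) :+ P :* ((x₁ :+ x₁) :* (x₁ :+ x₁)) :- Q :* ((x₂ :+ x₂) :* (x₂ :+ x₂)) :- R :* ((x₃ :+ x₃) :* (x₃ :+ x₃))
                 := (N :+ N) :+ (N :+ N)) refl P Q R x₀ x₁ x₂ x₃ ⟩
          (N + N) + (N + N)
            ≡⟨ cong (λ t → (t + t) + (t + t)) e≡ ⟩
          (ℤ→ℚ e + ℤ→ℚ e) + (ℤ→ℚ e + ℤ→ℚ e)
            ≡⟨ quadruple e ⟨
          ℤ→ℚ (+ 4 ℤ.* e) ∎)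
          where N = x₀ * x₀ + P * (x₁ * x₁) - Q * (x₂ * x₂) - R * (x₃ * x₃)
        eq₂ : X₀ ℤ.* X₁ ℤ.- (+ 2 ℤ.* ν ℤ.+ + 3) ℤ.* (X₂ ℤ.* X₃) ≡ + 2 ℤ.* f
        eq₂ = ℤ→ℚ-injective (begin
          ℤ→ℚ (X₀ ℤ.* X₁ ℤ.- (+ 2 ℤ.* ν ℤ.+ + 3) ℤ.* (X₂ ℤ.* X₃))
            ≡⟨ trans (ℤ→ℚ-- (X₀ ℤ.* X₁) ((+ 2 ℤ.* ν ℤ.+ + 3) ℤ.* (X₂ ℤ.* X₃))) (cong₂ _-_ (ℤ→ℚ-* X₀ X₁)
                 (trans (ℤ→ℚ-* (+ 2 ℤ.* ν ℤ.+ + 3) (X₂ ℤ.* X₃)) (cong₂ _*_ (sym M₃≡) (ℤ→ℚ-* X₂ X₃)))) ⟩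
          ℤ→ℚ X₀ * ℤ→ℚ X₁ - M₃ * (ℤ→ℚ X₂ * ℤ→ℚ X₃)
            ≡⟨ cong₂ _-_ (cong₂ _*_ (sym e₀) (sym e₁)) (cong₂ (λ s t → M₃ * (s * t)) (sym e₂) (sym e₃)) ⟩
          (x₀ + x₀) * (x₁ + x₁) - M₃ * ((x₂ + x₂) * (x₃ + x₃))
            ≡⟨ solveℚ 5 (λ M x₀ x₁ x₂ x₃ → let N = (x₀ :* x₁ :+ x₀ :* x₁) :- M :* (x₂ :* x₃ :+ x₂ :* x₃) in
                 (x₀ :+ x₀) :* (x₁ :+ x₁) :- M :* ((x₂ :+ x₂) :* (x₃ :+ x₃)) := N :+ N) refl M₃ x₀ x₁ x₂ x₃ ⟩
          N + N
            ≡⟨ cong (λ t → t + t) f≡ ⟩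
          ℤ→ℚ f + ℤ→ℚ f
            ≡⟨ trans (sym (ℤ→ℚ-+ f f)) (cong ℤ→ℚ (solveℤ 1 (λ f → f [+] f [=] # 2 [*] f) refl f)) ⟩
          ℤ→ℚ (+ 2 ℤ.* f) ∎)
          where N = (x₀ * x₁ + x₀ * x₁) - M₃ * (x₂ * x₃ + x₂ * x₃)
        halved : ∀ {u X} Y → u + u ≡ ℤ→ℚ X → X ≡ Y → u ≡ ½ * ℤ→ℚ Y
        halved {u} Y eq refl = trans (½-double u) (cong (½ *_) eq)
        difference : ∀ {X} α γ s → X ≡ + 2 ℤ.* α ℤ.+ bit s → X ≡ + 2 ℤ.* (α ℤ.- γ) ℤ.+ (+ 2 ℤ.* γ ℤ.+ bit s)
        difference α γ s eq = trans eq (solveℤ 3 (λ α γ s → # 2 [*] α [+] s [=] # 2 [*] (α [-] γ) [+] (# 2 [*] γ [+] s)) refl α γ (bit s))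
        go : ∃[ α ] ∃[ s ] (X₀ ≡ + 2 ℤ.* α ℤ.+ bit s) → ∃[ β ] ∃[ t ] (X₁ ≡ + 2 ℤ.* β ℤ.+ bit t)
           → ∃[ γ ] ∃[ u ] (X₂ ≡ + 2 ℤ.* γ ℤ.+ bit u) → ∃[ δ ] ∃[ v ] (X₃ ≡ + 2 ℤ.* δ ℤ.+ bit v)
           → ∃[ A ] ∃[ B ] ∃[ C ] ∃[ D ] (⟨ x₀ , x₁ , x₂ , x₃ ⟩ ≡ lattice A B C D)
        go (α , s , E₀) (β , t , E₁) (γ , u , E₂) (δ , v , E₃) =
            α ℤ.- γ , β ℤ.- δ , + 2 ℤ.* γ ℤ.+ bit u , + 2 ℤ.* δ ℤ.+ bit v
          , ⟨⟩-cong (halved (+ 2 ℤ.* (α ℤ.- γ) ℤ.+ (+ 2 ℤ.* γ ℤ.+ bit u)) e₀ (difference α γ u (subst (λ s → X₀ ≡ + 2 ℤ.* α ℤ.+ bit s) s≡u E₀)))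
                    (halved (+ 2 ℤ.* (β ℤ.- δ) ℤ.+ (+ 2 ℤ.* δ ℤ.+ bit v)) e₁ (difference β δ v (subst (λ s → X₁ ≡ + 2 ℤ.* β ℤ.+ bit s) t≡v E₁)))
                    (halved (+ 2 ℤ.* γ ℤ.+ bit u) e₂ E₂) (halved (+ 2 ℤ.* δ ℤ.+ bit v) e₃ E₃)
          where
          par : s ≡ u × t ≡ v
          par = parities e f α β γ δ s t u v
            (trans (cong₂ ℤ._-_ (cong₂ ℤ._-_ (cong₂ ℤ._+_ (cong (λ z → z ℤ.* z) (sym E₀)) (cong (λ z → p ℤ.* (z ℤ.* z)) (sym E₁))) (cong (λ z → q ℤ.* (z ℤ.* z)) (sym E₂))) (cong (λ z → r ℤ.* (z ℤ.* z)) (sym E₃))) eq₁)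
            (trans (cong₂ ℤ._-_ (cong₂ ℤ._*_ (sym E₀) (sym E₁)) (cong₂ (λ y z → (+ 2 ℤ.* ν ℤ.+ + 3) ℤ.* (y ℤ.* z)) (sym E₂) (sym E₃))) eq₂)
          s≡u = proj₁ par
          t≡v = proj₂ par

    almostIntegral⇒lattice : ∀ {x} → AlmostIntegral x → ∃[ A ] ∃[ B ] ∃[ C ] ∃[ D ] (x ≡ lattice A B C D)
    almostIntegral⇒lattice {⟨ x₀ , x₁ , x₂ , x₃ ⟩} ai = to-lattice x₀ x₁ x₂ x₃ (proj₁ 2x₀,2x₁) (proj₂ 2x₀,2x₁) 2x₂ 2x₃ (proj₁ norm) (proj₂ norm)
      where open Coordinates x₀ x₁ x₂ x₃ ai

    private
      -- y² + N = ty for the relative trace t and norm N of y over ℚ(√p), with c = C/2 and d = D/2.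
      relative-equation : ∀ N M₁ M₂ M₃ {P Q R} → M₁ ≡ ℤ→ℚ (+ 2) * N - ℤ→ℚ (+ 1) → M₂ ≡ ℤ→ℚ (+ 2) * N + ℤ→ℚ (+ 1) → M₃ ≡ ℤ→ℚ (+ 2) * N + ℤ→ℚ (+ 3)
        → P ≡ M₁ * M₂ → Q ≡ M₁ * M₃ → R ≡ M₂ * M₃ → ∀ A B c d → let y = ⟨ A + c , B + d , c , d ⟩ ; C = c + c ; D = d + d ; _·′_ = mul M₁ M₂ M₃ P Q R in
        (y ·′ y) ⊞ ⟨ A * A + A * C + P * (B * B + B * D) + (ℤ→ℚ (+ 1) - N - N * N) * (C * C) - (ℤ→ℚ (+ 2) * N + ℤ→ℚ (+ 1)) * (D * D)
                   , ℤ→ℚ (+ 2) * (A * B) + A * D + B * C - (N + ℤ→ℚ (+ 1)) * (C * D) , 0ℚ , 0ℚ ⟩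
        ≡ ⟨ ℤ→ℚ (+ 2) * A + C , ℤ→ℚ (+ 2) * B + D , 0ℚ , 0ℚ ⟩ ·′ y
      relative-equation N M₁ M₂ M₃ refl refl refl refl refl refl A B c d = solveᴷ 5 (λ N A B c d →
        let M₁ = κ 2 :* N :- κ 1 ; M₂ = κ 2 :* N :+ κ 1 ; M₃ = κ 2 :* N :+ κ 3
            y = quad (A :+ c) (B :+ d) c d ; C = c :+ c ; D = d :+ d ; _·′_ = mulᴹ M₁ M₂ M₃ in
        (y ·′ y) ⊕ᴾ quad
          (A :* A :+ A :* C :+ (M₁ :* M₂) :* (B :* B :+ B :* D) :+ (κ 1 :- N :- N :* N) :* (C :* C) :- (κ 2 :* N :+ κ 1) :* (D :* D))
          (κ 2 :* (A :* B) :+ A :* D :+ B :* C :- (N :+ κ 1) :* (C :* D)) (κ 0) (κ 0)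
        , quad (κ 2 :* A :+ C) (κ 2 :* B :+ D) (κ 0) (κ 0) ·′ y) refl (N ∷ A ∷ B ∷ c ∷ d ∷ [])

      -- A quadratic equation over ℤ[√p], multiplied by its conjugate under √p ↦ -√p, has
      -- coefficients in ℤ.
      quartic-p : ∀ {y} x₀ x₁ e f → y · y ⊞ ⟨ ℤ→ℚ e , ℤ→ℚ f , 0ℚ , 0ℚ ⟩ ≡ ⟨ ℤ→ℚ x₀ , ℤ→ℚ x₁ , 0ℚ , 0ℚ ⟩ · y
        → ∃[ cs ] (eval cs y ≡ zeroK n)
      quartic-p {y} x₀ x₁ e f eq = (c₀ ∷ c₁ ∷ c₂ ∷ c₃ ∷ [])
          , quartic-root {y} {t} {t̄} {N} {N̄} c₀ c₁ c₂ c₃ eq e₃ e₂ e₁ e₀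
        where
        T₀ = ℤ→ℚ x₀
        T₁ = ℤ→ℚ x₁
        E = ℤ→ℚ e
        F = ℤ→ℚ f
        t t̄ N N̄ : K
        t = ⟨ T₀ , T₁ , 0ℚ , 0ℚ ⟩
        t̄ = ⟨ T₀ , - T₁ , 0ℚ , 0ℚ ⟩
        N = ⟨ E , F , 0ℚ , 0ℚ ⟩
        N̄ = ⟨ E , - F , 0ℚ , 0ℚ ⟩
        ρ = p ∷ x₀ ∷ x₁ ∷ e ∷ f ∷ []
        X₀ X₁ X₂ X₃ : Poly 5
        X₃ = # 0 [-] (v₁ [+] v₁)
        X₂ = v₁ [*] v₁ [-] v₀ [*] (v₂ [*] v₂) [+] v₃ [+] v₃
        X₁ = # 0 [-] (v₁ [*] v₃ [-] v₀ [*] (v₂ [*] v₄) [+] (v₁ [*] v₃ [-] v₀ [*] (v₂ [*] v₄)))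
        X₀ = v₃ [*] v₃ [-] v₀ [*] (v₄ [*] v₄)
        c₀ c₁ c₂ c₃ : ℤ
        c₀ = ⟦ X₀ ⟧ ρ
        c₁ = ⟦ X₁ ⟧ ρ
        c₂ = ⟦ X₂ ⟧ ρ
        c₃ = ⟦ X₃ ⟧ ρ
        e₃ : emb c₃ ≡ neg (t ⊞ t̄)
        e₃ = ⟨⟩-cong (trans (ℤ→ℚ-poly X₃ ρ) (solveℚ 1 (λ x → κ 0 :- (x :+ x) := :- (x :+ x)) refl T₀))
          (solveℚ 1 (λ x → κ 0 := :- (x :+ (:- x))) refl T₁) refl refl
        vars : Vec ℚ 10
        vars = M₁ ∷ M₂ ∷ M₃ ∷ P ∷ Q ∷ R ∷ T₀ ∷ T₁ ∷ E ∷ F ∷ []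
        rational : ∀ {u v} → u ≡ v → ⟨ u , 0ℚ , 0ℚ , 0ℚ ⟩ ≡ ⟨ v , 0ℚ , 0ℚ , 0ℚ ⟩
        rational = cong (λ u → ⟨ u , 0ℚ , 0ℚ , 0ℚ ⟩)
        e₂ : emb c₂ ≡ t · t̄ ⊞ N ⊞ N̄
        e₂ = trans (rational (trans (ℤ→ℚ-poly X₂ ρ) (cong (λ P → T₀ * T₀ - P * (T₁ * T₁) + E + E) (sym P≡ℤ))))
          (solveᴷ 10 (λ M₁ M₂ M₃ P Q R x y e f → let o = κ 0 in
            quad (x :* x :- P :* (y :* y) :+ e :+ e) o o o ,
            mulᴾ M₁ M₂ M₃ P Q R (quad x y o o) (quad x (:- y) o o) ⊕ᴾ quad e f o o ⊕ᴾ quad e (:- f) o o) refl vars)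
        e₁ : emb c₁ ≡ neg (t · N̄ ⊞ t̄ · N)
        e₁ = trans (rational (trans (ℤ→ℚ-poly X₁ ρ) (cong (λ P → ℤ→ℚ (+ 0) - (T₀ * E - P * (T₁ * F) + (T₀ * E - P * (T₁ * F)))) (sym P≡ℤ))))
          (solveᴷ 10 (λ M₁ M₂ M₃ P Q R x y e f → let o = κ 0 ; _·′_ = mulᴾ M₁ M₂ M₃ P Q R in
            quad (o :- (x :* e :- P :* (y :* f) :+ (x :* e :- P :* (y :* f)))) o o o ,
            negᴾ ((quad x y o o ·′ quad e (:- f) o o) ⊕ᴾ (quad x (:- y) o o ·′ quad e f o o))) refl vars)
        e₀ : emb c₀ ≡ N · N̄
        e₀ = trans (rational (trans (ℤ→ℚ-poly X₀ ρ) (cong (λ P → E * E - P * (F * F)) (sym P≡ℤ))))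
          (solveᴷ 10 (λ M₁ M₂ M₃ P Q R x y e f → let o = κ 0 in
            quad (e :* e :- P :* (f :* f)) o o o , mulᴾ M₁ M₂ M₃ P Q R (quad e f o o) (quad e (:- f) o o)) refl vars)

    -- This inclusion is needed because the summands of a decomposition must themselves be shown to
    -- lie in O_K.
    lattice⇒root : ∀ A B C D → ∃[ cs ] (eval cs (lattice A B C D) ≡ zeroK n)
    lattice⇒root A B C D = quartic-p (+ 2 ℤ.* A ℤ.+ C) (+ 2 ℤ.* B ℤ.+ D) (⟦ X ⟧ ρ) (⟦ Y ⟧ ρ) (begin
        y · y ⊞ ⟨ ℤ→ℚ (⟦ X ⟧ ρ) , ℤ→ℚ (⟦ Y ⟧ ρ) , 0ℚ , 0ℚ ⟩
          ≡⟨ cong₂ (λ y N → y · y ⊞ N) y≡ (⟨⟩-cong (trans (ℤ→ℚ-poly X ρ) X≡) (trans (ℤ→ℚ-poly Y ρ) Y≡) refl refl) ⟩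
        _ ≡⟨ relative-equation (ℤ→ℚ ν) M₁ M₂ M₃ (trans M₁≡ (ℤ→ℚ-poly (# 2 [*] v₀ [-] # 1) (ν ∷ [])))
               (trans M₂≡ (ℤ→ℚ-poly (# 2 [*] v₀ [+] # 1) (ν ∷ []))) (trans M₃≡ (ℤ→ℚ-poly (# 2 [*] v₀ [+] # 3) (ν ∷ []))) P≡ Q≡ R≡ (ℤ→ℚ A) (ℤ→ℚ B) c′ d′ ⟩
        ⟨ ℤ→ℚ (+ 2) * ℤ→ℚ A + (c′ + c′) , ℤ→ℚ (+ 2) * ℤ→ℚ B + (d′ + d′) , 0ℚ , 0ℚ ⟩ · y′
          ≡⟨ cong₂ _·_ t≡ (sym y≡) ⟩
        ⟨ ℤ→ℚ (+ 2 ℤ.* A ℤ.+ C) , ℤ→ℚ (+ 2 ℤ.* B ℤ.+ D) , 0ℚ , 0ℚ ⟩ · y ∎)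
      where
      open ≡.≡-Reasoning
      y y′ : K
      y = lattice A B C D
      c′ d′ : ℚ
      c′ = ½ * ℤ→ℚ C
      d′ = ½ * ℤ→ℚ D
      y′ = ⟨ ℤ→ℚ A + c′ , ℤ→ℚ B + d′ , c′ , d′ ⟩
      ρ = ν ∷ A ∷ B ∷ C ∷ D ∷ []
      pᴱ X Y : Poly 5
      pᴱ = (# 2 [*] v₀ [-] # 1) [*] (# 2 [*] v₀ [+] # 1)
      -- The coordinates of the relative norm. The coefficients 1 - ν - ν², -(2ν + 1) and, in `Y`,
      -- -(ν + 1) are (1 - q)/4, (p - r)/4 and (1 - m₃)/2: here the residues mod 4 make the norm
      -- integral.
      X = v₁ [*] v₁ [+] v₁ [*] v₃ [+] pᴱ [*] (v₂ [*] v₂ [+] v₂ [*] v₄) [+] (# 1 [-] v₀ [-] v₀ [*] v₀) [*] (v₃ [*] v₃) [-] (# 2 [*] v₀ [+] # 1) [*] (v₄ [*] v₄)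
      Y = # 2 [*] (v₁ [*] v₂) [+] v₁ [*] v₄ [+] v₂ [*] v₃ [-] (v₀ [+] # 1) [*] (v₃ [*] v₄)
      double : ∀ Z → ℤ→ℚ Z ≡ ½ * ℤ→ℚ Z + ½ * ℤ→ℚ Z
      double Z = trans (½-double (ℤ→ℚ Z)) (ℚ.*-distribˡ-+ ½ (ℤ→ℚ Z) (ℤ→ℚ Z))
      two : ∀ A C → ℤ→ℚ (+ 2) * ℤ→ℚ A + (½ * ℤ→ℚ C + ½ * ℤ→ℚ C) ≡ ℤ→ℚ (+ 2 ℤ.* A ℤ.+ C)
      two A C = trans (cong (λ z → ℤ→ℚ (+ 2) * ℤ→ℚ A + z) (sym (double C))) (sym (ℤ→ℚ-poly (# 2 [*] v₀ [+] v₁) (A ∷ C ∷ [])))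
      t≡ : ⟨ ℤ→ℚ (+ 2) * ℤ→ℚ A + (c′ + c′) , ℤ→ℚ (+ 2) * ℤ→ℚ B + (d′ + d′) , 0ℚ , 0ℚ ⟩
         ≡ ⟨ ℤ→ℚ (+ 2 ℤ.* A ℤ.+ C) , ℤ→ℚ (+ 2 ℤ.* B ℤ.+ D) , 0ℚ , 0ℚ ⟩
      t≡ = ⟨⟩-cong (two A C) (two B D) refl refl
      halves : ∀ A C → ½ * ℤ→ℚ (+ 2 ℤ.* A ℤ.+ C) ≡ ℤ→ℚ A + ½ * ℤ→ℚ C
      halves A C = trans (cong (½ *_) (trans (ℤ→ℚ-poly (# 2 [*] v₀ [+] v₁) (A ∷ C ∷ [])) (cong (_+ ℤ→ℚ C)
          (solveℚ 1 (λ A → κ 2 :* A := A :+ A) refl (ℤ→ℚ A)))))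
        (trans (ℚ.*-distribˡ-+ ½ (ℤ→ℚ A + ℤ→ℚ A) (ℤ→ℚ C)) (cong (_+ ½ * ℤ→ℚ C) (sym (½-double (ℤ→ℚ A)))))
      y≡ : y ≡ y′
      y≡ = ⟨⟩-cong (halves A C) (halves B D) refl refl
      p≡ : ⟦ pᴱ ⟧ℚ ρ ≡ P
      p≡ = trans (sym (ℤ→ℚ-poly pᴱ ρ)) (sym P≡ℤ)
      X≡ : ⟦ X ⟧ℚ ρ ≡ ℤ→ℚ A * ℤ→ℚ A + ℤ→ℚ A * (c′ + c′) + P * (ℤ→ℚ B * ℤ→ℚ B + ℤ→ℚ B * (d′ + d′))
        + (ℤ→ℚ (+ 1) - ℤ→ℚ ν - ℤ→ℚ ν * ℤ→ℚ ν) * ((c′ + c′) * (c′ + c′)) - (ℤ→ℚ (+ 2) * ℤ→ℚ ν + ℤ→ℚ (+ 1)) * ((d′ + d′) * (d′ + d′))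
      X≡ = trans (cong (λ P → ℤ→ℚ A * ℤ→ℚ A + ℤ→ℚ A * ℤ→ℚ C + P * (ℤ→ℚ B * ℤ→ℚ B + ℤ→ℚ B * ℤ→ℚ D)
          + (ℤ→ℚ (+ 1) - ℤ→ℚ ν - ℤ→ℚ ν * ℤ→ℚ ν) * (ℤ→ℚ C * ℤ→ℚ C) - (ℤ→ℚ (+ 2) * ℤ→ℚ ν + ℤ→ℚ (+ 1)) * (ℤ→ℚ D * ℤ→ℚ D)) p≡)
        (cong₂ (λ C D → ℤ→ℚ A * ℤ→ℚ A + ℤ→ℚ A * C + P * (ℤ→ℚ B * ℤ→ℚ B + ℤ→ℚ B * D)
          + (ℤ→ℚ (+ 1) - ℤ→ℚ ν - ℤ→ℚ ν * ℤ→ℚ ν) * (C * C) - (ℤ→ℚ (+ 2) * ℤ→ℚ ν + ℤ→ℚ (+ 1)) * (D * D)) (double C) (double D))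
      Y≡ : ⟦ Y ⟧ℚ ρ ≡ ℤ→ℚ (+ 2) * (ℤ→ℚ A * ℤ→ℚ B) + ℤ→ℚ A * (d′ + d′) + ℤ→ℚ B * (c′ + c′) - (ℤ→ℚ ν + ℤ→ℚ (+ 1)) * ((c′ + c′) * (d′ + d′))
      Y≡ = cong₂ (λ C D → ℤ→ℚ (+ 2) * (ℤ→ℚ A * ℤ→ℚ B) + ℤ→ℚ A * D + ℤ→ℚ B * C - (ℤ→ℚ ν + ℤ→ℚ (+ 1)) * (C * D)) (double C) (double D)

-- Polynomial certificates for inequalities and linear maps.

module Certificates where
  open RingSolving
  open Integrality

  infix 9 _[_]

  _[_] : ∀ {j k} → Poly k → Vec (Poly j) k → Poly j
  op o e e′ [ s ] = op o (e [ s ]) (e′ [ s ])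
  conℤ c [ s ] = conℤ c
  var i [ s ] = lookup s i
  (e [^] k) [ s ] = (e [ s ]) [^] k
  ([-] e) [ s ] = [-] (e [ s ])

  substitution : ∀ {j k} (e : Poly k) (s : Vec (Poly j) k) ρ → ⟦ e [ s ] ⟧ ρ ≡ ⟦ e ⟧ (Vec.map (λ p → ⟦ p ⟧ ρ) s)
  substitution (op o e e′) s ρ = cong₂ (λ x y → ⟦ op o (var zero) (var (suc zero)) ⟧ (x ∷ y ∷ [])) (substitution e s ρ) (substitution e′ s ρ)
  substitution (conℤ c) s ρ = refl
  substitution (var i) s ρ = sym (Vec.lookup-map i (λ p → ⟦ p ⟧ ρ) s)
  substitution (e [^] k) s ρ = cong (λ x → ⟦ var zero [^] k ⟧ (x ∷ [])) (substitution e s ρ)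
  substitution ([-] e) s ρ = cong ℤ.-_ (substitution e s ρ)

  record V : Set where
    constructor vec
    field X Y I J : ℤ

  vec-cong : ∀ {X X′ Y Y′ I I′ J J′ : ℤ} → X ≡ X′ → Y ≡ Y′ → I ≡ I′ → J ≡ J′ → vec X Y I J ≡ vec X′ Y′ I′ J′
  vec-cong refl refl refl refl = refl

  infixl 6 _+ᵛ_ _-ᵛ_
  infixl 7 _•_

  _+ᵛ_ _-ᵛ_ : V → V → V
  vec X Y I J +ᵛ vec X′ Y′ I′ J′ = vec (X ℤ.+ X′) (Y ℤ.+ Y′) (I ℤ.+ I′) (J ℤ.+ J′)
  vec X Y I J -ᵛ vec X′ Y′ I′ J′ = vec (X ℤ.- X′) (Y ℤ.- Y′) (I ℤ.- I′) (J ℤ.- J′)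

  _•_ : ℤ → V → V
  k • vec X Y I J = vec (k ℤ.* X) (k ℤ.* Y) (k ℤ.* I) (k ℤ.* J)

  0ᵛ : V
  0ᵛ = vec (+ 0) (+ 0) (+ 0) (+ 0)

  record Vᴾ (k : ℕ) : Set where
    constructor vecᴾ
    field x₀ x₁ x₂ x₃ : Poly k

  infixl 6 _+ᴾ_ _-ᴾ_
  infixl 7 _•ᴾ_

  _+ᴾ_ _-ᴾ_ : ∀ {k} → Vᴾ k → Vᴾ k → Vᴾ k
  vecᴾ x y i j +ᴾ vecᴾ x′ y′ i′ j′ = vecᴾ (x [+] x′) (y [+] y′) (i [+] i′) (j [+] j′)
  vecᴾ x y i j -ᴾ vecᴾ x′ y′ i′ j′ = vecᴾ (x [-] x′) (y [-] y′) (i [-] i′) (j [-] j′)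

  _•ᴾ_ : ∀ {k} → Poly k → Vᴾ k → Vᴾ k
  e •ᴾ vecᴾ x y i j = vecᴾ (e [*] x) (e [*] y) (e [*] i) (e [*] j)

  ⟦_⟧ᵛ ⟦_⟧ᵛ↓ : ∀ {k} → Vᴾ k → Vec ℤ k → V
  ⟦ vecᴾ x y i j ⟧ᵛ ρ = vec (⟦ x ⟧ ρ) (⟦ y ⟧ ρ) (⟦ i ⟧ ρ) (⟦ j ⟧ ρ)
  ⟦ vecᴾ x y i j ⟧ᵛ↓ ρ = vec (⟦ x ⟧↓ ρ) (⟦ y ⟧↓ ρ) (⟦ i ⟧↓ ρ) (⟦ j ⟧↓ ρ)

  infix 9 _[_]ᵛ

  _[_]ᵛ : ∀ {j k} → Vᴾ k → Vec (Poly j) k → Vᴾ j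
  vecᴾ x y i j [ s ]ᵛ = vecᴾ (x [ s ]) (y [ s ]) (i [ s ]) (j [ s ])

  substitutionᵛ : ∀ {j k} (p : Vᴾ k) (s : Vec (Poly j) k) ρ → ⟦ p [ s ]ᵛ ⟧ᵛ ρ ≡ ⟦ p ⟧ᵛ (Vec.map (λ e → ⟦ e ⟧ ρ) s)
  substitutionᵛ (vecᴾ x y i j) s ρ = vec-cong (substitution x s ρ) (substitution y s ρ) (substitution i s ρ) (substitution j s ρ)

  proveᵛ : ∀ {k} (p q : Vᴾ k) ρ → ⟦ p ⟧ᵛ↓ ρ ≡ ⟦ q ⟧ᵛ↓ ρ → ⟦ p ⟧ᵛ ρ ≡ ⟦ q ⟧ᵛ ρ
  proveᵛ (vecᴾ x y i j) (vecᴾ x′ y′ i′ j′) ρ eq =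
    vec-cong (proveℤ ρ x x′ (cong V.X eq)) (proveℤ ρ y y′ (cong V.Y eq)) (proveℤ ρ i i′ (cong V.I eq)) (proveℤ ρ j j′ (cong V.J eq))

  -- The first variable stands for ν, the others for the entries of a vector.
  N X Y I J L M : Poly 5
  N = var (fin 0)
  X = var (fin 1)
  Y = var (fin 2)
  I = var (fin 3)
  J = var (fin 4)
  L = # 2 [*] N
  M = L [+] # 1

  id : Vᴾ 5
  id = vecᴾ X Y I J

  infix 9 _∘_ _∘ᵛ_

  _∘_ : Poly 5 → Vᴾ 5 → Poly 5
  e ∘ (vecᴾ x y i j) = e [ N ∷ x ∷ y ∷ i ∷ j ∷ [] ]

  _∘ᵛ_ : Vᴾ 5 → Vᴾ 5 → Vᴾ 5
  p ∘ᵛ (vecᴾ x y i j) = p [ N ∷ x ∷ y ∷ i ∷ j ∷ [] ]ᵛ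

  private
    n x y i j x′ y′ i′ j′ : Poly 9
    n = var (fin 0)
    x = var (fin 1)
    y = var (fin 2)
    i = var (fin 3)
    j = var (fin 4)
    x′ = var (fin 5)
    y′ = var (fin 6)
    i′ = var (fin 7)
    j′ = var (fin 8)

    first second both : Vec (Poly 9) 5
    first = n ∷ x ∷ y ∷ i ∷ j ∷ []
    second = n ∷ x′ ∷ y′ ∷ i′ ∷ j′ ∷ []
    both = n ∷ x [+] x′ ∷ y [+] y′ ∷ i [+] i′ ∷ j [+] j′ ∷ []

  -- Additivity of a map as one identity in nine variables, ν and the entries of two vectors, so
  -- that it is proved by `refl`.
  Additive : Vᴾ 5 → Set
  Additive p = ∀ {ρ} → ⟦ p [ both ]ᵛ ⟧ᵛ↓ ρ ≡ ⟦ p [ first ]ᵛ +ᴾ p [ second ]ᵛ ⟧ᵛ↓ ρ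

  module Evaluation (ν : ℤ) where

    env : V → Vec ℤ 5
    env v = ν ∷ V.X v ∷ V.Y v ∷ V.I v ∷ V.J v ∷ []

    infix 8 _$_

    _$_ : Vᴾ 5 → V → V
    p $ v = ⟦ p ⟧ᵛ (env v)

    ∘-$ : ∀ e p v → ⟦ e ∘ p ⟧ (env v) ≡ ⟦ e ⟧ (env (p $ v))
    ∘-$ e (vecᴾ x y i j) v = substitution e (N ∷ x ∷ y ∷ i ∷ j ∷ []) (env v)

    ∘ᵛ-$ : ∀ p q v → p ∘ᵛ q $ v ≡ p $ (q $ v)
    ∘ᵛ-$ p (vecᴾ x y i j) v = substitutionᵛ p (N ∷ x ∷ y ∷ i ∷ j ∷ []) (env v)

    additive : ∀ p → Additive p → ∀ v w → p $ (v +ᵛ w) ≡ p $ v +ᵛ p $ w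
    additive p eq (vec X Y I J) (vec X′ Y′ I′ J′) = trans (sym (substitutionᵛ p both ρ))
      (trans (proveᵛ (p [ both ]ᵛ) (p [ first ]ᵛ +ᴾ p [ second ]ᵛ) ρ eq) (cong₂ _+ᵛ_ (substitutionᵛ p first ρ) (substitutionᵛ p second ρ)))
      where ρ = ν ∷ X ∷ Y ∷ I ∷ J ∷ X′ ∷ Y′ ∷ I′ ∷ J′ ∷ []

    infix 4 _⊢_

    -- The inequality is attached to a polynomial rather than to its value. So `by` can accept a
    -- certificate: the target equals, identically in ν and the coordinates, a sum of products of
    -- forms already known to be non-negative.
    record _⊢_ (v : V) (e : Poly 5) : Set where
      constructor cert
      field nonneg : + 0 ℤ.≤ ⟦ e ⟧ (env v)
    open _⊢_ public

    infixl 6 _∔_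
    infixl 7 _∙_ _⊙_

    _∔_ : ∀ {v e e′} → v ⊢ e → v ⊢ e′ → v ⊢ e [+] e′
    cert p ∔ cert p′ = cert (ℤ.+-mono-≤ p p′)

    _∙_ : ∀ {v e e′} → v ⊢ e → v ⊢ e′ → v ⊢ e [*] e′
    cert p ∙ cert p′ = cert (0≤* p p′)
      where
      0≤* : ∀ {x y} → + 0 ℤ.≤ x → + 0 ℤ.≤ y → + 0 ℤ.≤ x ℤ.* y
      0≤* {+ x} {+ y} _ _ = subst (+ 0 ℤ.≤_) (ℤ.pos-* x y) (ℤ.+≤+ z≤n)

    lit : ∀ {v} k → v ⊢ # k
    lit {v} k = cert (subst (+ 0 ℤ.≤_) (sym (fromℤ-id {v} k)) (ℤ.+≤+ z≤n))
      where
      fromℤ-id : ∀ {v} k → ⟦ # k ⟧ (env v) ≡ + k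
      fromℤ-id zero = refl
      fromℤ-id {v} (suc k) = cong ℤ.suc (fromℤ-id {v} k)

    _⊙_ : ∀ {v e} k → v ⊢ e → v ⊢ # k [*] e
    k ⊙ c = lit k ∙ c

    by : ∀ {v e e′} → v ⊢ e → (∀ {ρ} → ⟦ e′ ⟧↓ ρ ≡ ⟦ e ⟧↓ ρ) → v ⊢ e′
    by {v} {e} {e′} (cert p) eq = cert (subst (+ 0 ℤ.≤_) (sym (proveℤ (env v) e′ e eq)) p)

    at : ∀ {v e} p → v ⊢ e ∘ p → p $ v ⊢ e
    at {v} {e} p (cert c) = cert (subst (+ 0 ℤ.≤_) (∘-$ e p v) c)

    -- Values are integers, so a failing inequality fails by at least 1. The certificates live on
    -- this gain.
    decide : ∀ {A : Set} v e → (v ⊢ [-] e [-] # 1 → A) → (v ⊢ e → A) → A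
    decide v e negative nonnegative = go (⟦ e ⟧ (env v)) refl
      where
      go : ∀ z → ⟦ e ⟧ (env v) ≡ z → _
      go (+ k) eq = nonnegative (cert (subst (+ 0 ℤ.≤_) (sym eq) (ℤ.+≤+ z≤n)))
      go -[1+ k ] eq = negative (cert (subst (λ z → + 0 ℤ.≤ ℤ.- z ℤ.- + 1) (sym eq) (ℤ.+≤+ z≤n)))

    positive : ∀ {v} e → v ⊢ e [-] # 1 → + 0 ℤ.< ⟦ e ⟧ (env v)
    positive e (cert p) = ℤ.suc[i]≤j⇒i<j (ℤ.0≤i-j⇒j≤i p)

    identity : ∀ p q → (∀ {ρ} → ⟦ p ⟧ᵛ↓ ρ ≡ ⟦ q ⟧ᵛ↓ ρ) → ∀ v → p $ v ≡ q $ v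
    identity p q eq v = proveᵛ p q (env v) eq

-- The cone over the hexagon facet and the subtraction of a vertex.

module HexagonCone where
  open RingSolving
  open Integrality
  open Certificates

  -- The cone over the facet of the Klein polyhedron which is the Cayley polytope of the hexagons
  -- conv ±{(1,0),(0,1),(1,1)} (first kind) and conv ±{(1,0),(l,1),(l+1,1)} (second kind):
  -- at heights X and Y it is the set of (I,J) in the corresponding Minkowski sum.
  module Cone (ν : ℤ) (6≤ν : + 6 ℤ.≤ ν) where
    open Evaluation ν

    -- Besides the two heights there is one pair of walls for each edge direction of the hexagons:
    -- `c₁` to `c₅` bound J, I - lJ, I - (l+1)J, I and I - J, for the directions (1,0), (l,1),
    -- (l+1,1), (0,1) and (1,1).
    data Face : Set where
      x≥0 y≥0 c₁⁺ c₁⁻ c₂⁺ c₂⁻ c₃⁺ c₃⁻ c₄⁺ c₄⁻ c₅⁺ c₅⁻ : Face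

    face : Face → Poly 5
    face x≥0 = X
    face y≥0 = Y
    face c₁⁺ = X [+] Y [-] J
    face c₁⁻ = X [+] Y [+] J
    face c₂⁺ = Y [+] L [*] X [-] I [+] L [*] J
    face c₂⁻ = Y [+] L [*] X [+] I [-] L [*] J
    face c₃⁺ = Y [+] M [*] X [-] I [+] M [*] J
    face c₃⁻ = Y [+] M [*] X [+] I [-] M [*] J
    face c₄⁺ = X [+] M [*] Y [-] I
    face c₄⁻ = X [+] M [*] Y [+] I
    face c₅⁺ = X [+] L [*] Y [-] I [+] J
    face c₅⁻ = X [+] L [*] Y [+] I [-] J

    record InCone (v : V) : Set where
      constructor inCone
      field faces : ∀ c → v ⊢ face c

    inCone-at : ∀ {v} p → (∀ c → v ⊢ face c ∘ p) → InCone (p $ v)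
    inCone-at p f = inCone λ c → at p (f c)

    -- Certificates expand l as 12 + (l - 12). This is the origin of the multipliers 11, 12, 13, 24
    -- and 26 and of the products with `l≥12`.
    l≥12 : ∀ {v} → v ⊢ L [-] # 12
    l≥12 {v} = by {v} (2 ⊙ cert {v} {N [-] # 6} (ℤ.i≤j⇒0≤j-i 6≤ν)) refl

    l≥0 : ∀ {v} → v ⊢ L
    l≥0 = by (l≥12 ∔ lit 12) refl

    l≥1 : ∀ {v} → v ⊢ L [-] # 1
    l≥1 = by (l≥12 ∔ lit 11) refl

    m≥0 : ∀ {v} → v ⊢ M
    m≥0 = l≥0 ∔ lit 1

    -- `negate` is the central symmetry of both hexagons. `swap` exchanges them: it sends (1,0),
    -- (0,1), (1,1) to (-1,0), (l+1,1), (l,1).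
    negate swap : Vᴾ 5
    negate = vecᴾ X Y ([-] I) ([-] J)
    swap = vecᴾ Y X (M [*] J [-] I) J

    cone-neg : ∀ {v} → InCone v → InCone (negate $ v)
    cone-neg (inCone f) = inCone-at negate λ
      { x≥0 → by (f x≥0) refl ; y≥0 → by (f y≥0) refl ; c₁⁺ → by (f c₁⁻) refl ; c₁⁻ → by (f c₁⁺) refl
      ; c₂⁺ → by (f c₂⁻) refl ; c₂⁻ → by (f c₂⁺) refl ; c₃⁺ → by (f c₃⁻) refl ; c₃⁻ → by (f c₃⁺) refl
      ; c₄⁺ → by (f c₄⁻) refl ; c₄⁻ → by (f c₄⁺) refl ; c₅⁺ → by (f c₅⁻) refl ; c₅⁻ → by (f c₅⁺) refl }

    cone-swap : ∀ {v} → InCone v → InCone (swap $ v)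
    cone-swap (inCone f) = inCone-at swap λ
      { x≥0 → by (f y≥0) refl ; y≥0 → by (f x≥0) refl ; c₁⁺ → by (f c₁⁺) refl ; c₁⁻ → by (f c₁⁻) refl
      ; c₂⁺ → by (f c₅⁻) refl ; c₂⁻ → by (f c₅⁺) refl ; c₃⁺ → by (f c₄⁻) refl ; c₃⁻ → by (f c₄⁺) refl
      ; c₄⁺ → by (f c₃⁻) refl ; c₄⁻ → by (f c₃⁺) refl ; c₅⁺ → by (f c₂⁻) refl ; c₅⁻ → by (f c₂⁺) refl }

    generator₁₀ : InCone (vec (+ 1) (+ 0) (+ 1) (+ 0))
    generator₁₀ = inCone-at {0ᵛ} (vecᴾ (# 1) (# 0) (# 1) (# 0)) λ
      { x≥0 → by (lit 1) refl ; y≥0 → by (lit 0) refl ; c₁⁺ → by (lit 1) refl ; c₁⁻ → by (lit 1) refl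
      ; c₂⁺ → by (lit 11 ∔ l≥12) refl ; c₂⁻ → by (lit 13 ∔ l≥12) refl ; c₃⁺ → by (lit 12 ∔ l≥12) refl ; c₃⁻ → by (lit 14 ∔ l≥12) refl
      ; c₄⁺ → by (lit 0) refl ; c₄⁻ → by (lit 2) refl ; c₅⁺ → by (lit 0) refl ; c₅⁻ → by (lit 2) refl }

    generator₀₁ : InCone (vec (+ 1) (+ 0) (+ 0) (+ 1))
    generator₀₁ = inCone-at {0ᵛ} (vecᴾ (# 1) (# 0) (# 0) (# 1)) λ
      { x≥0 → by (lit 1) refl ; y≥0 → by (lit 0) refl ; c₁⁺ → by (lit 0) refl ; c₁⁻ → by (lit 2) refl
      ; c₂⁺ → by (lit 24 ∔ 2 ⊙ l≥12) refl ; c₂⁻ → by (lit 0) refl ; c₃⁺ → by (lit 26 ∔ 2 ⊙ l≥12) refl ; c₃⁻ → by (lit 0) refl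
      ; c₄⁺ → by (lit 1) refl ; c₄⁻ → by (lit 1) refl ; c₅⁺ → by (lit 2) refl ; c₅⁻ → by (lit 0) refl }

    generator₁₁ : InCone (vec (+ 1) (+ 0) (+ 1) (+ 1))
    generator₁₁ = inCone-at {0ᵛ} (vecᴾ (# 1) (# 0) (# 1) (# 1)) λ
      { x≥0 → by (lit 1) refl ; y≥0 → by (lit 0) refl ; c₁⁺ → by (lit 0) refl ; c₁⁻ → by (lit 2) refl
      ; c₂⁺ → by (lit 23 ∔ 2 ⊙ l≥12) refl ; c₂⁻ → by (lit 1) refl ; c₃⁺ → by (lit 25 ∔ 2 ⊙ l≥12) refl ; c₃⁻ → by (lit 1) refl
      ; c₄⁺ → by (lit 0) refl ; c₄⁻ → by (lit 2) refl ; c₅⁺ → by (lit 1) refl ; c₅⁻ → by (lit 1) refl }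

    Split : V → Set
    Split v = ∃[ i ] ∃[ j ] (InCone (vec (+ 1) (+ 0) i j) × InCone (v -ᵛ vec (+ 1) (+ 0) i j))

    split-neg : ∀ v → Split (negate $ v) → Split v
    split-neg (vec _ _ I J) (i , j , g , c) = ℤ.- i , ℤ.- j , cone-neg g ,
      subst InCone (vec-cong refl refl (eq I i) (eq J j)) (cone-neg c)
      where
      eq : ∀ i w → ℤ.- (ℤ.- i ℤ.- w) ≡ i ℤ.- ℤ.- w
      eq = solveℤ 2 (λ i w → [-] ([-] i [-] w) [=] i [-] [-] w) refl

    minus : (i j : Poly 5) → Vᴾ 5
    minus i j = id -ᴾ vecᴾ (# 1) (# 0) i j

    -- For J > Y one of the top vertices (0,1) and (1,1) is subtracted; both leave `c₁⁺` unchanged.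
    -- The vertex (0,1) uses up one unit of `c₄⁺`, so (1,1), which uses none, is taken when `c₄⁺` is
    -- tight.
    above-inner : ∀ {v} → InCone v → v ⊢ X [-] # 2 → v ⊢ J [-] Y [-] # 1 → v ⊢ X [+] M [*] Y [-] I [-] # 1 → Split v
    above-inner {v} (inCone f) hX hj h₄ = _ , _ , generator₀₁ , inCone-at (minus (# 0) (# 1)) λ
      { x≥0 → by (lit 1 ∔ hX) refl ; y≥0 → by (f y≥0) refl
      ; c₁⁺ → by (f c₁⁺) refl ; c₁⁻ → by (lit 1 ∔ hj ∔ 2 ⊙ f y≥0 ∔ hX) refl
      ; c₂⁺ → by (h₄ ∔ lit 11 ∔ 12 ⊙ hj ∔ 11 ⊙ hX ∔ l≥12 ∔ l≥12 ∙ hj ∔ l≥12 ∙ hX) refl ; c₂⁻ → by (f c₂⁻) refl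
      ; c₃⁺ → by (h₄ ∔ lit 12 ∔ 13 ⊙ hj ∔ f y≥0 ∔ 12 ⊙ hX ∔ l≥12 ∔ l≥12 ∙ hj ∔ l≥12 ∙ hX) refl ; c₃⁻ → by (f c₃⁻) refl
      ; c₄⁺ → by h₄ refl ; c₄⁻ → by (f c₅⁻ ∔ hj ∔ 2 ⊙ f y≥0) refl
      ; c₅⁺ → by (h₄ ∔ hj) refl ; c₅⁻ → by (f c₅⁻) refl }

    above-outer : ∀ {v} → InCone v → v ⊢ X [-] # 2 → v ⊢ J [-] Y [-] # 1 → v ⊢ I [-] X [-] M [*] Y → Split v
    above-outer {v} (inCone f) hX hj h₄ = _ , _ , generator₁₁ , inCone-at (minus (# 1) (# 1)) λ
      { x≥0 → by (lit 1 ∔ hX) refl ; y≥0 → by (f y≥0) refl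
      ; c₁⁺ → by (f c₁⁺) refl ; c₁⁻ → by (lit 1 ∔ hj ∔ 2 ⊙ f y≥0 ∔ hX) refl
      ; c₂⁺ → by (f c₄⁺ ∔ lit 11 ∔ 12 ⊙ hj ∔ 11 ⊙ hX ∔ l≥12 ∔ l≥12 ∙ hj ∔ l≥12 ∙ hX) refl ; c₂⁻ → by (h₄ ∔ l≥0 ∙ f c₁⁺ ∔ lit 1 ∔ 2 ⊙ f y≥0 ∔ hX) refl
      ; c₃⁺ → by (f c₄⁺ ∔ lit 12 ∔ 13 ⊙ hj ∔ f y≥0 ∔ 12 ⊙ hX ∔ l≥12 ∔ l≥12 ∙ hj ∔ l≥12 ∙ hX) refl ; c₃⁻ → by (h₄ ∔ m≥0 ∙ f c₁⁺ ∔ lit 1 ∔ f y≥0 ∔ hX) refl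
      ; c₄⁺ → by (f c₄⁺) refl ; c₄⁻ → by (h₄ ∔ lit 2 ∔ 26 ⊙ f y≥0 ∔ 2 ⊙ hX ∔ 2 ⊙ (l≥12 ∙ f y≥0)) refl
      ; c₅⁺ → by (f c₄⁺ ∔ hj) refl ; c₅⁻ → by (h₄ ∔ f c₁⁺ ∔ lit 1 ∔ 24 ⊙ f y≥0 ∔ hX ∔ 2 ⊙ (l≥12 ∙ f y≥0)) refl }

    -- For J = Y the forms `c₄⁺` and `c₅⁺` agree. The vertex (0,1) would lower them by 1 and 2; when
    -- less than 2 is left, (1,0) is subtracted, which lowers neither.
    edge-outer : ∀ {v} → InCone v → v ⊢ X [-] # 2 → v ⊢ J [-] Y → v ⊢ Y [-] J → v ⊢ I [-] X [-] M [*] Y [+] # 1 → Split v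
    edge-outer {v} (inCone f) hX hj hj′ h₄ = _ , _ , generator₁₀ , inCone-at (minus (# 1) (# 0)) λ
      { x≥0 → by (lit 1 ∔ hX) refl ; y≥0 → by (f y≥0) refl
      ; c₁⁺ → by (hj′ ∔ lit 1 ∔ hX) refl ; c₁⁻ → by (lit 1 ∔ hj ∔ 2 ⊙ f y≥0 ∔ hX) refl
      ; c₂⁺ → by (f c₄⁺ ∔ lit 11 ∔ 12 ⊙ hj ∔ 11 ⊙ hX ∔ l≥12 ∔ l≥12 ∙ hj ∔ l≥12 ∙ hX) refl ; c₂⁻ → by (h₄ ∔ l≥0 ∙ hj′ ∔ lit 12 ∔ 2 ⊙ f y≥0 ∔ 13 ⊙ hX ∔ l≥12 ∔ l≥12 ∙ hX) refl
      ; c₃⁺ → by (f c₄⁺ ∔ lit 12 ∔ 13 ⊙ hj ∔ f y≥0 ∔ 12 ⊙ hX ∔ l≥12 ∔ l≥12 ∙ hj ∔ l≥12 ∙ hX) refl ; c₃⁻ → by (h₄ ∔ m≥0 ∙ hj′ ∔ lit 13 ∔ f y≥0 ∔ 14 ⊙ hX ∔ l≥12 ∔ l≥12 ∙ hX) refl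
      ; c₄⁺ → by (f c₄⁺) refl ; c₄⁻ → by (h₄ ∔ lit 1 ∔ 26 ⊙ f y≥0 ∔ 2 ⊙ hX ∔ 2 ⊙ (l≥12 ∙ f y≥0)) refl
      ; c₅⁺ → by (f c₄⁺ ∔ hj) refl ; c₅⁻ → by (h₄ ∔ hj′ ∔ lit 1 ∔ 24 ⊙ f y≥0 ∔ 2 ⊙ hX ∔ 2 ⊙ (l≥12 ∙ f y≥0)) refl }

    edge-inner : ∀ {v} → InCone v → v ⊢ X [-] # 2 → v ⊢ J [-] Y → v ⊢ X [+] M [*] Y [-] I [-] # 2 → v ⊢ X [+] M [*] Y [+] I [-] # 1 → Split v
    edge-inner {v} (inCone f) hX hj h₄ h₄′ = _ , _ , generator₀₁ , inCone-at (minus (# 0) (# 1)) λ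
      { x≥0 → by (lit 1 ∔ hX) refl ; y≥0 → by (f y≥0) refl
      ; c₁⁺ → by (f c₁⁺) refl ; c₁⁻ → by (hj ∔ 2 ⊙ f y≥0 ∔ hX) refl
      ; c₂⁺ → by (h₄ ∔ 12 ⊙ hj ∔ 11 ⊙ hX ∔ l≥12 ∙ hj ∔ l≥12 ∙ hX) refl ; c₂⁻ → by (f c₂⁻) refl
      ; c₃⁺ → by (h₄ ∔ 13 ⊙ hj ∔ f y≥0 ∔ 12 ⊙ hX ∔ l≥12 ∙ hj ∔ l≥12 ∙ hX) refl ; c₃⁻ → by (f c₃⁻) refl
      ; c₄⁺ → by (h₄ ∔ lit 1) refl ; c₄⁻ → by h₄′ refl
      ; c₅⁺ → by (h₄ ∔ hj) refl ; c₅⁻ → by (f c₅⁻) refl }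

    -- The amounts 2l, 2(l+1) and 2 are the values of `c₂⁻`, `c₃⁻` and `c₅⁻` at the vertex (0,-1).
    inner-down : ∀ {v} → InCone v → v ⊢ X [-] # 2 → v ⊢ Y [-] J [-] # 1 → v ⊢ Y [+] J [-] # 1 → v ⊢ Y [+] L [*] X [+] I [-] L [*] J [-] # 2 [*] L → v ⊢ Y [+] M [*] X [+] I [-] M [*] J [-] # 2 [*] M → v ⊢ X [+] L [*] Y [+] I [-] J [-] # 2 → Split v
    inner-down {v} (inCone f) hX hj⁺ hj⁻ h₂ h₃ h₅ = _ , _ , cone-neg generator₀₁ , inCone-at (minus (# 0) ([-] # 1)) λ
      { x≥0 → by (lit 1 ∔ hX) refl ; y≥0 → by (f y≥0) refl
      ; c₁⁺ → by (hj⁺ ∔ lit 1 ∔ hX) refl ; c₁⁻ → by (f c₁⁻) refl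
      ; c₂⁺ → by (f c₂⁺) refl ; c₂⁻ → by h₂ refl
      ; c₃⁺ → by (f c₃⁺) refl ; c₃⁻ → by h₃ refl
      ; c₄⁺ → by (f c₅⁺ ∔ hj⁺) refl ; c₄⁻ → by (h₅ ∔ hj⁻ ∔ lit 2) refl
      ; c₅⁺ → by (f c₅⁺) refl ; c₅⁻ → by h₅ refl }

    -- If (0,-1) cannot be subtracted, v is close to one of the walls `c₂⁻`, `c₃⁻`, `c₅⁻`. The cone
    -- is wide enough for v then to be far from all of `c₂⁺`, `c₃⁺`, `c₅⁺`, and (0,1) can be
    -- subtracted.
    split-inner : ∀ {v} → InCone v → v ⊢ X [-] # 2 → v ⊢ Y [-] J [-] # 1 → v ⊢ Y [+] J [-] # 1 → Split v
    split-inner {v} c@(inCone f) hX hj⁺ hj⁻ =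
      decide v (Y [+] L [*] X [+] I [-] L [*] J [-] # 2 [*] L)
        (λ h → up (by (h ∔ lit 1 ∔ 2 ⊙ f y≥0 ∔ 24 ⊙ hX ∔ 2 ⊙ (l≥12 ∙ hX)) refl)
          (by (h ∔ hj⁻ ∔ lit 2 ∔ f y≥0 ∔ 25 ⊙ hX ∔ 2 ⊙ (l≥12 ∙ hX)) refl)
          (by (h ∔ l≥1 ∙ hj⁺ ∔ lit 12 ∔ 2 ⊙ f y≥0 ∔ 13 ⊙ hX ∔ l≥12 ∔ l≥12 ∙ hX) refl)) λ h₂ →
      decide v (Y [+] M [*] X [+] I [-] M [*] J [-] # 2 [*] M)
        (λ h → up (by (h ∔ hj⁺ ∔ lit 2 ∔ f y≥0 ∔ 25 ⊙ hX ∔ 2 ⊙ (l≥12 ∙ hX)) refl)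
          (by (h ∔ lit 1 ∔ 2 ⊙ f y≥0 ∔ 26 ⊙ hX ∔ 2 ⊙ (l≥12 ∙ hX)) refl)
          (by (h ∔ l≥0 ∙ hj⁺ ∔ lit 13 ∔ f y≥0 ∔ 14 ⊙ hX ∔ l≥12 ∔ l≥12 ∙ hX) refl)) λ h₃ →
      decide v (X [+] L [*] Y [+] I [-] J [-] # 2)
        (λ h → up (by (h ∔ l≥1 ∙ hj⁻ ∔ lit 12 ∔ 2 ⊙ f y≥0 ∔ 13 ⊙ hX ∔ l≥12 ∔ l≥12 ∙ hX) refl)
          (by (h ∔ l≥0 ∙ hj⁻ ∔ lit 13 ∔ f y≥0 ∔ 14 ⊙ hX ∔ l≥12 ∔ l≥12 ∙ hX) refl)
          (by (h ∔ lit 1 ∔ 24 ⊙ f y≥0 ∔ 2 ⊙ hX ∔ 2 ⊙ (l≥12 ∙ f y≥0)) refl)) λ h₅ →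
      inner-down c hX hj⁺ hj⁻ h₂ h₃ h₅
      where
      up : v ⊢ Y [+] L [*] X [-] I [+] L [*] J [-] # 2 [*] L → v ⊢ Y [+] M [*] X [-] I [+] M [*] J [-] # 2 [*] M → v ⊢ X [+] L [*] Y [-] I [+] J [-] # 2 → Split v
      up h₂ h₃ h₅ = split-neg v (inner-down (cone-neg c) (at negate hX) (at negate (by hj⁻ refl)) (at negate (by hj⁺ refl))
        (at negate (by h₂ refl)) (at negate (by h₃ refl)) (at negate (by h₅ refl)))

    split-above : ∀ {v} → InCone v → v ⊢ X [-] # 2 → v ⊢ J [-] Y [-] # 1 → Split v
    split-above {v} c hX hj = decide v (X [+] M [*] Y [-] I [-] # 1) (λ h → above-outer c hX hj (by h refl)) (above-inner c hX hj)

    split-edge : ∀ {v} → InCone v → v ⊢ X [-] # 2 → v ⊢ J [-] Y → v ⊢ Y [-] J → Split v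
    split-edge {v} c@(inCone f) hX hj hj′ =
      decide v (X [+] M [*] Y [-] I [-] # 2) (λ h → edge-outer c hX hj hj′ (by h refl)) λ h →
      decide v (X [+] M [*] Y [+] I [-] # 1)
        -- Here I = −X − mY, and c₅⁻ forces Y = 0.
        (λ h′ → split-neg v (edge-outer (cone-neg c) (at negate hX) (at negate (by (f c₅⁻ ∔ h′ ∔ hj ∔ hj′) refl))
          (at negate (by (2 ⊙ f y≥0 ∔ hj) refl)) (at negate (by (h′ ∔ lit 1) refl))))
        (edge-inner c hX hj h)

    split : ∀ {v} → InCone v → v ⊢ X [-] # 2 → Split v
    split {v} c hX =
      decide v (Y [-] J) (λ h → split-above c hX (by h refl)) λ hj⁺ →
      decide v (Y [+] J) (λ h → split-neg v (split-above (cone-neg c) (at negate hX) (at negate (by h refl)))) λ hj⁻ →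
      decide v (Y [-] J [-] # 1) (λ h → split-edge c hX (by h refl) hj⁺) λ hj⁺′ →
      decide v (Y [+] J [-] # 1) (λ h → split-neg v (split-edge (cone-neg c) (at negate hX) (at negate (by h refl)) (at negate (by hj⁻ refl)))) λ hj⁻′ →
      split-inner c hX hj⁺′ hj⁻′

-- Facet coordinates on O_K, totally positive units and symmetries.

module LatticeCoordinates where
  open RingSolving
  open OrderedRings
  open Rationals
  open Multiplication
  open FieldOrder
  open Integrality
  open AlgebraicIntegers
  open Certificates
  open HexagonCone
  open import Data.Rational using (_+_; _*_; -_; _-_; _<_)

  timesᴾ : ∀ {k} → Poly k → Vᴾ k → Vᴾ k → Vᴾ k
  timesᴾ n (vecᴾ s₀ s₁ s₂ s₃) (vecᴾ t₀ t₁ t₂ t₃) = let m₁ = # 2 [*] n [-] # 1 ; m₂ = # 2 [*] n [+] # 1 ; m₃ = # 2 [*] n [+] # 3 in vecᴾ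
    (s₀ [*] t₀ [+] m₁ [*] m₂ [*] (s₁ [*] t₁) [+] m₁ [*] m₃ [*] (s₂ [*] t₂) [+] m₂ [*] m₃ [*] (s₃ [*] t₃))
    (s₀ [*] t₁ [+] s₁ [*] t₀ [+] m₃ [*] (s₂ [*] t₃ [+] s₃ [*] t₂))
    (s₀ [*] t₂ [+] s₂ [*] t₀ [+] m₂ [*] (s₁ [*] t₃ [+] s₃ [*] t₁))
    (s₀ [*] t₃ [+] s₃ [*] t₀ [+] m₁ [*] (s₁ [*] t₂ [+] s₂ [*] t₁))

  conj : Bool → Bool → V → V
  conj true  true  (vec x y z w) = vec x y z w
  conj true  false (vec x y z w) = vec x y (ℤ.- z) (ℤ.- w)
  conj false true  (vec x y z w) = vec x (ℤ.- y) z (ℤ.- w)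
  conj false false (vec x y z w) = vec x (ℤ.- y) (ℤ.- z) (ℤ.- (ℤ.- w))

  conjᴾ : ∀ {k} → Bool → Bool → Vᴾ k → Vᴾ k
  conjᴾ true  true  (vecᴾ x y z w) = vecᴾ x y z w
  conjᴾ true  false (vecᴾ x y z w) = vecᴾ x y ([-] z) ([-] w)
  conjᴾ false true  (vecᴾ x y z w) = vecᴾ x ([-] y) z ([-] w)
  conjᴾ false false (vecᴾ x y z w) = vecᴾ x ([-] y) ([-] z) ([-] ([-] w))

  ⟦conjᴾ⟧ : ∀ {k} s t (p : Vᴾ k) ρ → ⟦ conjᴾ s t p ⟧ᵛ ρ ≡ conj s t (⟦ p ⟧ᵛ ρ)
  ⟦conjᴾ⟧ true  true  p ρ = refl
  ⟦conjᴾ⟧ true  false p ρ = refl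
  ⟦conjᴾ⟧ false true  p ρ = refl
  ⟦conjᴾ⟧ false false p ρ = refl

  -- Twice the coordinates 1, √p, √q, √r of the element with coordinates X, Y, I, J with respect to the basis
  --   (2m + √p + √r)/2,  (m² + (m+1)√p + m√q + (m−1)√r)/2,  (m + √p + √q + √r)/2,  (−2 + √p − √r)/2,
  -- where m = m₂: the centres of the two hexagons and two of their edge directions.
  coords : Vᴾ 5
  coords = vecᴾ (# 2 [*] (M [*] X [+] M [*] N [*] Y [+] N [*] I [-] J) [+] z) (# 2 [*] (Y [+] J) [+] w) z w
    where
    z w : Poly 5
    z = M [*] Y [+] I
    w = X [+] L [*] Y [+] I [-] J

  module Lattice (S : Setting) where
    open Setting S
    open Biquadratic S
    open Integers S
    open Evaluation ν public
    open Cone ν 6≤ν public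
    private
      infixl 6 _⊞_
      _⊞_ : K → K → K
      _⊞_ = _⊕_ n

    l m : ℤ
    l = + 2 ℤ.* ν
    m = l ℤ.+ + 1

    halfᵛ : V → K
    halfᵛ (vec x y z w) = half x y z w

    ι : V → K
    ι v = halfᵛ (coords $ v)

    lattice-surjective : ∀ A B C D → ∃[ v ] (lattice A B C D ≡ ι v)
    lattice-surjective A B C D = g $ vec A B C D ,
        cong halfᵛ (trans (identity (vecᴾ (# 2 [*] X [+] I) (# 2 [*] Y [+] J) I J) (coords ∘ᵛ g) refl (vec A B C D)) (∘ᵛ-$ coords g (vec A B C D)))
      where
      -- The variables X, Y, I, J stand for A, B, C, D here. Solving `coords` for the first two
      -- facet coordinates needs no division, so the change of basis is unimodular.
      x y : Poly 5
      x = J [-] I [+] Y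
      y = X [+] Y [-] M [*] x [-] N [*] I
      g = vecᴾ x y (I [-] M [*] y) (Y [-] y)

    private
      ½-+ : ∀ x y → ½ * ℤ→ℚ (x ℤ.+ y) ≡ ½ * ℤ→ℚ x + ½ * ℤ→ℚ y
      ½-+ x y = trans (cong (½ *_) (ℤ→ℚ-+ x y)) (ℚ.*-distribˡ-+ ½ (ℤ→ℚ x) (ℤ→ℚ y))

      ½-* : ∀ k x → ½ * ℤ→ℚ (k ℤ.* x) ≡ ℤ→ℚ k * (½ * ℤ→ℚ x)
      ½-* k y = trans (cong (½ *_) (ℤ→ℚ-* k y)) (solveℚ 3 (λ h k y → h :* (k :* y) := k :* (h :* y)) refl ½ (ℤ→ℚ k) (ℤ→ℚ y))

      halfᵛ-+ : ∀ u v → halfᵛ (u +ᵛ v) ≡ halfᵛ u ⊞ halfᵛ v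
      halfᵛ-+ (vec x y z w) (vec x′ y′ z′ w′) = ⟨⟩-cong (½-+ x x′) (½-+ y y′) (½-+ z z′) (½-+ w w′)

      halfᵛ-• : ∀ k v → halfᵛ (k • v) ≡ ⟨ ℤ→ℚ k , 0ℚ , 0ℚ , 0ℚ ⟩ · halfᵛ v
      halfᵛ-• k v@(vec x y z w) = trans (⟨⟩-cong (½-* k x) (½-* k y) (½-* k z) (½-* k w)) (sym (rational-· (ℤ→ℚ k) (halfᵛ v)))

    ι-+ : ∀ v w → ι (v +ᵛ w) ≡ ι v ⊞ ι w
    ι-+ v w = trans (cong halfᵛ (additive coords refl v w)) (halfᵛ-+ (coords $ v) (coords $ w))

    ι-• : ∀ k v → ι (k • v) ≡ ⟨ ℤ→ℚ k , 0ℚ , 0ℚ , 0ℚ ⟩ · ι v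
    ι-• k v@(vec X Y I J) = trans (cong halfᵛ (homogeneous k X Y I J)) (halfᵛ-• k (coords $ v))
      where
      homogeneous : ∀ k X Y I J → coords $ (k • vec X Y I J) ≡ k • (coords $ vec X Y I J)
      homogeneous k X Y I J = proveᵛ (coords [ e₀ ∷ e₁ [*] e₂ ∷ e₁ [*] e₃ ∷ e₁ [*] e₄ ∷ e₁ [*] e₅ ∷ [] ]ᵛ) (e₁ •ᴾ coords [ e₀ ∷ e₂ ∷ e₃ ∷ e₄ ∷ e₅ ∷ [] ]ᵛ) (ν ∷ k ∷ X ∷ Y ∷ I ∷ J ∷ []) refl
        where
        e₀ e₁ e₂ e₃ e₄ e₅ : Poly 6
        e₀ = var (fin 0)
        e₁ = var (fin 1)
        e₂ = var (fin 2)
        e₃ = var (fin 3)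
        e₄ = var (fin 4)
        e₅ = var (fin 5)

    record TP (v : V) : Set where
      constructor tp
      field totallyPositive : TotallyPositive (ι v)

    TP-+ : ∀ {v w} → TP v → TP w → TP (v +ᵛ w)
    TP-+ {v} {w} (tp p) (tp p′) = tp (subst TotallyPositive (sym (ι-+ v w)) (totPos-⊕ p p′))

    totPos-rational : ∀ {u} → 0ℚ < u → TotallyPositive ⟨ u , 0ℚ , 0ℚ , 0ℚ ⟩
    totPos-rational {u} p = totPos-p p (subst (0ℚ <_) (solveℚ 2 (λ P u → u :* u := u :* u :- P :* (κ 0 :* κ 0)) refl P u) (0<-* p p))

    TP-• : ∀ {k v} → + 0 ℤ.< k → TP v → TP (k • v)
    TP-• {k} {v} k>0 (tp p) = tp (subst TotallyPositive (sym (ι-• k v)) (totPos-· (totPos-rational (ℤ→ℚ-mono-< k>0)) p))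

    TP-•⁻¹ : ∀ {k v} → + 0 ℤ.< k → TP (k • v) → TP v
    TP-•⁻¹ {k} {v} k>0 (tp p) = tp (subst TotallyPositive eq (totPos-· (totPos-rational 1/k>0) p))
      where
      k′ = ℤ→ℚ k
      k′>0 : 0ℚ < k′
      k′>0 = ℤ→ℚ-mono-< k>0
      instance k≠0 : ℚ.NonZero k′
      k≠0 = ℚ.>-nonZero k′>0
      1/k = ℚ.1/ k′
      1/k>0 : 0ℚ < 1/k
      1/k>0 = OrderedRing.pos-cancelˡ ℚ-ordered k′>0 (subst (0ℚ <_) (sym (ℚ.*-inverseʳ k′)) (ℤ→ℚ-mono-< {+ 0} {+ 1} (ℤ.+<+ (s≤s z≤n))))
      cancel : ∀ x → 1/k * (k′ * x) ≡ x
      cancel x = trans (sym (ℚ.*-assoc 1/k k′ x)) (trans (cong (_* x) (ℚ.*-inverseˡ k′)) (ℚ.*-identityˡ x))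
      eq : ⟨ 1/k , 0ℚ , 0ℚ , 0ℚ ⟩ · ι (k • v) ≡ ι v
      eq = trans (cong (⟨ 1/k , 0ℚ , 0ℚ , 0ℚ ⟩ ·_) (trans (ι-• k v) (rational-· k′ (ι v))))
        (trans (rational-· 1/k ⟨ k′ * a (ι v) , k′ * b (ι v) , k′ * c (ι v) , k′ * d (ι v) ⟩) (⟨⟩-cong (cancel (a (ι v))) (cancel (b (ι v))) (cancel (c (ι v))) (cancel (d (ι v)))))

    σ-half : ∀ s t v → σ n s t (halfᵛ v) ≡ halfᵛ (conj s t v)
    σ-half s t (vec x y z w) = go s t
      where
      neg-half : ∀ z → - (½ * ℤ→ℚ z) ≡ ½ * ℤ→ℚ (ℤ.- z)
      neg-half z = trans (ℚ.neg-distribʳ-* ½ (ℤ→ℚ z)) (cong (½ *_) (sym (ℤ→ℚ-neg z)))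
      go : ∀ s t → σ n s t (half x y z w) ≡ halfᵛ (conj s t (vec x y z w))
      go true  true  = refl
      go true  false = ⟨⟩-cong refl refl (neg-half z) (neg-half w)
      go false true  = ⟨⟩-cong refl (neg-half y) refl (neg-half w)
      go false false = ⟨⟩-cong refl (neg-half y) (neg-half z) (trans (cong -_ (neg-half w)) (neg-half (ℤ.- w)))

    _×ᵛ_ : V → V → V
    _×ᵛ_ (vec s₀ s₁ s₂ s₃) (vec t₀ t₁ t₂ t₃) =
      ⟦ timesᴾ (var (fin 0)) (vecᴾ (var (fin 1)) (var (fin 2)) (var (fin 3)) (var (fin 4))) (vecᴾ (var (fin 5)) (var (fin 6)) (var (fin 7)) (var (fin 8))) ⟧ᵛ
        (ν ∷ s₀ ∷ s₁ ∷ s₂ ∷ s₃ ∷ t₀ ∷ t₁ ∷ t₂ ∷ t₃ ∷ [])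

    private
      ratᵛ : V → K
      ratᵛ (vec x y z w) = ⟨ ℤ→ℚ x , ℤ→ℚ y , ℤ→ℚ z , ℤ→ℚ w ⟩

      ratᵛ-· : ∀ u v → ratᵛ u · ratᵛ v ≡ ratᵛ (u ×ᵛ v)
      ratᵛ-· u@(vec s₀ s₁ s₂ s₃) v@(vec t₀ t₁ t₂ t₃) = trans
          (replace (ratᵛ u) (ratᵛ v) (trans M₁≡ (ℤ→ℚ-poly (# 2 [*] v₀ [-] # 1) (ν ∷ []))) (trans M₂≡ (ℤ→ℚ-poly (# 2 [*] v₀ [+] # 1) (ν ∷ []))) (trans M₃≡ (ℤ→ℚ-poly (# 2 [*] v₀ [+] # 3) (ν ∷ []))) P≡ Q≡ R≡)
          (sym (⟨⟩-cong (ℤ→ℚ-poly (Vᴾ.x₀ e) ρ) (ℤ→ℚ-poly (Vᴾ.x₁ e) ρ) (ℤ→ℚ-poly (Vᴾ.x₂ e) ρ) (ℤ→ℚ-poly (Vᴾ.x₃ e) ρ)))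
        where
        e = timesᴾ (var (fin 0)) (vecᴾ (var (fin 1)) (var (fin 2)) (var (fin 3)) (var (fin 4))) (vecᴾ (var (fin 5)) (var (fin 6)) (var (fin 7)) (var (fin 8)))
        ρ = ν ∷ s₀ ∷ s₁ ∷ s₂ ∷ s₃ ∷ t₀ ∷ t₁ ∷ t₂ ∷ t₃ ∷ []
        replace : ∀ {M₁ M₂ M₃ P Q R μ₁ μ₂ μ₃} x y → M₁ ≡ μ₁ → M₂ ≡ μ₂ → M₃ ≡ μ₃ → P ≡ M₁ * M₂ → Q ≡ M₁ * M₃ → R ≡ M₂ * M₃
          → mul M₁ M₂ M₃ P Q R x y ≡ mul μ₁ μ₂ μ₃ (μ₁ * μ₂) (μ₁ * μ₃) (μ₂ * μ₃) x y
        replace _ _ refl refl refl refl refl refl = refl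

      quarter : ∀ w → ½ * (½ * ℤ→ℚ (+ 2 ℤ.* w)) ≡ ½ * ℤ→ℚ w
      quarter w = cong (½ *_) (trans (cong (½ *_) (trans (cong ℤ→ℚ (solveℤ 1 (λ w → # 2 [*] w [=] w [+] w) refl w)) (ℤ→ℚ-+ w w))) (sym (½-double (ℤ→ℚ w))))

    -- Doubled coordinates keep everything in ℤ. A product of halves is a quarter, whence the factor
    -- 2 in the hypothesis.
    half-· : ∀ u v w → + 2 • w ≡ u ×ᵛ v → halfᵛ u · halfᵛ v ≡ halfᵛ w
    half-· u@(vec s₀ s₁ s₂ s₃) v@(vec t₀ t₁ t₂ t₃) (vec w₀ w₁ w₂ w₃) eq = trans
      (solveᴷ 15 (λ h M₁ M₂ M₃ P Q R s₀ s₁ s₂ s₃ t₀ t₁ t₂ t₃ →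
          let s = quad s₀ s₁ s₂ s₃ ; t = quad t₀ t₁ t₂ t₃ ; _·′_ = mulᴾ M₁ M₂ M₃ P Q R in
          scalarᴾ h s ·′ scalarᴾ h t , scalarᴾ h (scalarᴾ h (s ·′ t)))
        refl (½ ∷ M₁ ∷ M₂ ∷ M₃ ∷ P ∷ Q ∷ R ∷ ℤ→ℚ s₀ ∷ ℤ→ℚ s₁ ∷ ℤ→ℚ s₂ ∷ ℤ→ℚ s₃ ∷ ℤ→ℚ t₀ ∷ ℤ→ℚ t₁ ∷ ℤ→ℚ t₂ ∷ ℤ→ℚ t₃ ∷ []))
      (trans (cong (λ { ⟨ x , y , z , w ⟩ → ⟨ ½ * (½ * x) , ½ * (½ * y) , ½ * (½ * z) , ½ * (½ * w) ⟩ }) (trans (ratᵛ-· u v) (cong ratᵛ (sym eq))))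
        (⟨⟩-cong (quarter w₀) (quarter w₁) (quarter w₂) (quarter w₃)))

    private
      0<½ : 0ℚ < ½
      0<½ = ℚ.positive⁻¹ ½

      half-norm : ∀ {M} μ → M ≡ ℤ→ℚ μ → ∀ u₀ u₁ → + 0 ℤ.< u₀ ℤ.* u₀ ℤ.- μ ℤ.* (u₁ ℤ.* u₁) → 0ℚ < (½ * ℤ→ℚ u₀) * (½ * ℤ→ℚ u₀) - M * ((½ * ℤ→ℚ u₁) * (½ * ℤ→ℚ u₁))
      half-norm μ refl u₀ u₁ N>0 = subst (0ℚ <_) (solveℚ 4 (λ h M x y → (h :* h) :* (x :* x :- M :* (y :* y)) := (h :* x) :* (h :* x) :- M :* ((h :* y) :* (h :* y))) refl ½ (ℤ→ℚ μ) (ℤ→ℚ u₀) (ℤ→ℚ u₁))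
        (0<-* (0<-* 0<½ 0<½) (subst (0ℚ <_) (ℤ→ℚ-poly (v₀ [*] v₀ [-] v₁ [*] (v₂ [*] v₂)) (u₀ ∷ μ ∷ u₁ ∷ [])) (ℤ→ℚ-mono-< N>0)))

      half-pos : ∀ {u} → + 0 ℤ.< u → 0ℚ < ½ * ℤ→ℚ u
      half-pos u>0 = 0<-* 0<½ (ℤ→ℚ-mono-< u>0)

    half-totPos-p : ∀ u₀ u₁ → + 0 ℤ.< u₀ → + 0 ℤ.< u₀ ℤ.* u₀ ℤ.- p ℤ.* (u₁ ℤ.* u₁) → TotallyPositive (half u₀ u₁ (+ 0) (+ 0))
    half-totPos-p u₀ u₁ h N = totPos-p (half-pos h) (half-norm p P≡ℤ u₀ u₁ N)

    half-totPos-q : ∀ u₀ u₁ → + 0 ℤ.< u₀ → + 0 ℤ.< u₀ ℤ.* u₀ ℤ.- q ℤ.* (u₁ ℤ.* u₁) → TotallyPositive (half u₀ (+ 0) u₁ (+ 0))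
    half-totPos-q u₀ u₁ h N = totPos-q (half-pos h) (half-norm q Q≡ℤ u₀ u₁ N)

    half-totPos-r : ∀ u₀ u₁ → + 0 ℤ.< u₀ → + 0 ℤ.< u₀ ℤ.* u₀ ℤ.- r ℤ.* (u₁ ℤ.* u₁) → TotallyPositive (half u₀ (+ 0) (+ 0) u₁)
    half-totPos-r u₀ u₁ h N = totPos-r (half-pos h) (half-norm r R≡ℤ u₀ u₁ N)

    private
      pos-by : ∀ {x} k → x ≡ + suc k → + 0 ℤ.< x
      pos-by k refl = ℤ.+<+ (s≤s z≤n)

      2l>0 : + 0 ℤ.< + 2 ℤ.* l
      2l>0 = positive {0ᵛ} (# 2 [*] L) (by (2 ⊙ l≥12 ∔ lit 23) refl)
      2l+4>0 : + 0 ℤ.< + 2 ℤ.* l ℤ.+ + 4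
      2l+4>0 = positive {0ᵛ} (# 2 [*] L [+] # 4) (by (2 ⊙ l≥12 ∔ lit 27) refl)
      m>0 : + 0 ℤ.< m
      m>0 = positive {0ᵛ} M (by (l≥12 ∔ lit 12) refl)

    one-totPos : TotallyPositive (half (+ 2) (+ 0) (+ 0) (+ 0))
    one-totPos = half-totPos-p (+ 2) (+ 0) (ℤ.+<+ (s≤s z≤n)) (pos-by 3 (solveℤ 1 (λ p → # 2 [*] # 2 [-] p [*] (# 0 [*] # 0) [=] # 4) refl p))

    -- ε_p = 2n + √p has norm 1; in doubled coordinates this is 4, the successor of the 3 given to
    -- `pos-by`. The same holds for ε_q = (m₂ + √q)/2, its inverse and ε_r = 2n + 2 + √r.
    ε-p-totPos : TotallyPositive (half (+ 2 ℤ.* l) (+ 2) (+ 0) (+ 0))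
    ε-p-totPos = half-totPos-p (+ 2 ℤ.* l) (+ 2) 2l>0 (pos-by 3 (solveℤ 1 (λ nu → let l = # 2 [*] nu in
      # 2 [*] l [*] (# 2 [*] l) [-] ((l [-] # 1) [*] (l [+] # 1)) [*] (# 2 [*] # 2) [=] # 4) refl ν))

    ε-q-totPos : TotallyPositive (half m (+ 0) (+ 1) (+ 0))
    ε-q-totPos = half-totPos-q m (+ 1) m>0 (pos-by 3 (solveℤ 1 (λ nu → let l = # 2 [*] nu in
      (l [+] # 1) [*] (l [+] # 1) [-] ((l [-] # 1) [*] (l [+] # 3)) [*] (# 1 [*] # 1) [=] # 4) refl ν))

    ε-q⁻¹-totPos : TotallyPositive (half m (+ 0) (ℤ.- + 1) (+ 0))
    ε-q⁻¹-totPos = half-totPos-q m (ℤ.- + 1) m>0 (pos-by 3 (solveℤ 1 (λ nu → let l = # 2 [*] nu in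
      (l [+] # 1) [*] (l [+] # 1) [-] ((l [-] # 1) [*] (l [+] # 3)) [*] (# 1 [*] # 1) [=] # 4) refl ν))

    ε-r-totPos : TotallyPositive (half (+ 2 ℤ.* l ℤ.+ + 4) (+ 0) (+ 0) (+ 2))
    ε-r-totPos = half-totPos-r (+ 2 ℤ.* l ℤ.+ + 4) (+ 2) 2l+4>0 (pos-by 3 (solveℤ 1 (λ nu → let l = # 2 [*] nu in
      (# 2 [*] l [+] # 4) [*] (# 2 [*] l [+] # 4) [-] ((l [+] # 1) [*] (l [+] # 3)) [*] (# 2 [*] # 2) [=] # 4) refl ν))

    -- In each instance u·σ(u) = 1, so the map is an involution and carries a decomposition of an
    -- image back by itself.
    record Symmetry : Set where
      field
        f : Vᴾ 5
        {u} : K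
        s t : Bool
        unit-totPos : TotallyPositive u
        law : ∀ v → ι (f $ v) ≡ u · σ n s t (ι v)
        involutive : ∀ v → f $ (f $ v) ≡ v
        f-additive : ∀ v w → f $ (v +ᵛ w) ≡ f $ v +ᵛ f $ w

    symmetry : ∀ f s t u → TotallyPositive (halfᵛ (⟦ u ⟧ᵛ (ν ∷ [])))
      → (∀ {ρ} → ⟦ # 2 •ᴾ coords ∘ᵛ f ⟧ᵛ↓ ρ ≡ ⟦ timesᴾ N (u [ N ∷ [] ]ᵛ) (conjᴾ s t coords) ⟧ᵛ↓ ρ)
      → (∀ {ρ} → ⟦ f ∘ᵛ f ⟧ᵛ↓ ρ ≡ ⟦ id ⟧ᵛ↓ ρ) → Additive f → Symmetry
    symmetry f s t u u-totPos law involution add = record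
      { f = f ; s = s ; t = t ; unit-totPos = u-totPos
      ; law = λ v → sym (trans (cong (halfᵛ (⟦ u ⟧ᵛ (ν ∷ [])) ·_) (σ-half s t (coords $ v)))
          (half-· (⟦ u ⟧ᵛ (ν ∷ [])) (conj s t (coords $ v)) (coords $ (f $ v))
            (trans (cong (+ 2 •_) (sym (∘ᵛ-$ coords f v))) (trans (identity (# 2 •ᴾ coords ∘ᵛ f) (timesᴾ N (u [ N ∷ [] ]ᵛ) (conjᴾ s t coords)) law v)
              (cong₂ _×ᵛ_ (substitutionᵛ u (N ∷ []) (env v)) (⟦conjᴾ⟧ s t coords (env v)))))))
      ; involutive = λ v → trans (sym (∘ᵛ-$ f f v)) (identity (f ∘ᵛ f) id involution v)
      ; f-additive = additive f add }

    private
      l′ m′ : Poly 1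
      l′ = # 2 [*] var (fin 0)
      m′ = l′ [+] # 1


    -- Matrices of x ↦ uσ(x) for the pairs (u, σ) listed with the symmetries below. `turn` followed
    -- by `swap` is `negate`. `reflect₁` and `reflect₄` bring the facets beyond `c₁⁻` and `c₄⁻` back
    -- to the hexagon facet; `simplex₂` and `simplex₁` do so for the facets beyond the walls τ₁ and
    -- τ₄ of the simplex.
    turn reflect₁ reflect₄ simplex₁ simplex₂ : Vᴾ 5
    turn = vecᴾ Y X (I [-] M [*] J) ([-] J)
    reflect₁ = vecᴾ (L [*] Y [+] I [-] J) (L [*] X [-] I [+] L [*] J) (L [*] I [-] M [*] L [*] X [-] M [*] Y [-] M [*] L [*] J) (# 0 [-] M [*] X [-] M [*] Y [-] L [*] J)
    reflect₄ = vecᴾ (L [*] X [+] M [*] L [*] Y [+] L [*] I [-] J) (J [-] L [*] Y [-] I) (# 0 [-] M [*] X [-] M [*] Y [-] L [*] J) (# 0 [-] M [*] X [-] M [*] L [*] Y [-] L [*] I)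
    simplex₁ = vecᴾ ((M [+] # 1) [*] X [+] I [-] (M [+] # 1) [*] J) ((M [+] # 1) [*] Y [+] I [+] J) (# 0 [-] M [*] X [-] M [*] (M [+] # 1) [*] Y [-] (M [+] # 1) [*] I) (M [*] X [-] M [*] Y [-] (M [+] # 1) [*] J)
    simplex₂ = vecᴾ ((M [+] # 1) [*] J [-] (M [+] # 1) [*] X [-] I) (M [*] (M [+] # 1) [*] X [+] (M [+] # 1) [*] Y [+] (M [+] # 1) [*] I [+] (# 1 [-] M [*] (M [+] # 1)) [*] J) (M [*] X [-] M [*] M [*] (M [+] # 1) [*] X [-] M [*] (M [+] # 1) [*] Y [-] M [*] (M [+] # 1) [*] I [+] (M [+] # 1) [*] (M [*] M [-] # 1) [*] J) (M [*] (M [+] # 1) [*] J [-] M [*] (M [+] # 1) [*] X [-] M [*] Y [-] (M [+] # 1) [*] I)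

    swapˢ turnˢ reflect₁ˢ reflect₄ˢ simplex₁ˢ simplex₂ˢ : Symmetry
    swapˢ = symmetry swap true false (vecᴾ (# 2 [*] l′ [+] # 4) (# 0) (# 0) (# 2)) ε-r-totPos refl refl refl
    turnˢ = symmetry turn false false (vecᴾ (# 2 [*] l′) (# 2) (# 0) (# 0)) ε-p-totPos refl refl refl
    reflect₁ˢ = symmetry reflect₁ false false (vecᴾ (# 2) (# 0) (# 0) (# 0)) one-totPos refl refl refl
    reflect₄ˢ = symmetry reflect₄ false false (vecᴾ m′ (# 0) ([-] # 1) (# 0)) ε-q⁻¹-totPos refl refl refl
    simplex₁ˢ = symmetry simplex₁ false true (vecᴾ (# 2 [*] l′) (# 2) (# 0) (# 0)) ε-p-totPos refl refl refl
    simplex₂ˢ = symmetry simplex₂ true false (vecᴾ m′ (# 0) (# 1) (# 0)) ε-q-totPos refl refl refl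

-- The two codifferent elements and their traces.

module CodifferentElements where
  open RingSolving
  open OrderedRings
  open Rationals
  open Multiplication
  open FieldOrder
  open Integrality
  open AlgebraicIntegers
  open LatticeCoordinates
  open Certificates
  open HexagonCone
  open import Data.Rational using (_+_; _*_; -_; _-_; _<_)

  module Facets (S : Setting) where
    open Setting S
    open Biquadratic S
    open Integers S
    open Lattice S
    private
      module KR = CommutativeRing K-commutativeRing

    Codifferent : K → Set
    Codifferent δ = ∀ v → Integral (Tr n (ι v · δ))

    Decomposable : V → Set
    Decomposable v = ∃[ w ] ∃[ w′ ] (TP w × TP w′ × v ≡ w +ᵛ w′)

    Short : V → Set
    Short v = ∃[ δ ] (Codifferent δ × TotallyPositive δ × Tr n (ι v · δ) ℚ.≤ ℕ→ℚ 2)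

    Good : V → Set
    Good v = Decomposable v ⊎ Short v

    private
      neg-neg : ∀ u → - (- u) ≡ u
      neg-neg = solveℚ 1 (λ u → :- (:- u) := u) refl

    σ-involutive : ∀ s t x → σ n s t (σ n s t x) ≡ x
    σ-involutive true  true  x = refl
    σ-involutive true  false x = ⟨⟩-cong refl refl (neg-neg (c x)) (neg-neg (d x))
    σ-involutive false true  x = ⟨⟩-cong refl (neg-neg (b x)) refl (neg-neg (d x))
    σ-involutive false false x = ⟨⟩-cong refl (neg-neg (b x)) (neg-neg (c x)) (trans (neg-neg (- (- d x))) (neg-neg (d x)))

    module _ (g : Symmetry) where
      open Symmetry g

      TP-symmetry : ∀ {v} → TP v → TP (f $ v)
      TP-symmetry {v} (tp p) = tp (subst TotallyPositive (sym (law v)) (totPos-· unit-totPos (totPos-σ s t p)))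

      private
        adjoint : K → K
        adjoint δ = σ n s t (u · δ)

        σ-adjoint : ∀ v δ → σ n s t (ι v · adjoint δ) ≡ ι (f $ v) · δ
        σ-adjoint v δ = trans (σ-· s t (ι v) (adjoint δ)) (trans (cong (y ·_) (σ-involutive s t (u · δ)))
          (trans (sym (KR.*-assoc y u δ)) (trans (cong (_· δ) (KR.*-comm y u)) (cong (_· δ) (sym (law v))))))
          where y = σ n s t (ι v)

        trace-adjoint : ∀ v δ → Tr n (ι v · adjoint δ) ≡ Tr n (ι (f $ v) · δ)
        -- σ fixes the rational coordinate, so the trace of a conjugate is the same by computation.
        trace-adjoint v δ = cong (Tr n) (σ-adjoint v δ)

      -- A decomposition returns through the involution. A functional returns through its adjoint
      -- σ(uδ), because Tr(x·σ(uδ)) = Tr(uσ(x)·δ).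
      good-symmetry : ∀ {v} → Good (f $ v) → Good v
      good-symmetry {v} (inj₁ (w , w′ , p , p′ , eq)) = inj₁ (f $ w , f $ w′ , TP-symmetry p , TP-symmetry p′ ,
        trans (sym (involutive v)) (trans (cong (f $_) eq) (f-additive w w′)))
      good-symmetry {v} (inj₂ (δ , cod , p , le)) = inj₂ (adjoint δ ,
        (λ w → subst Integral (sym (trace-adjoint w δ)) (cod (f $ w))) ,
        totPos-σ s t (totPos-· unit-totPos p) ,
        subst (ℚ._≤ ℕ→ℚ 2) (sym (trace-adjoint v δ)) le)

    private
      1>0 : 0ℚ < 1ℚ
      1>0 = ℤ→ℚ-mono-< {+ 0} {+ 1} (ℤ.+<+ (s≤s z≤n))

      inverse : ∀ {M} → 0ℚ < M → ∃[ i ] (M * i ≡ 1ℚ × 0ℚ < i)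
      inverse {M} M>0 = (ℚ.1/ M) , ℚ.*-inverseʳ M , OrderedRing.pos-cancelˡ ℚ-ordered M>0 (subst (0ℚ <_) (sym (ℚ.*-inverseʳ M)) 1>0)
        where
        instance M≠0 : ℚ.NonZero M
        M≠0 = ℚ.>-nonZero M>0

    -- Inverses of m₂ and m₃; in K one has √(m₁/m₂) = √p/m₂, √(m₁/m₃) = √q/m₃ and √(m₂/m₃) = √r/m₃.
    i₂ i₃ : ℚ
    i₂ = proj₁ (inverse M₂>0)
    i₃ = proj₁ (inverse M₃>0)

    M₂i₂≡1 : M₂ * i₂ ≡ 1ℚ
    M₂i₂≡1 = proj₁ (proj₂ (inverse M₂>0))
    M₃i₃≡1 : M₃ * i₃ ≡ 1ℚ
    M₃i₃≡1 = proj₁ (proj₂ (inverse M₃>0))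

    private
      i₂>0 : 0ℚ < i₂
      i₂>0 = proj₂ (proj₂ (inverse M₂>0))
      i₃>0 : 0ℚ < i₃
      i₃>0 = proj₂ (proj₂ (inverse M₃>0))

      -- 1 − (MN)(1/N)² = (N − M)/N
      ratio-pos : ∀ M N {MN} i → MN ≡ M * N → N * i ≡ 1ℚ → 0ℚ < i → 0ℚ < N - M → 0ℚ < 1ℚ * 1ℚ - MN * (i * i)
      ratio-pos M N i refl Ni≡1 i>0 N-M>0 = subst (0ℚ <_) eq (0<-* N-M>0 i>0)
        where
        eq : (N - M) * i ≡ 1ℚ * 1ℚ - M * N * (i * i)
        eq = trans (solveℚ 3 (λ M N i → (N :- M) :* i := N :* i :- M :* i :* κ 1) refl M N i)
          (trans (cong₂ (λ x y → x - M * i * y) Ni≡1 (sym Ni≡1))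
            (solveℚ 3 (λ M N i → κ 1 :- M :* i :* (N :* i) := κ 1 :* κ 1 :- M :* N :* (i :* i)) refl M N i))

      difference-pos : ∀ {M N} μ η k → M ≡ ℤ→ℚ μ → N ≡ ℤ→ℚ η → η ℤ.- μ ≡ + suc k → 0ℚ < N - M
      difference-pos μ η k refl refl eq = subst (0ℚ <_) (trans (cong ℤ→ℚ (sym eq)) (ℤ→ℚ-- η μ)) (ℤ→ℚ-mono-< {+ 0} {+ suc k} (ℤ.+<+ (s≤s z≤n)))

      neg-square : ∀ M i → 0ℚ < 1ℚ * 1ℚ - M * (i * i) → 0ℚ < 1ℚ * 1ℚ - M * ((- i) * (- i))
      neg-square M i = subst (0ℚ <_) (solveℚ 2 (λ M i → κ 1 :* κ 1 :- M :* (i :* i) := κ 1 :* κ 1 :- M :* ((:- i) :* (:- i))) refl M i)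

      norm-p : 0ℚ < 1ℚ * 1ℚ - P * (i₂ * i₂)
      norm-p = ratio-pos M₁ M₂ i₂ P≡ M₂i₂≡1 i₂>0 (difference-pos (+ 2 ℤ.* ν ℤ.- + 1) (+ 2 ℤ.* ν ℤ.+ + 1) 1 M₁≡ M₂≡
        (solveℤ 1 (λ x → (x [+] # 1) [-] (x [-] # 1) [=] # 2) refl (+ 2 ℤ.* ν)))
      norm-q : 0ℚ < 1ℚ * 1ℚ - Q * (i₃ * i₃)
      norm-q = ratio-pos M₁ M₃ i₃ Q≡ M₃i₃≡1 i₃>0 (difference-pos (+ 2 ℤ.* ν ℤ.- + 1) (+ 2 ℤ.* ν ℤ.+ + 3) 3 M₁≡ M₃≡
        (solveℤ 1 (λ x → (x [+] # 3) [-] (x [-] # 1) [=] # 4) refl (+ 2 ℤ.* ν)))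
      norm-r : 0ℚ < 1ℚ * 1ℚ - R * (i₃ * i₃)
      norm-r = ratio-pos M₂ M₃ i₃ R≡ M₃i₃≡1 i₃>0 (difference-pos (+ 2 ℤ.* ν ℤ.+ + 1) (+ 2 ℤ.* ν ℤ.+ + 3) 1 M₂≡ M₃≡
        (solveℤ 1 (λ x → (x [+] # 3) [-] (x [+] # 1) [=] # 2) refl (+ 2 ℤ.* ν)))

    ¼ : ℚ
    ¼ = + 1 ℚ./ 4

    -- ¼(1 − √(m₁/m₂))(1 − √(m₁/m₃)) and ¼(1 − √(m₁/m₂))(1 − √(m₂/m₃)).
    δᴬ δᴮ : K
    δᴬ = ⟨ ¼ , 0ℚ , 0ℚ , 0ℚ ⟩ · (⟨ 1ℚ , - i₂ , 0ℚ , 0ℚ ⟩ · ⟨ 1ℚ , 0ℚ , - i₃ , 0ℚ ⟩)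
    δᴮ = ⟨ ¼ , 0ℚ , 0ℚ , 0ℚ ⟩ · (⟨ 1ℚ , - i₂ , 0ℚ , 0ℚ ⟩ · ⟨ 1ℚ , 0ℚ , 0ℚ , - i₃ ⟩)

    private
      ¼ᴷ 1-√p 1-√q 1-√r : K
      ¼ᴷ = ⟨ ¼ , 0ℚ , 0ℚ , 0ℚ ⟩
      1-√p = ⟨ 1ℚ , - i₂ , 0ℚ , 0ℚ ⟩
      1-√q = ⟨ 1ℚ , 0ℚ , - i₃ , 0ℚ ⟩
      1-√r = ⟨ 1ℚ , 0ℚ , 0ℚ , - i₃ ⟩

      ¼-totPos : TotallyPositive ¼ᴷ
      ¼-totPos = totPos-rational {¼} (ℚ.positive⁻¹ ¼)

      1-√p-totPos : TotallyPositive 1-√p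
      1-√p-totPos = totPos-p {1ℚ} { - i₂} 1>0 (neg-square P i₂ norm-p)

    1-√q-totPos : TotallyPositive ⟨ 1ℚ , 0ℚ , - i₃ , 0ℚ ⟩
    1-√q-totPos = totPos-q {1ℚ} { - i₃} 1>0 (neg-square Q i₃ norm-q)

    1+√r-totPos : TotallyPositive ⟨ 1ℚ , 0ℚ , 0ℚ , i₃ ⟩
    1+√r-totPos = totPos-r {1ℚ} {i₃} 1>0 norm-r

    private
      1-√r-totPos : TotallyPositive 1-√r
      1-√r-totPos = totPos-r {1ℚ} { - i₃} 1>0 (neg-square R i₃ norm-r)

    δᴬ-totPos : TotallyPositive δᴬ
    δᴬ-totPos = totPos-· {¼ᴷ} {1-√p · 1-√q} ¼-totPos (totPos-· {1-√p} {1-√q} 1-√p-totPos 1-√q-totPos)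

    δᴮ-totPos : TotallyPositive δᴮ
    δᴮ-totPos = totPos-· {¼ᴷ} {1-√p · 1-√r} ¼-totPos (totPos-· {1-√p} {1-√r} 1-√p-totPos 1-√r-totPos)

    -- The traces against `δᴬ` and `δᴮ` in facet coordinates. Their integer coefficients are what
    -- puts both elements into the codifferent.
    hᴬ hᴮ : Poly 5
    hᴬ = M [*] X [+] # 2 [*] Y [+] I [-] L [*] J
    hᴮ = X [+] Y

    heightᴬ heightᴮ : V → ℤ
    heightᴬ v = ⟦ hᴬ ⟧ (env v)
    heightᴮ v = ⟦ hᴮ ⟧ (env v)

    private
      -- The products m₂i₂ and m₃i₃ are kept visible, since the solver does not know that they are
      -- 1; they are replaced afterwards.
      traceᴮ : ∀ M₁ M₂ M₃ {P Q R} → P ≡ M₁ * M₂ → Q ≡ M₁ * M₃ → R ≡ M₂ * M₃ → ∀ h k i₂ i₃ x₀ x₁ x₂ x₃ → let _·′_ = mul M₁ M₂ M₃ P Q R in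
        h * a (⟨ x₀ , x₁ , x₂ , x₃ ⟩ ·′ (⟨ k , 0ℚ , 0ℚ , 0ℚ ⟩ ·′ (⟨ 1ℚ , - i₂ , 0ℚ , 0ℚ ⟩ ·′ ⟨ 1ℚ , 0ℚ , 0ℚ , - i₃ ⟩)))
        ≡ (h * k) * (x₀ - (M₂ * i₂) * (M₁ * x₁) + (M₂ * i₂) * (M₃ * i₃) * (M₁ * x₂) - (M₃ * i₃) * (M₂ * x₃))
      traceᴮ M₁ M₂ M₃ refl refl refl = solveℚ 11 (λ M₁ M₂ M₃ h k i₂ i₃ x₀ x₁ x₂ x₃ → let _·′_ = mulᴹ M₁ M₂ M₃ ; o = κ 0 in
        h :* π₀ (quad x₀ x₁ x₂ x₃ ·′ (quad k o o o ·′ (quad (κ 1) (:- i₂) o o ·′ quad (κ 1) o o (:- i₃))))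
        := (h :* k) :* (x₀ :- (M₂ :* i₂) :* (M₁ :* x₁) :+ (M₂ :* i₂) :* (M₃ :* i₃) :* (M₁ :* x₂) :- (M₃ :* i₃) :* (M₂ :* x₃))) refl M₁ M₂ M₃

      traceᴬ : ∀ M₁ M₂ M₃ {P Q R} → P ≡ M₁ * M₂ → Q ≡ M₁ * M₃ → R ≡ M₂ * M₃ → ∀ h k i₂ i₃ x₀ x₁ x₂ x₃ → let _·′_ = mul M₁ M₂ M₃ P Q R in
        h * a (⟨ x₀ , x₁ , x₂ , x₃ ⟩ ·′ (⟨ k , 0ℚ , 0ℚ , 0ℚ ⟩ ·′ (⟨ 1ℚ , - i₂ , 0ℚ , 0ℚ ⟩ ·′ ⟨ 1ℚ , 0ℚ , - i₃ , 0ℚ ⟩)))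
        ≡ (h * k) * (x₀ - (M₂ * i₂) * (M₁ * x₁) - (M₃ * i₃) * (M₁ * x₂) + (M₂ * i₂) * (M₃ * i₃) * (M₁ * x₃))
      traceᴬ M₁ M₂ M₃ refl refl refl = solveℚ 11 (λ M₁ M₂ M₃ h k i₂ i₃ x₀ x₁ x₂ x₃ → let _·′_ = mulᴹ M₁ M₂ M₃ ; o = κ 0 in
        h :* π₀ (quad x₀ x₁ x₂ x₃ ·′ (quad k o o o ·′ (quad (κ 1) (:- i₂) o o ·′ quad (κ 1) o (:- i₃) o)))
        := (h :* k) :* (x₀ :- (M₂ :* i₂) :* (M₁ :* x₁) :- (M₃ :* i₃) :* (M₁ :* x₂) :+ (M₂ :* i₂) :* (M₃ :* i₃) :* (M₁ :* x₃))) refl M₁ M₂ M₃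

      halve-twice : ∀ {x} w → x ≡ + 2 ℤ.* w → ½ * ℤ→ℚ x ≡ ℤ→ℚ w
      halve-twice w refl = trans (cong (½ *_) (trans (cong ℤ→ℚ (solveℤ 1 (λ w → # 2 [*] w [=] w [+] w) refl w)) (ℤ→ℚ-+ w w))) (sym (½-double (ℤ→ℚ w)))

      v₅ : Poly 6
      v₅ = var (fin 5)

      xᴾ yᴾ zᴾ wᴾ : Poly 5
      xᴾ = Vᴾ.x₀ coords
      yᴾ = Vᴾ.x₁ coords
      zᴾ = Vᴾ.x₂ coords
      wᴾ = Vᴾ.x₃ coords

      xc yc zc wc : V → ℤ
      xc v = ⟦ xᴾ ⟧ (env v)
      yc v = ⟦ yᴾ ⟧ (env v)
      zc v = ⟦ zᴾ ⟧ (env v)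
      wc v = ⟦ wᴾ ⟧ (env v)

    trace-δᴮ : ∀ v → Tr n (ι v · δᴮ) ≡ ℤ→ℚ (heightᴮ v)
    trace-δᴮ v = begin
      Tr n (ι v · δᴮ)
        ≡⟨ traceᴮ M₁ M₂ M₃ P≡ Q≡ R≡ (ℕ→ℚ 4) ¼ i₂ i₃ x₀ x₁ x₂ x₃ ⟩
      (ℕ→ℚ 4 * ¼) * (x₀ - (M₂ * i₂) * (M₁ * x₁) + (M₂ * i₂) * (M₃ * i₃) * (M₁ * x₂) - (M₃ * i₃) * (M₂ * x₃))
        ≡⟨ cong₂ (λ s t → 1ℚ * (x₀ - s * (M₁ * x₁) + s * t * (M₁ * x₂) - t * (M₂ * x₃))) M₂i₂≡1 M₃i₃≡1 ⟩
      1ℚ * (x₀ - 1ℚ * (M₁ * x₁) + 1ℚ * 1ℚ * (M₁ * x₂) - 1ℚ * (M₂ * x₃))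
        ≡⟨ cong₂ (λ s t → 1ℚ * (x₀ - 1ℚ * (s * x₁) + 1ℚ * 1ℚ * (s * x₂) - 1ℚ * (t * x₃))) M₁≡ M₂≡ ⟩
      1ℚ * (x₀ - 1ℚ * (μ₁ * x₁) + 1ℚ * 1ℚ * (μ₁ * x₂) - 1ℚ * (μ₂ * x₃))
        ≡⟨ solveℚ 7 (λ h μ₁ μ₂ x y z w → κ 1 :* (h :* x :- κ 1 :* (μ₁ :* (h :* y)) :+ κ 1 :* κ 1 :* (μ₁ :* (h :* z)) :- κ 1 :* (μ₂ :* (h :* w)))
             := h :* (x :- μ₁ :* y :+ μ₁ :* z :- μ₂ :* w)) refl ½ μ₁ μ₂ (ℤ→ℚ (xc v)) (ℤ→ℚ (yc v)) (ℤ→ℚ (zc v)) (ℤ→ℚ (wc v)) ⟩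
      ½ * (ℤ→ℚ (xc v) - μ₁ * ℤ→ℚ (yc v) + μ₁ * ℤ→ℚ (zc v) - μ₂ * ℤ→ℚ (wc v))
        ≡⟨ cong (½ *_) (ℤ→ℚ-poly (v₀ [-] v₄ [*] v₁ [+] v₄ [*] v₂ [-] v₅ [*] v₃) (xc v ∷ yc v ∷ zc v ∷ wc v ∷ (+ 2 ℤ.* ν ℤ.- + 1) ∷ (+ 2 ℤ.* ν ℤ.+ + 1) ∷ [])) ⟨
      ½ * ℤ→ℚ (xc v ℤ.- (+ 2 ℤ.* ν ℤ.- + 1) ℤ.* yc v ℤ.+ (+ 2 ℤ.* ν ℤ.- + 1) ℤ.* zc v ℤ.- (+ 2 ℤ.* ν ℤ.+ + 1) ℤ.* wc v)
        ≡⟨ halve-twice (heightᴮ v) (proveℤ (env v) (xᴾ [-] (L [-] # 1) [*] yᴾ [+] (L [-] # 1) [*] zᴾ [-] M [*] wᴾ) (# 2 [*] hᴮ) refl) ⟩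
      ℤ→ℚ (heightᴮ v) ∎
      where
      open ≡.≡-Reasoning
      x₀ = a (ι v)
      x₁ = b (ι v)
      x₂ = c (ι v)
      x₃ = d (ι v)
      μ₁ = ℤ→ℚ (+ 2 ℤ.* ν ℤ.- + 1)
      μ₂ = ℤ→ℚ (+ 2 ℤ.* ν ℤ.+ + 1)

    trace-δᴬ : ∀ v → Tr n (ι v · δᴬ) ≡ ℤ→ℚ (heightᴬ v)
    trace-δᴬ v = begin
      Tr n (ι v · δᴬ)
        ≡⟨ traceᴬ M₁ M₂ M₃ P≡ Q≡ R≡ (ℕ→ℚ 4) ¼ i₂ i₃ x₀ x₁ x₂ x₃ ⟩
      (ℕ→ℚ 4 * ¼) * (x₀ - (M₂ * i₂) * (M₁ * x₁) - (M₃ * i₃) * (M₁ * x₂) + (M₂ * i₂) * (M₃ * i₃) * (M₁ * x₃))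
        ≡⟨ cong₂ (λ s t → 1ℚ * (x₀ - s * (M₁ * x₁) - t * (M₁ * x₂) + s * t * (M₁ * x₃))) M₂i₂≡1 M₃i₃≡1 ⟩
      1ℚ * (x₀ - 1ℚ * (M₁ * x₁) - 1ℚ * (M₁ * x₂) + 1ℚ * 1ℚ * (M₁ * x₃))
        ≡⟨ cong (λ s → 1ℚ * (x₀ - 1ℚ * (s * x₁) - 1ℚ * (s * x₂) + 1ℚ * 1ℚ * (s * x₃))) M₁≡ ⟩
      1ℚ * (x₀ - 1ℚ * (μ₁ * x₁) - 1ℚ * (μ₁ * x₂) + 1ℚ * 1ℚ * (μ₁ * x₃))
        ≡⟨ solveℚ 6 (λ h μ₁ x y z w → κ 1 :* (h :* x :- κ 1 :* (μ₁ :* (h :* y)) :- κ 1 :* (μ₁ :* (h :* z)) :+ κ 1 :* κ 1 :* (μ₁ :* (h :* w)))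
             := h :* (x :- μ₁ :* y :- μ₁ :* z :+ μ₁ :* w)) refl ½ μ₁ (ℤ→ℚ (xc v)) (ℤ→ℚ (yc v)) (ℤ→ℚ (zc v)) (ℤ→ℚ (wc v)) ⟩
      ½ * (ℤ→ℚ (xc v) - μ₁ * ℤ→ℚ (yc v) - μ₁ * ℤ→ℚ (zc v) + μ₁ * ℤ→ℚ (wc v))
        ≡⟨ cong (½ *_) (ℤ→ℚ-poly (v₀ [-] v₄ [*] v₁ [-] v₄ [*] v₂ [+] v₄ [*] v₃) (xc v ∷ yc v ∷ zc v ∷ wc v ∷ (+ 2 ℤ.* ν ℤ.- + 1) ∷ [])) ⟨
      ½ * ℤ→ℚ (xc v ℤ.- (+ 2 ℤ.* ν ℤ.- + 1) ℤ.* yc v ℤ.- (+ 2 ℤ.* ν ℤ.- + 1) ℤ.* zc v ℤ.+ (+ 2 ℤ.* ν ℤ.- + 1) ℤ.* wc v)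
        ≡⟨ halve-twice (heightᴬ v) (proveℤ (env v) (xᴾ [-] (L [-] # 1) [*] yᴾ [-] (L [-] # 1) [*] zᴾ [+] (L [-] # 1) [*] wᴾ) (# 2 [*] hᴬ) refl) ⟩
      ℤ→ℚ (heightᴬ v) ∎
      where
      open ≡.≡-Reasoning
      x₀ = a (ι v)
      x₁ = b (ι v)
      x₂ = c (ι v)
      x₃ = d (ι v)
      μ₁ = ℤ→ℚ (+ 2 ℤ.* ν ℤ.- + 1)

    private
      height-pos : ∀ {v} δ h → TotallyPositive δ → Tr n (ι v · δ) ≡ ℤ→ℚ h → TP v → + 0 ℤ.< h
      height-pos δ h p eq (tp q) = ℤ→ℚ-cancel-< {+ 0} (subst (0ℚ <_) eq (0<-* (ℤ→ℚ-mono-< {+ 0} {+ 4} (ℤ.+<+ (s≤s z≤n))) (totPos⇒0<a (totPos-· q p))))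

    heightᴬ-pos : ∀ {v} → TP v → + 0 ℤ.< heightᴬ v
    heightᴬ-pos {v} = height-pos {v} δᴬ (heightᴬ v) δᴬ-totPos (trace-δᴬ v)

    heightᴮ-pos : ∀ {v} → TP v → + 0 ℤ.< heightᴮ v
    heightᴮ-pos {v} = height-pos {v} δᴮ (heightᴮ v) δᴮ-totPos (trace-δᴮ v)

    shortᴬ : ∀ {v} → heightᴬ v ℤ.≤ + 2 → Short v
    shortᴬ {v} le = δᴬ , (λ w → heightᴬ w , trace-δᴬ w) , δᴬ-totPos , subst (ℚ._≤ ℕ→ℚ 2) (sym (trace-δᴬ v)) (ℤ→ℚ-mono-≤ le)

    shortᴮ : ∀ {v} → heightᴮ v ℤ.≤ + 2 → Short v
    shortᴮ {v} le = δᴮ , (λ w → heightᴮ w , trace-δᴮ w) , δᴮ-totPos , subst (ℚ._≤ ℕ→ℚ 2) (sym (trace-δᴮ v)) (ℤ→ℚ-mono-≤ le)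

-- Total positivity of the vertices and of the hexagon cone.

module FacetCones where
  open RingSolving
  open OrderedRings
  open Rationals
  open Multiplication
  open FieldOrder
  open Integrality
  open AlgebraicIntegers
  open LatticeCoordinates
  open Certificates
  open HexagonCone
  open CodifferentElements
  open import Data.Rational using (_+_; _*_; -_; _-_; _<_)

  module Cones (S : Setting) where
    open Setting S
    open Biquadratic S
    open Integers S
    open Lattice S
    open Facets S

    TP-negate : ∀ {v} → TP v → TP (negate $ v)
    TP-negate {v} p = subst TP (identity (swap ∘ᵛ turn) negate refl v) (TP-symmetry swapˢ (TP-symmetry turnˢ p))

    -- Superscript 0 marks the second hexagon, of which `𝟙` is the vertex -(l+1,1). The simplex has
    -- the vertices `𝟙`, `b⁺` = ε_p, `a⁰⁻` = ε_p ε_q, all on the hexagon facet, and `ε-q`, which has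
    -- X = -1 and lies outside its cone.
    b⁻ b⁺ b⁰⁺ a⁺ a⁰⁺ a⁰⁻ d⁺ d⁻ d⁰⁻ 𝟙 ε-q : Vᴾ 5
    b⁻ = vecᴾ (# 1) (# 0) (# 0) ([-] # 1)
    b⁺ = vecᴾ (# 1) (# 0) (# 0) (# 1)
    b⁰⁺ = vecᴾ (# 0) (# 1) M (# 1)
    a⁺ = vecᴾ (# 1) (# 0) (# 1) (# 0)
    a⁰⁺ = vecᴾ (# 0) (# 1) (# 1) (# 0)
    a⁰⁻ = vecᴾ (# 0) (# 1) ([-] # 1) (# 0)
    d⁺ = vecᴾ (# 1) (# 0) (# 1) (# 1)
    d⁻ = vecᴾ (# 1) (# 0) ([-] # 1) ([-] # 1)
    d⁰⁻ = vecᴾ (# 0) (# 1) ([-] L) ([-] # 1)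
    𝟙 = vecᴾ (# 0) (# 1) ([-] M) ([-] # 1)
    ε-q = vecᴾ ([-] # 1) M (# 1 [-] M [*] M) ([-] M)

    private
      units : (x y z : Poly 5) → Vᴾ 5
      units x y z = vecᴾ x y z (# 0)

    TP-b⁺ : ∀ v → TP (b⁺ $ v)
    TP-b⁺ v = tp (subst TotallyPositive (cong halfᵛ (identity (units (# 2 [*] L) (# 2) (# 0)) (coords ∘ᵛ b⁺) refl v)) ε-p-totPos)

    TP-𝟙 : ∀ v → TP (𝟙 $ v)
    TP-𝟙 v = tp (subst TotallyPositive (cong halfᵛ (identity (units (# 2) (# 0) (# 0)) (coords ∘ᵛ 𝟙) refl v)) one-totPos)

    TP-ε-q : ∀ v → TP (ε-q $ v)
    TP-ε-q v = tp (subst TotallyPositive (cong halfᵛ (identity (units M (# 0) (# 1)) (coords ∘ᵛ ε-q) refl v)) ε-q-totPos)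

    TP-a⁰⁻ : ∀ v → TP (a⁰⁻ $ v)
    TP-a⁰⁻ v = tp (subst TotallyPositive
        (half-· (ε-p′ $ v) (ε-q′ $ v) (coords ∘ᵛ a⁰⁻ $ v) (identity (# 2 •ᴾ (coords ∘ᵛ a⁰⁻)) (timesᴾ N ε-p′ ε-q′) refl v))
        (totPos-· {halfᵛ (ε-p′ $ v)} {halfᵛ (ε-q′ $ v)} ε-p-totPos ε-q-totPos))
      where
      ε-p′ ε-q′ : Vᴾ 5
      ε-p′ = units (# 2 [*] L) (# 2) (# 0)
      ε-q′ = units M (# 0) (# 1)

    private
      product : ∀ M₁ M₂ M₃ {P Q R} → P ≡ M₁ * M₂ → Q ≡ M₁ * M₃ → R ≡ M₂ * M₃ → ∀ h i → let _·′_ = mul M₁ M₂ M₃ P Q R in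
        ⟨ h * M₃ , 0ℚ , 0ℚ , 0ℚ ⟩ ·′ (⟨ 1ℚ , 0ℚ , - i , 0ℚ ⟩ ·′ ⟨ 1ℚ , 0ℚ , 0ℚ , i ⟩)
        ≡ ⟨ h * M₃ , h * (- ((M₃ * i) * (M₃ * i))) , h * (- (M₃ * i)) , h * (M₃ * i) ⟩
      product M₁ M₂ M₃ refl refl refl h i = solveᴷ 5 (λ M₁ M₂ M₃ h i → let _·′_ = mulᴹ M₁ M₂ M₃ ; o = κ 0 ; e = κ 1 ; z = M₃ :* i in
        quad (h :* M₃) o o o ·′ (quad e o (:- i) o ·′ quad e o o i) , quad (h :* M₃) (h :* (:- (z :* z))) (h :* (:- z)) (h :* z))
        refl (M₁ ∷ M₂ ∷ M₃ ∷ h ∷ i ∷ [])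

    -- (m₃ − √p − √q + √r)/2 = (m₃/2)(1 − √(m₁/m₃))(1 + √(m₂/m₃))
    TP-d⁻ : ∀ v → TP (d⁻ $ v)
    TP-d⁻ v = tp (subst TotallyPositive eq (totPos-· {⟨ ½ * M₃ , 0ℚ , 0ℚ , 0ℚ ⟩} {⟨ 1ℚ , 0ℚ , - i₃ , 0ℚ ⟩ · ⟨ 1ℚ , 0ℚ , 0ℚ , i₃ ⟩}
        (totPos-rational (0<-* (ℚ.positive⁻¹ ½) M₃>0)) (totPos-· {⟨ 1ℚ , 0ℚ , - i₃ , 0ℚ ⟩} {⟨ 1ℚ , 0ℚ , 0ℚ , i₃ ⟩} 1-√q-totPos 1+√r-totPos)))
      where
      eq : ⟨ ½ * M₃ , 0ℚ , 0ℚ , 0ℚ ⟩ · (⟨ 1ℚ , 0ℚ , - i₃ , 0ℚ ⟩ · ⟨ 1ℚ , 0ℚ , 0ℚ , i₃ ⟩) ≡ ι (d⁻ $ v)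
      eq = trans (product M₁ M₂ M₃ P≡ Q≡ R≡ ½ i₃) (trans
        (cong (λ z → ⟨ ½ * M₃ , ½ * (- (z * z)) , ½ * (- z) , ½ * z ⟩) M₃i₃≡1)
        (trans (cong (λ z → ⟨ ½ * z , ½ * (- (1ℚ * 1ℚ)) , ½ * (- 1ℚ) , ½ * 1ℚ ⟩) M₃≡)
          (cong halfᵛ (identity (vecᴾ (L [+] # 3) ([-] # 1) ([-] # 1) (# 1)) (coords ∘ᵛ d⁻) refl v))))

    TP-b⁻ : ∀ v → TP (b⁻ $ v)
    TP-b⁻ v = TP-negate (TP-b⁺ v)

    TP-b⁰⁺ : ∀ v → TP (b⁰⁺ $ v)
    TP-b⁰⁺ v = subst TP (identity (swap ∘ᵛ b⁺) b⁰⁺ refl v) (TP-symmetry swapˢ (TP-b⁺ v))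

    TP-a⁰⁺ : ∀ v → TP (a⁰⁺ $ v)
    TP-a⁰⁺ v = TP-negate (TP-a⁰⁻ v)

    TP-a⁺ : ∀ v → TP (a⁺ $ v)
    TP-a⁺ v = subst TP (identity (swap ∘ᵛ a⁰⁻) a⁺ refl v) (TP-symmetry swapˢ (TP-a⁰⁻ v))

    TP-d⁺ : ∀ v → TP (d⁺ $ v)
    TP-d⁺ v = TP-negate (TP-d⁻ v)

    TP-d⁰⁻ : ∀ v → TP (d⁰⁻ $ v)
    TP-d⁰⁻ v = subst TP (identity (swap ∘ᵛ d⁻) d⁰⁻ refl v) (TP-symmetry swapˢ (TP-d⁻ v))

    private
      TP-≡ : ∀ {v w} → v ≡ w → TP v → TP w
      TP-≡ refl p = p

    NonNegᵛ : V → Set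
    NonNegᵛ v = TP v ⊎ v ≡ 0ᵛ

    nonNeg-+ : ∀ {v w} → NonNegᵛ v → NonNegᵛ w → NonNegᵛ (v +ᵛ w)
    nonNeg-+ {v} {w} (inj₁ p) (inj₁ p′) = inj₁ (TP-+ {v} {w} p p′)
    nonNeg-+ {v@(vec X Y I J)} (inj₁ p) (inj₂ refl) = inj₁ (TP-≡ {v} (vec-cong (sym (ℤ.+-identityʳ X)) (sym (ℤ.+-identityʳ Y)) (sym (ℤ.+-identityʳ I)) (sym (ℤ.+-identityʳ J))) p)
    nonNeg-+ {w = w@(vec X Y I J)} (inj₂ refl) (inj₁ p) = inj₁ (TP-≡ {w} (vec-cong (sym (ℤ.+-identityˡ X)) (sym (ℤ.+-identityˡ Y)) (sym (ℤ.+-identityˡ I)) (sym (ℤ.+-identityˡ J))) p)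
    nonNeg-+ (inj₂ refl) (inj₂ refl) = inj₂ refl

    nonNeg-• : ∀ {k v} → + 0 ℤ.≤ k → TP v → NonNegᵛ (k • v)
    nonNeg-• {+ zero} _ _ = inj₂ refl
    nonNeg-• {+ suc k} {v} _ p = inj₁ (TP-• {+ suc k} {v} (ℤ.+<+ (s≤s z≤n)) p)

    nonNeg⇒TP : ∀ {v} → NonNegᵛ v → + 0 ℤ.< heightᴮ v → TP v
    nonNeg⇒TP (inj₁ p) _ = p
    nonNeg⇒TP (inj₂ refl) h = ⊥-elim (ℤ.<-irrefl refl h)

    nonNeg-•⊢ : ∀ {v e} g → v ⊢ e → TP (g $ v) → NonNegᵛ ((e •ᴾ g) $ v)
    nonNeg-•⊢ {v} {e} g (cert c) p = nonNeg-• {⟦ e ⟧ (env v)} {g $ v} c p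

    -- The right end of the slice of the cone through v in direction I.
    RightEnd : V → Set
    RightEnd v = ∃[ e ] (v ⊢ e [-] I × TP (vecᴾ X Y e J $ v))

    private
      endpoint : ∀ {v} e {k₁ k₂ k₃} g₁ g₂ g₃ → v ⊢ e [-] I → v ⊢ k₁ → TP (g₁ $ v) → v ⊢ k₂ → TP (g₂ $ v) → v ⊢ k₃ → TP (g₃ $ v)
        → + 0 ℤ.< heightᴮ v → (∀ {ρ} → ⟦ vecᴾ X Y e J ⟧ᵛ↓ ρ ≡ ⟦ k₁ •ᴾ g₁ +ᴾ k₂ •ᴾ g₂ +ᴾ k₃ •ᴾ g₃ ⟧ᵛ↓ ρ) → RightEnd v
      endpoint {v} e {k₁} {k₂} {k₃} g₁ g₂ g₃ le c₁ p₁ c₂ p₂ c₃ p₃ h eq = e , le , nonNeg⇒TP {vecᴾ X Y e J $ v} (subst NonNegᵛ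
        (sym (identity (vecᴾ X Y e J) (k₁ •ᴾ g₁ +ᴾ k₂ •ᴾ g₂ +ᴾ k₃ •ᴾ g₃) eq v))
        (nonNeg-+ (nonNeg-+ (nonNeg-•⊢ g₁ c₁ p₁) (nonNeg-•⊢ g₂ c₂ p₂)) (nonNeg-•⊢ g₃ c₃ p₃))) h

    -- As J grows, the upper bound on I is given in turn by `c₃⁺`, `c₂⁺`, `c₅⁺` and `c₄⁺`, with
    -- breaks at J = -X, Y - X and Y. On each stretch the boundary point is a combination of three
    -- vertices whose coefficients are non-negative there.
    rightEnd : ∀ {v} → InCone v → + 0 ℤ.< heightᴮ v → RightEnd v
    rightEnd {v} (inCone f) pos =
      decide v (X [+] J)
        (λ h → endpoint (Y [+] M [*] (X [+] J)) b⁻ d⁰⁻ a⁰⁺ (by (f c₃⁺) refl)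
          (f x≥0) (TP-b⁻ v) (by {e′ = # 0 [-] X [-] J} (h ∔ lit 1) refl) (TP-d⁰⁻ v) (f c₁⁻) (TP-a⁰⁺ v) pos refl) λ h →
      decide v (Y [-] X [-] J)
        (λ h′ → decide v (Y [-] J)
          (λ h → endpoint (X [+] M [*] Y) b⁰⁺ a⁺ d⁺ (f c₄⁺)
            (f y≥0) (TP-b⁰⁺ v) (f c₁⁺) (TP-a⁺ v) (by {e′ = J [-] Y} (h ∔ lit 1) refl) (TP-d⁺ v) pos refl)
          (λ h → endpoint (X [+] L [*] Y [+] J) b⁰⁺ b⁻ a⁺ (by (f c₅⁺) refl)
            (f y≥0) (TP-b⁰⁺ v) h (TP-b⁻ v) (by {e′ = X [-] Y [+] J} (h′ ∔ lit 1) refl) (TP-a⁺ v) pos refl))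
        (λ h′ → endpoint (Y [+] L [*] (X [+] J)) b⁻ a⁰⁺ b⁰⁺ (by (f c₂⁺) refl)
          (f x≥0) (TP-b⁻ v) h′ (TP-a⁰⁺ v) h (TP-b⁰⁺ v) pos refl)

    pos*pos : ∀ x y → + 0 ℤ.< x → + 0 ℤ.< y → + 0 ℤ.< x ℤ.* y
    pos*pos (+ suc x) (+ suc y) _ _ = ℤ.+<+ (s≤s z≤n)
    pos*pos (+ zero) _ (ℤ.+<+ ()) _
    pos*pos (+ suc _) (+ zero) _ (ℤ.+<+ ())

    -- Convexity without fractions: the vector is first multiplied by the length H - H′ of the
    -- segment, which is divided out at the end. A segment of length 0 is treated apart.
    TP-between : ∀ {X Y i j} H H′ → + 0 ℤ.< X ℤ.+ Y → + 0 ℤ.≤ H ℤ.- i → TP (vec X Y H j) → + 0 ℤ.≤ i ℤ.- H′ → TP (vec X Y H′ j) → TP (vec X Y i j)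
    TP-between {X} {Y} {i} {j} H H′ pos h p h′ p′ = choose ((H ℤ.- i) ℤ.+ (i ℤ.- H′)) refl (ℤ.+-mono-≤ h h′)
      where
      v = vec X Y i j
      choose : ∀ k → k ≡ (H ℤ.- i) ℤ.+ (i ℤ.- H′) → + 0 ℤ.≤ k → TP v
      choose (+ zero) eq _ = TP-≡ {vec X Y H j} (vec-cong refl refl (ℤ.i-j≡0⇒i≡j H i (zero-summand (H ℤ.- i) (i ℤ.- H′) h h′ (sym eq))) refl) p
        where
        zero-summand : ∀ x y → + 0 ℤ.≤ x → + 0 ℤ.≤ y → x ℤ.+ y ≡ + 0 → x ≡ + 0
        zero-summand (+ zero) _ _ _ _ = refl
        zero-summand (+ suc x) (+ y) _ _ ()
      choose k@(+ suc _) eq _ = TP-•⁻¹ {k} {v} (ℤ.+<+ (s≤s z≤n)) (TP-≡ {(i ℤ.- H′) • vec X Y H j +ᵛ (H ℤ.- i) • vec X Y H′ j} (vec-cong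
          (trans (solveℤ 4 (λ H H′ i X → (i [-] H′) [*] X [+] (H [-] i) [*] X [=] ((H [-] i) [+] (i [-] H′)) [*] X) refl H H′ i X) (cong (ℤ._* X) (sym eq)))
          (trans (solveℤ 4 (λ H H′ i X → (i [-] H′) [*] X [+] (H [-] i) [*] X [=] ((H [-] i) [+] (i [-] H′)) [*] X) refl H H′ i Y) (cong (ℤ._* Y) (sym eq)))
          (trans (solveℤ 3 (λ H H′ i → (i [-] H′) [*] H [+] (H [-] i) [*] H′ [=] ((H [-] i) [+] (i [-] H′)) [*] i) refl H H′ i) (cong (ℤ._* i) (sym eq)))
          (trans (solveℤ 4 (λ H H′ i X → (i [-] H′) [*] X [+] (H [-] i) [*] X [=] ((H [-] i) [+] (i [-] H′)) [*] X) refl H H′ i j) (cong (ℤ._* j) (sym eq))))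
        (nonNeg⇒TP {(i ℤ.- H′) • vec X Y H j +ᵛ (H ℤ.- i) • vec X Y H′ j}
          (nonNeg-+ {(i ℤ.- H′) • vec X Y H j} {(H ℤ.- i) • vec X Y H′ j} (nonNeg-• {i ℤ.- H′} {vec X Y H j} h′ p) (nonNeg-• {H ℤ.- i} {vec X Y H′ j} h p′))
          (subst (+ 0 ℤ.<_) (trans (cong (ℤ._* (X ℤ.+ Y)) eq) (solveℤ 5 (λ H H′ i X Y → ((H [-] i) [+] (i [-] H′)) [*] (X [+] Y) [=] ((i [-] H′) [*] X [+] (H [-] i) [*] X) [+] ((i [-] H′) [*] Y [+] (H [-] i) [*] Y)) refl H H′ i X Y))
            (pos*pos k (X ℤ.+ Y) (ℤ.+<+ (s≤s z≤n)) pos))))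

    -- The left end of the slice is the negative of the right end for the centrally reflected
    -- vector.
    cone⇒TP : ∀ {v} → InCone v → + 0 ℤ.< heightᴮ v → TP v
    cone⇒TP {v@(vec x y i j)} c pos =
      let e , h , p = rightEnd c pos
          e′ , h′ , p′ = rightEnd (cone-neg c) pos
          z′ = ⟦ e′ ⟧ (env (negate $ v))
      in TP-between {x} {y} {i} {j} (⟦ e ⟧ (env v)) (ℤ.- z′) pos (nonneg h) p
           (subst (+ 0 ℤ.≤_) (solveℤ 2 (λ i z → z [-] [-] i [=] i [-] [-] z) refl i z′) (nonneg h′))
           (TP-≡ {vec x y (ℤ.- z′) (ℤ.- (ℤ.- j))} (vec-cong refl refl refl (ℤ.neg-involutive j)) (TP-negate p′))

-- Decomposition in the simplex cone and descent on the height.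

module HeightDescent where
  open RingSolving
  open Rationals
  open FieldOrder
  open Integrality
  open AlgebraicIntegers
  open LatticeCoordinates
  open Certificates
  open HexagonCone
  open CodifferentElements
  open FacetCones

  module Descent (S : Setting) where
    open Setting S using (ν)
    open Lattice S
    open Facets S
    open Cones S

    -- The coordinates, multiplied by m₁, with respect to the vertices 1, ε_p, ε_q, ε_p ε_q of the simplex.
    τ₁ τ₂ τ₃ τ₄ : Poly 5
    τ₁ = (L [*] L [+] L [-] # 1) [*] (X [-] J) [+] L [*] (Y [+] I)
    τ₂ = L [*] J [-] X [-] Y [-] I
    τ₃ = # 0 [-] L [*] (X [-] J) [-] Y [-] I
    τ₄ = X [-] J [+] L [*] Y [+] I

    record InSimplex (v : V) : Set where
      constructor inSimplex
      field
        t₁ : v ⊢ τ₁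
        t₂ : v ⊢ τ₂
        t₃ : v ⊢ τ₃
        t₄ : v ⊢ τ₄

    simplex⇒TP : ∀ {v} → InSimplex v → + 0 ℤ.< heightᴬ v → TP v
    simplex⇒TP {v} (inSimplex t₁ t₂ t₃ t₄) pos = conclude
        (nonNeg-+ (nonNeg-+ (nonNeg-+ (nonNeg-•⊢ 𝟙 t₁ (TP-𝟙 v)) (nonNeg-•⊢ b⁺ t₂ (TP-b⁺ v))) (nonNeg-•⊢ ε-q t₃ (TP-ε-q v))) (nonNeg-•⊢ a⁰⁻ t₄ (TP-a⁰⁻ v)))
      where
      open ≡.≡-Reasoning
      w multiple : Vᴾ 5
      w = τ₁ •ᴾ 𝟙 +ᴾ τ₂ •ᴾ b⁺ +ᴾ τ₃ •ᴾ ε-q +ᴾ τ₄ •ᴾ a⁰⁻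
      multiple = (L [-] # 1) •ᴾ id
      eq : w $ v ≡ multiple $ v
      eq = identity w multiple refl v
      l-1>0 : + 0 ℤ.< l ℤ.- + 1
      l-1>0 = positive {v} (L [-] # 1) (by (l≥12 ∔ lit 10) refl)
      conclude : NonNegᵛ (w $ v) → TP v
      conclude (inj₁ p) = TP-•⁻¹ {l ℤ.- + 1} l-1>0 (subst TP eq p)
      -- A vanishing combination would give m₁v, and with it v, the height 0.
      conclude (inj₂ z) = ⊥-elim (ℤ.<-irrefl (sym (begin
          (l ℤ.- + 1) ℤ.* heightᴬ v  ≡⟨ proveℤ (env v) ((L [-] # 1) [*] hᴬ) (hᴬ ∘ multiple) refl ⟩
          heightᴬ (multiple $ v)     ≡⟨ cong heightᴬ (trans (sym eq) z) ⟩
          heightᴬ 0ᵛ                 ≡⟨ proveℤ (env v) (hᴬ ∘ vecᴾ (# 0) (# 0) (# 0) (# 0)) (# 0) refl ⟩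
          + 0                        ∎)) (pos*pos (l ℤ.- + 1) (heightᴬ v) l-1>0 pos))

    private
      cancel : ∀ v w → v ≡ w +ᵛ (v -ᵛ w)
      cancel (vec X Y I J) (vec X′ Y′ I′ J′) = vec-cong (go X X′) (go Y Y′) (go I I′) (go J J′)
        where
        go : ∀ i w → i ≡ w ℤ.+ (i ℤ.- w)
        go = solveℤ 2 (λ i w → i [=] w [+] (i [-] w)) refl

      subtract : ∀ {v} g → TP (g $ v) → v ⊢ τ₁ ∘ (id -ᴾ g) → v ⊢ τ₂ ∘ (id -ᴾ g) → v ⊢ τ₃ ∘ (id -ᴾ g) → v ⊢ τ₄ ∘ (id -ᴾ g)
        → v ⊢ (hᴬ [-] # 1) ∘ (id -ᴾ g) → Decomposable v
      subtract {v} g p c₁ c₂ c₃ c₄ h = g $ v , (id -ᴾ g) $ v , p ,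
        simplex⇒TP (inSimplex (at r c₁) (at r c₂) (at r c₃) (at r c₄)) (positive {r $ v} hᴬ (at r h)) , cancel v (g $ v)
        where r = id -ᴾ g

    -- t₁ + t₃ and t₂ + t₄ are integers (in units of m₁) with sum the height.
    split-simplex : ∀ {v} → InSimplex v → v ⊢ hᴬ [-] # 3 → Decomposable v
    split-simplex {v} (inSimplex t₁ t₂ t₃ t₄) h =
      -- The form tested is (τ₁ + τ₃)/m₁. With height at least 3 one of the two sums is at least 2,
      -- so one of its terms is at least 1, that is m₁ after scaling, and the vertex belonging to it
      -- is subtracted.
      decide v (M [*] (X [-] J) [+] Y [+] I [-] # 2)
        (λ e → decide v (τ₂ [-] (L [-] # 1))
          (λ t → subtract a⁰⁻ (TP-a⁰⁻ v) (by t₁ refl) (by t₂ refl) (by t₃ refl) (by (l≥1 ∙ (h ∔ e) ∔ t ∔ lit 1) refl) (by (h ∔ lit 1) refl))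
          (λ t → subtract b⁺ (TP-b⁺ v) (by t₁ refl) (by t refl) (by t₃ refl) (by t₄ refl) (by (h ∔ lit 1) refl)))
        (λ e → decide v (τ₁ [-] (L [-] # 1))
          (λ t → subtract ε-q (TP-ε-q v) (by t₁ refl) (by t₂ refl) (by (l≥1 ∙ e ∔ t ∔ lit 1) refl) (by t₄ refl) (by (h ∔ lit 1) refl))
          (λ t → subtract 𝟙 (TP-𝟙 v) (by t refl) (by t₂ refl) (by t₃ refl) (by t₄ refl) (by (h ∔ lit 1) refl)))

    split-cone : ∀ {v} → InCone v → v ⊢ X [-] # 2 → Decomposable v
    split-cone {v} c@(inCone f) h =
      let i , j , g , r = split c h
          w = vec (+ 1) (+ 0) i j
      in w , v -ᵛ w , cone⇒TP g (ℤ.+<+ (s≤s z≤n)) ,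
         cone⇒TP r (positive {v} (X [-] # 1 [+] (Y [-] # 0)) (by (h ∔ f y≥0) refl)) , cancel v w

    good-negate : ∀ {v} → Good (negate $ v) → Good v
    good-negate {v} p = good-symmetry turnˢ (good-symmetry swapˢ (subst Good (sym (identity (swap ∘ᵛ turn) negate refl v)) p))

    Bounded : ℕ → Poly 5 → V → Set
    Bounded N h v = + 0 ℤ.≤ + N ℤ.- ⟦ h ⟧ (env v)

    private
      -- `d` is the drop in height on passing to the neighbouring facet; being at least 1, it pays
      -- for one unit of the bound.
      descend : ∀ {N h v} h′ p d → Bounded (suc N) h v → v ⊢ d [-] # 1 → (∀ {ρ} → ⟦ h′ ∘ p [+] d ⟧↓ ρ ≡ ⟦ h ⟧↓ ρ) → Bounded N h′ (p $ v)
      descend {N} {h} {v} h′ p d b (cert c) eq = subst (+ 0 ℤ.≤_) (begin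
          + suc N ℤ.- ⟦ h ⟧ (env v) ℤ.+ (D ℤ.- + 1)    ≡⟨ cong (λ z → + suc N ℤ.- z ℤ.+ (D ℤ.- + 1)) (proveℤ (env v) (h′ ∘ p [+] d) h eq) ⟨
          + suc N ℤ.- (H ℤ.+ D) ℤ.+ (D ℤ.- + 1)        ≡⟨ solveℤ 3 (λ N H D → (# 1 [+] N) [-] (H [+] D) [+] (D [-] # 1) [=] N [-] H) refl (+ N) H D ⟩
          + N ℤ.- H                                    ≡⟨ cong (λ z → + N ℤ.- z) (∘-$ h′ p v) ⟩
          + N ℤ.- ⟦ h′ ⟧ (env (p $ v))                 ∎)
        (ℤ.+-mono-≤ b c)
        where
        open ≡.≡-Reasoning
        D = ⟦ d ⟧ (env v)
        H = ⟦ h′ ∘ p ⟧ (env v)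

      -- Across a wall between two copies of the hexagon facet the height drops by m₁ = l - 1 times
      -- the violation.
      far : ∀ {v} e → v ⊢ [-] e [-] # 1 → v ⊢ (L [-] # 1) [*] ([-] e) [-] # 1
      far {v} e c = cert (subst (+ 0 ℤ.≤_)
        (solveℤ 2 (λ l e → (l [-] # 1) [*] ([-] e [-] # 1) [+] ((l [-] # 12) [+] # 10) [=] (l [-] # 1) [*] ([-] e) [-] # 1) refl l (⟦ e ⟧ (env v)))
        (ℤ.+-mono-≤ (nonneg (l≥1 {v} ∙ c)) (nonneg (l≥12 {v} ∔ lit {v} 10))))

    -- Each violated inequality of a facet cone leads to a neighbouring facet at which the height is smaller.
    module Step (N : ℕ) (ihᴬ : ∀ v → TP v → Bounded N hᴬ v → Good v) (ihᴮ : ∀ v → TP v → Bounded N hᴮ v → Good v) where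

      private
        Step : Poly 5 → Poly 5 → Set
        Step h e = ∀ {v} → TP v → Bounded (suc N) h v → v ⊢ [-] e [-] # 1 → Good v

        via-negate : ∀ e {e′} → Step hᴮ e → (∀ {v} → v ⊢ [-] e′ [-] # 1 → v ⊢ ([-] e [-] # 1) ∘ negate) → Step hᴮ e′
        via-negate e step flip {v} p b h = good-negate (step (TP-negate p) b (at negate (flip h)))

        via-swap : ∀ e {e′} → Step hᴮ e → (∀ {v} → v ⊢ [-] e′ [-] # 1 → v ⊢ ([-] e [-] # 1) ∘ swap) → Step hᴮ e′
        via-swap e step flip {v} p b h = good-symmetry swapˢ
          (step (TP-symmetry swapˢ p) (subst (λ z → + 0 ℤ.≤ + suc N ℤ.- z) (ℤ.+-comm (V.X v) (V.Y v)) b) (at swap (flip h)))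

        step-x : Step hᴮ (face x≥0)
        step-x {v} p b h = good-symmetry reflect₁ˢ (good-symmetry reflect₄ˢ (ihᴮ _ (TP-symmetry reflect₄ˢ (TP-symmetry reflect₁ˢ p))
          (descend {h = hᴮ} {v} hᴮ (reflect₄ ∘ᵛ reflect₁) ((L [-] # 1) [*] ([-] X)) b (far X h) refl)))

        step-c₁⁻ : Step hᴮ (face c₁⁻)
        step-c₁⁻ {v} p b h = good-symmetry reflect₁ˢ (ihᴮ _ (TP-symmetry reflect₁ˢ p)
          (descend {h = hᴮ} {v} hᴮ reflect₁ ((L [-] # 1) [*] ([-] face c₁⁻)) b (far (face c₁⁻) h) refl))

        step-c₄⁻ : Step hᴮ (face c₄⁻)
        step-c₄⁻ {v} p b h = good-symmetry reflect₄ˢ (ihᴮ _ (TP-symmetry reflect₄ˢ p)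
          (descend {h = hᴮ} {v} hᴮ reflect₄ ((L [-] # 1) [*] ([-] face c₄⁻)) b (far (face c₄⁻) h) refl))

        -- This wall is the triangle 1, ε_p, ε_p ε_q shared with the simplex: `c₂⁻` is -τ₃. So no
        -- symmetry is applied, and the two heights differ by exactly the violation.
        step-c₂⁻ : Step hᴮ (face c₂⁻)
        step-c₂⁻ {v} p b h = ihᴬ v p (descend {h = hᴮ} {v} hᴬ id ([-] face c₂⁻) b h refl)

        step-c₂⁺ : Step hᴮ (face c₂⁺)
        step-c₂⁺ = via-negate (face c₂⁻) step-c₂⁻ (λ h → by h refl)

        step-c₄⁺ : Step hᴮ (face c₄⁺)
        step-c₄⁺ = via-negate (face c₄⁻) step-c₄⁻ (λ h → by h refl)

        -- `negate` and `swap` preserve `hᴮ` and permute the twelve walls in four orbits,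
        -- represented by `x≥0`, `c₁⁻`, `c₂⁻` and `c₄⁻`.
        step : ∀ c → Step hᴮ (face c)
        step x≥0 = step-x
        step y≥0 = via-swap X step-x (λ h → by h refl)
        step c₁⁻ = step-c₁⁻
        step c₁⁺ = via-negate (face c₁⁻) step-c₁⁻ (λ h → by h refl)
        step c₂⁻ = step-c₂⁻
        step c₂⁺ = step-c₂⁺
        step c₃⁺ = via-swap (face c₄⁻) step-c₄⁻ (λ h → by h refl)
        step c₃⁻ = via-swap (face c₄⁺) step-c₄⁺ (λ h → by h refl)
        step c₄⁻ = step-c₄⁻
        step c₄⁺ = step-c₄⁺
        step c₅⁺ = via-swap (face c₂⁻) step-c₂⁻ (λ h → by h refl)
        step c₅⁻ = via-swap (face c₂⁺) step-c₂⁺ (λ h → by h refl)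

        inside : ∀ {v} → InCone v → Good v
        -- If neither height reaches 2, then X + Y ≤ 2, and `δᴮ` itself is the required functional.
        inside {v} c = decide v (X [-] # 2)
          (λ h → decide v (Y [-] # 2)
            (λ h′ → inj₂ (shortᴮ (ℤ.0≤i-j⇒j≤i (nonneg (by {v} {e′ = # 2 [-] hᴮ} (h ∔ h′) refl)))))
            (λ h′ → good-symmetry swapˢ (inj₁ (split-cone (cone-swap c) (at swap h′)))))
          (λ h → inj₁ (split-cone c h))

      stepᴮ : ∀ v → TP v → Bounded (suc N) hᴮ v → Good v
      stepᴮ v p b =
        try x≥0 λ x → try y≥0 λ y → try c₁⁺ λ q₁⁺ → try c₁⁻ λ q₁⁻ → try c₂⁺ λ q₂⁺ → try c₂⁻ λ q₂⁻ →
        try c₃⁺ λ q₃⁺ → try c₃⁻ λ q₃⁻ → try c₄⁺ λ q₄⁺ → try c₄⁻ λ q₄⁻ → try c₅⁺ λ q₅⁺ → try c₅⁻ λ q₅⁻ →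
        inside (inCone λ
          { x≥0 → x ; y≥0 → y ; c₁⁺ → q₁⁺ ; c₁⁻ → q₁⁻ ; c₂⁺ → q₂⁺ ; c₂⁻ → q₂⁻
          ; c₃⁺ → q₃⁺ ; c₃⁻ → q₃⁻ ; c₄⁺ → q₄⁺ ; c₄⁻ → q₄⁻ ; c₅⁺ → q₅⁺ ; c₅⁻ → q₅⁻ })
        where
        try : ∀ c → (v ⊢ face c → Good v) → Good v
        try c = decide v (face c) (step c p b)

      private
        -- Beyond each of the four walls of the simplex lies a copy of the hexagon facet, and the
        -- height drops by exactly the violation.
        step-t₁ : Step hᴬ τ₁
        step-t₁ {v} p b h = good-symmetry simplex₂ˢ (ihᴮ _ (TP-symmetry simplex₂ˢ p) (descend {h = hᴬ} {v} hᴮ simplex₂ ([-] τ₁) b h refl))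

        step-t₂ : Step hᴬ τ₂
        step-t₂ {v} p b h = good-symmetry simplex₂ˢ (good-symmetry simplex₁ˢ (ihᴮ _ (TP-symmetry simplex₁ˢ (TP-symmetry simplex₂ˢ p))
          (descend {h = hᴬ} {v} hᴮ (simplex₁ ∘ᵛ simplex₂) ([-] τ₂) b h refl)))

        step-t₃ : Step hᴬ τ₃
        step-t₃ {v} p b h = ihᴮ v p (descend {h = hᴬ} {v} hᴮ id ([-] τ₃) b h refl)

        step-t₄ : Step hᴬ τ₄
        step-t₄ {v} p b h = good-symmetry simplex₁ˢ (ihᴮ _ (TP-symmetry simplex₁ˢ p) (descend {h = hᴬ} {v} hᴮ simplex₁ ([-] τ₄) b h refl))

      stepᴬ : ∀ v → TP v → Bounded (suc N) hᴬ v → Good v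
      stepᴬ v p b =
        decide v τ₁ (step-t₁ p b) λ t₁ → decide v τ₂ (step-t₂ p b) λ t₂ → decide v τ₃ (step-t₃ p b) λ t₃ → decide v τ₄ (step-t₄ p b) λ t₄ →
        decide v (hᴬ [-] # 3)
          (λ h → inj₂ (shortᴬ {v} (ℤ.0≤i-j⇒j≤i (nonneg (by {v} {e′ = # 2 [-] hᴬ} h refl)))))
          (λ h → inj₁ (split-simplex (inSimplex t₁ t₂ t₃ t₄) h))

    private
      exhausted : ∀ {h} → + 0 ℤ.< h → ¬ (+ 0 ℤ.≤ + 0 ℤ.- h)
      exhausted {h} pos le = ℤ.<-irrefl refl (ℤ.<-≤-trans pos (ℤ.0≤i-j⇒j≤i le))

    mutual
      -- One bound serves both heights, since a step may change the facet. The bound 0 is impossible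
      -- because heights are positive.
      goodᴬ : ∀ N v → TP v → Bounded N hᴬ v → Good v
      goodᴬ zero v p b = ⊥-elim (exhausted (heightᴬ-pos p) b)
      goodᴬ (suc N) = Step.stepᴬ N (goodᴬ N) (goodᴮ N)

      goodᴮ : ∀ N v → TP v → Bounded N hᴮ v → Good v
      goodᴮ zero v p b = ⊥-elim (exhausted (heightᴮ-pos p) b)
      goodᴮ (suc N) = Step.stepᴮ N (goodᴬ N) (goodᴮ N)

    good : ∀ v → TP v → Good v
    good v p = goodᴮ ℤ.∣ heightᴮ v ∣ v p (ℤ.i≤j⇒0≤j-i (ℤ.≤-reflexive (sym (ℤ.0≤i⇒+∣i∣≡i (ℤ.<⇒≤ (heightᴮ-pos p))))))

-- From the abstract setting to the statement.

module Final where
  open RingSolving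
  open Rationals
  open Multiplication
  open FieldOrder
  open Integrality
  open AlgebraicIntegers
  open Certificates
  open LatticeCoordinates
  open HexagonCone
  open CodifferentElements
  open FacetCones
  open HeightDescent

  module Conclusion (S : Setting) where
    open Setting S
    open Biquadratic S
    open Integers S
    open Lattice S
    open Facets S
    open Descent S

    AlgebraicInteger : K → Set
    AlgebraicInteger x = ∃[ cs ] (eval cs x ≡ zeroK n)

    coordinates : ∀ {x} → AlgebraicInteger x → ∃[ v ] (x ≡ ι v)
    coordinates (cs , root) =
      let A , B , C , D , e = almostIntegral⇒lattice (root⇒almostIntegral cs root)
          v , e′ = lattice-surjective A B C D
      in v , trans e e′

    -- The entries of `coords` have the shape 2A + C, 2B + D, C, D, from which the lattice
    -- coordinates are read off.
    ι-algebraic : ∀ v → AlgebraicInteger (ι v)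
    ι-algebraic (vec X Y I J) = lattice⇒root (m ℤ.* X ℤ.+ m ℤ.* ν ℤ.* Y ℤ.+ ν ℤ.* I ℤ.- J) (Y ℤ.+ J) (m ℤ.* Y ℤ.+ I) (X ℤ.+ l ℤ.* Y ℤ.+ I ℤ.- J)

    short-codifferent : ∀ α → AlgebraicInteger α → TotallyPositive α
      → ¬ (∃[ β ] ∃[ γ ] (AlgebraicInteger β × TotallyPositive β × AlgebraicInteger γ × TotallyPositive γ × α ≡ _⊕_ n β γ))
      → ∃[ δ ] ((∀ β → AlgebraicInteger β → Integral (Tr n (β · δ))) × TotallyPositive δ × Tr n (α · δ) ℚ.≤ ℕ→ℚ 2)
    short-codifferent α alg pos indecomposable = conclude (coordinates alg)
      where
      conclude : ∃[ v ] (α ≡ ι v) → ∃[ δ ] ((∀ β → AlgebraicInteger β → Integral (Tr n (β · δ))) × TotallyPositive δ × Tr n (α · δ) ℚ.≤ ℕ→ℚ 2)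
      conclude (v , α≡) = finish (good v (tp (subst TotallyPositive α≡ pos)))
        where
        finish : Good v → ∃[ δ ] ((∀ β → AlgebraicInteger β → Integral (Tr n (β · δ))) × TotallyPositive δ × Tr n (α · δ) ℚ.≤ ℕ→ℚ 2)
        finish (inj₁ (w , w′ , tp p , tp p′ , eq)) = ⊥-elim (indecomposable (ι w , ι w′ , ι-algebraic w , p , ι-algebraic w′ , p′ ,
          trans α≡ (trans (cong ι eq) (ι-+ w w′))))
        finish (inj₂ (δ , cod , p , le)) = δ , (λ β algβ → let w , β≡ = coordinates algβ in subst (λ β → Integral (Tr n (β · δ))) (sym β≡) (cod w)) , p ,
          subst (λ α → Tr n (α · δ) ℚ.≤ ℕ→ℚ 2) (sym α≡) le

  setting : (n : ℕ) → 6 ≤ n → SquareFree (pN n) → SquareFree (qN n) → SquareFree (rN n) → Setting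
  setting n 6≤n sfp sfq sfr = record
    { n = n ; ν = + n
    ; M₁ = ℕ→ℚ (m₁ n) ; M₂ = ℕ→ℚ (m₂ n) ; M₃ = ℕ→ℚ (m₃ n) ; P = ℕ→ℚ (pN n) ; Q = ℕ→ℚ (qN n) ; R = ℕ→ℚ (rN n)
    ; M₁≡ = cong ℤ→ℚ (trans (sym (ℤ.⊖-≥ 1≤2n)) (trans (sym (ℤ.m-n≡m⊖n (2 ℕ.* n) 1)) (cong (ℤ._- + 1) (ℤ.pos-* 2 n))))
    ; M₂≡ = cong ℤ→ℚ (trans (ℤ.pos-+ (2 ℕ.* n) 1) (cong (ℤ._+ + 1) (ℤ.pos-* 2 n)))
    ; M₃≡ = cong ℤ→ℚ (trans (ℤ.pos-+ (2 ℕ.* n) 3) (cong (ℤ._+ + 3) (ℤ.pos-* 2 n)))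
    ; P≡ = ℕ→ℚ-* (m₁ n) (m₂ n) ; Q≡ = ℕ→ℚ-* (m₁ n) (m₃ n) ; R≡ = ℕ→ℚ-* (m₂ n) (m₃ n)
    ; 6≤ν = ℤ.+≤+ 6≤n
    ; M₁>0 = pos (1≤ 2≤m₁) ; M₂>0 = pos (1≤ 2≤m₂) ; M₃>0 = pos (1≤ 2≤m₃) ; P>0 = pos (1≤ 2≤pN) ; Q>0 = pos (1≤ 2≤qN)
    ; nonsquare-p = squareFree⇒nonsquare sfp 2≤pN
    ; nonsquare-q = squareFree⇒nonsquare sfq 2≤qN
    ; nonsquare-r = squareFree⇒nonsquare sfr (ℕ.*-mono-≤ 2≤m₂ (1≤ 2≤m₃))
    ; integral-p = squareFree⇒integral sfp
    ; integral-q = squareFree⇒integral sfq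
    ; integral-r = squareFree⇒integral sfr
    }
    where
    ℕ→ℚ-* : ∀ k l → ℕ→ℚ (k ℕ.* l) ≡ ℕ→ℚ k ℚ.* ℕ→ℚ l
    ℕ→ℚ-* k l = trans (cong ℤ→ℚ (ℤ.pos-* k l)) (ℤ→ℚ-* (+ k) (+ l))
    pos : ∀ {k} → 1 ≤ k → 0ℚ ℚ.< ℕ→ℚ k
    pos le = ℤ→ℚ-mono-< (ℤ.+<+ le)
    1≤ : ∀ {k} → 2 ≤ k → 1 ≤ k
    1≤ = ℕ.≤-trans (s≤s z≤n)
    12≤2n : 12 ≤ 2 ℕ.* n
    12≤2n = ℕ.*-monoʳ-≤ 2 6≤n
    1≤2n : 1 ≤ 2 ℕ.* n
    1≤2n = ℕ.≤-trans (s≤s z≤n) 12≤2n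
    2≤m₁ : 2 ≤ m₁ n
    2≤m₁ = ℕ.≤-trans (s≤s (s≤s z≤n)) (ℕ.∸-monoˡ-≤ 1 12≤2n)
    2≤m₂ : 2 ≤ m₂ n
    2≤m₂ = ℕ.+-monoˡ-≤ 1 1≤2n
    2≤m₃ : 2 ≤ m₃ n
    2≤m₃ = ℕ.≤-trans (s≤s (s≤s z≤n)) (ℕ.m≤n+m 3 (2 ℕ.* n))
    2≤pN : 2 ≤ pN n
    2≤pN = ℕ.*-mono-≤ 2≤m₁ (1≤ 2≤m₂)
    2≤qN : 2 ≤ qN n
    2≤qN = ℕ.*-mono-≤ 2≤m₁ (1≤ 2≤m₃)

  module Specialise (n : ℕ) (6≤n : 6 ≤ n) (sfp : SquareFree (pN n)) (sfq : SquareFree (qN n)) (sfr : SquareFree (rN n)) where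
    private
      S = setting n 6≤n sfp sfq sfr
    open Biquadratic S
    open Integers S using (eval)
    open Conclusion S

    -- Product, positivity and trace of the statement agree with those of the setting by
    -- computation; only the recursive evaluation requires an induction.
    evalMonic≡eval : ∀ cs x → evalMonic n cs x ≡ eval cs x
    evalMonic≡eval [] x = refl
    evalMonic≡eval (z ∷ zs) x = cong (λ w → _⊕_ n (embℤ n z) (_⊛_ n x w)) (evalMonic≡eval zs x)

    inOK⇒algebraic : ∀ {x} → InOK n x → AlgebraicInteger x
    inOK⇒algebraic {x} (cs , root) = cs , trans (sym (evalMonic≡eval cs x)) root

    algebraic⇒inOK : ∀ {x} → AlgebraicInteger x → InOK n x
    algebraic⇒inOK {x} (cs , root) = cs , trans (evalMonic≡eval cs x) root

    convert : ∀ α → ∃[ δ ] ((∀ β → AlgebraicInteger β → Integral (Tr n (β · δ))) × TotallyPositive δ × Tr n (α · δ) ℚ.≤ ℕ→ℚ 2)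
      → ∃[ δ ] (InCodiff⁺ n δ × Tr n (_⊛_ n α δ) ℚ.≤ ℕ→ℚ 2)
    convert α (δ , cod , p , le) = δ , ((λ β iβ → cod β (inOK⇒algebraic iβ)) , conjugates p) , le

    refute : ∀ α → ¬ (∃[ β ] ∃[ γ ] (InOK⁺ n β × InOK⁺ n γ × α ≡ _⊕_ n β γ))
      → ¬ (∃[ β ] ∃[ γ ] (AlgebraicInteger β × TotallyPositive β × AlgebraicInteger γ × TotallyPositive γ × α ≡ _⊕_ n β γ))
    refute α indecomposable (β , γ , iβ , pβ , iγ , pγ , eq) =
      indecomposable (β , γ , (algebraic⇒inOK iβ , conjugates pβ) , (algebraic⇒inOK iγ , conjugates pγ) , eq)

    specialise : ∀ α → Indecomposable n α → ∃[ δ ] (InCodiff⁺ n δ × Tr n (_⊛_ n α δ) ℚ.≤ ℕ→ℚ 2)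
    specialise α ((inOK , pos) , indecomposable) =
      convert α (short-codifferent α (inOK⇒algebraic inOK) (totPos pos) (refute α indecomposable))

open Final

theorem1p4 : (n : ℕ) → 6 ≤ n → SquareFree (pN n) → SquareFree (qN n) → SquareFree (rN n)
    → (α : K) → Indecomposable n α
    → ∃[ δ ] (InCodiff⁺ n δ × Tr n (_⊛_ n α δ) ℚ.≤ ℕ→ℚ 2)
theorem1p4 n 6≤n sfp sfq sfr = Specialise.specialise n 6≤n sfp sfq sfr
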